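{- Let $T$ be a tree on $n\ge4$ vertices, let $v_1$ and $v_c$ be two non-adjacent vertices of $T$, let $v_1,v_2,\dots,v_c$ be the unique path in $T$ from $v_1$ to $v_c$ (so $c\ge3$), and let $G$ be the graph obtained from $T$ by adding the edge $v_1v_c$. Then $$\begin{aligned}\mathcal{K}(G)-\mathcal{K}(T)\ge\frac{1}{4cn(n-1)}\Big\{&-\tfrac{2}{3}(n+1)c^2(c^2-1)-8(n-c)\Big(-nc^2+\tfrac{c(c+1)}{6}\big((2n+1)c+n-1\big)\Big)\\&-8\left\lfloor\tfrac{n-c}{2}\right\rfloor\left\lceil\tfrac{n-c}{2}\right\rceil\big((n-1)(c-1)^2+c(c-1)\big)+4n(n-1)c(c-1)+2(n-1)c^2\Big\},\end{aligned}$$ with equality if and only if $T$ is formed from the path $v_1,v_2,\dots,v_c$ by appending $\lfloor\frac{n-c}{2}\rfloor$ pendent vertices at one of its end points and $\lceil\frac{n-c}{2}\rceil$ pendent vertices at the other end point.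
   Context: Kemeny's constant: for a connected graph $H$ with adjacency matrix $A$ and diagonal degree matrix $\Delta$, consider the random walk with transition matrix $\Delta^{ -1}A$, its stationary distribution $w=(w_k)$ and mean first passage times $m_{j,k}$; then $\mathcal{K}(H)=\sum_{k\neq j} m_{j,k}w_k$, which is independent of $j$. -}

module Defs where

open import Algebra.Bundles using (CommutativeRing)
open import Data.Bool.Base using (Bool; true; false; _∧_; _∨_; if_then_else_; T)
open import Data.Bool.Properties using (∨-comm)
open import Data.Empty using (⊥-elim)
open import Data.Fin.Base using (Fin; zero; suc; toℕ; fromℕ; inject₁)
open import Data.Fin.Properties using (_≟_)
open import Data.Integer.Base using (+_)
open import Data.Nat.Base as ℕ using (ℕ; zero; suc; ⌊_/2⌋; ⌈_/2⌉)
open import Data.Nat.Properties using (+-*-semiring)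
open import Data.Product.Base using (Σ-syntax; ∃-syntax; _×_)
open import Data.Rational.Base using (ℚ; 0ℚ; 1ℚ; _/_; _+_; _*_; _-_; -_; _≤_; _<_; ∣_∣)
open import Data.Rational.Properties using (+-*-commutativeRing)
open import Data.Sum.Base using (_⊎_; [_,_])
open import Function.Bundles using (_⇔_)
open import Function.Definitions using (Injective; Bijective)
open import Relation.Binary.Construct.Closure.ReflexiveTransitive using (Star)
open import Relation.Binary.PropositionalEquality using (_≡_; _≢_; refl; sym; trans; cong₂)
open import Relation.Nullary using (¬_; yes; no; does)

open import Algebra.Properties.Semiring.Sum (CommutativeRing.semiring +-*-commutativeRing) public
  using (sum; sum-syntax)
open import Algebra.Properties.Semiring.Sum +-*-semiring public
  using () renaming (sum to sumℕ)

ι : ℕ → ℚ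
ι k = + k / 1

-- recip 0 = 0 is a junk value.  It is never met below for connected graphs
-- on at least two vertices (their degrees are positive), nor in the bound
-- when n ≥ 2 and c ≥ 1.
recip : ℕ → ℚ
recip zero    = 0ℚ
recip (suc k) = + 1 / suc k

------------------------------------------------------------------------
-- Finite simple graphs

record Graph (n : ℕ) : Set where
  field
    adj        : Fin n → Fin n → Bool
    adj-sym    : ∀ i j → adj i j ≡ adj j i
    adj-irrefl : ∀ i → adj i i ≡ false

Adj : ∀ {n} → Graph n → Fin n → Fin n → Set
Adj H i j = T (Graph.adj H i j)

Connected : ∀ {n} → Graph n → Set
Connected H = ∀ i j → Star (Adj H) i j

-- A path with ℓ edges, hence ℓ + 1 distinct vertices.
record Path {n : ℕ} (H : Graph n) (ℓ : ℕ) (x y : Fin n) : Set where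
  field
    vertex    : Fin (suc ℓ) → Fin n
    injective : Injective _≡_ _≡_ vertex
    start     : vertex zero ≡ x
    end       : vertex (fromℕ ℓ) ≡ y
    step      : ∀ (i : Fin ℓ) → Adj H (vertex (inject₁ i)) (vertex (suc i))

-- A cycle (of length ℓ + 1 ≥ 3) is a path together with an edge joining its ends.
Acyclic : ∀ {n} → Graph n → Set
Acyclic H = ∀ ℓ x y → 2 ℕ.≤ ℓ → Path H ℓ x y → ¬ Adj H y x

IsTree : ∀ {n} → Graph n → Set
IsTree H = Connected H × Acyclic H

sameEdge : ∀ {n} → Fin n → Fin n → Fin n → Fin n → Bool
sameEdge x y i j = (does (i ≟ x) ∧ does (j ≟ y)) ∨ (does (j ≟ x) ∧ does (i ≟ y))

sameEdge-irrefl : ∀ {n} (x y : Fin n) → x ≢ y → ∀ i → sameEdge x y i i ≡ false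
sameEdge-irrefl x y x≢y i with i ≟ x | i ≟ y
... | yes i≡x | yes i≡y = ⊥-elim (x≢y (trans (sym i≡x) i≡y))
... | yes _   | no _    = refl
... | no _    | yes _   = refl
... | no _    | no _    = refl

addEdge : ∀ {n} (H : Graph n) (x y : Fin n) → x ≢ y → Graph n
addEdge H x y x≢y = record
  { adj        = λ i j → Graph.adj H i j ∨ sameEdge x y i j
  ; adj-sym    = λ i j → cong₂ _∨_ (Graph.adj-sym H i j)
                   (∨-comm (does (i ≟ x) ∧ does (j ≟ y)) (does (j ≟ x) ∧ does (i ≟ y)))
  ; adj-irrefl = λ i → cong₂ _∨_ (Graph.adj-irrefl H i) (sameEdge-irrefl x y x≢y i)
  }

------------------------------------------------------------------------
-- Random walks and Kemeny's constant

Matrix : ℕ → Set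
Matrix n = Fin n → Fin n → ℚ

degree : ∀ {n} → Graph n → Fin n → ℕ
degree H i = sumℕ (λ j → if Graph.adj H i j then 1 else 0)

-- Δ⁻¹A, where A is the adjacency and Δ the diagonal degree matrix.
transition : ∀ {n} → Graph n → Matrix n
transition H i j = recip (degree H i) * (if Graph.adj H i j then 1ℚ else 0ℚ)

sum≢ : ∀ {n} → Fin n → (Fin n → ℚ) → ℚ
sum≢ k f = sum (λ i → if does (i ≟ k) then 0ℚ else f i)

record IsStationary {n : ℕ} (P : Matrix n) (w : Fin n → ℚ) : Set where
  field
    nonNegative : ∀ k → 0ℚ ≤ w k
    normalised  : sum w ≡ 1ℚ
    invariant   : ∀ k → sum (λ j → w j * P j k) ≡ w k

-- firstPassage P k t j is the probability that the chain started at j is at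
-- k at time t ≥ 1 and at none of the times 1, …, t - 1 (the start does not
-- count as a passage); the recursion conditions on the first step.
firstPassage : ∀ {n} → Matrix n → Fin n → ℕ → Fin n → ℚ
firstPassage P k zero          j = 0ℚ
firstPassage P k (suc zero)    j = P j k
firstPassage P k (suc (suc t)) j = sum≢ k (λ l → P j l * firstPassage P k (suc t) l)

ConvergesTo : (ℕ → ℚ) → ℚ → Set
ConvergesTo a L = ∀ ε → 0ℚ < ε → ∃[ N ] (∀ m → N ℕ.≤ m → ∣ a m - L ∣ < ε)

-- m j k is the expected first passage time, i.e. the sum over all t of
-- t times the probability that the first passage from j to k is at time t.
-- For a finite irreducible chain with rational transition probabilities these
-- expectations are rational, so nothing is lost by taking the limit in ℚ.
IsMeanFirstPassage : ∀ {n} → Matrix n → Matrix n → Set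
IsMeanFirstPassage P m = ∀ j k →
  ConvergesTo (λ N → ∑[ t < N ] (ι (toℕ t) * firstPassage P k (toℕ t) j)) (m j k)

-- The value does not depend on the initial vertex j, so κ is only required
-- to be attained at some j.
IsKemenyConstant : ∀ {n} → Graph n → ℚ → Set
IsKemenyConstant {n} H κ =
  Σ[ w ∈ (Fin n → ℚ) ] Σ[ m ∈ Matrix n ]
    IsStationary (transition H) w ×
    IsMeanFirstPassage (transition H) m ×
    ∃[ j ] κ ≡ sum≢ j (λ k → m j k * w k)

------------------------------------------------------------------------
-- The lower bound and the extremal trees

-- When c ≤ n the truncated subtraction n ∸ c is exact.
bound : (n c : ℕ) → ℚ
bound n c = recip (4 ℕ.* c ℕ.* n ℕ.* (n ℕ.∸ 1)) *
  ( - ((+ 2 / 3) * (n′ + 1ℚ) * (c′ * c′) * (c′ * c′ - 1ℚ))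
  - ι 8 * (n′ - c′) *
      ( - (n′ * (c′ * c′))
      + (c′ * (c′ + 1ℚ) * (+ 1 / 6)) * ((ι 2 * n′ + 1ℚ) * c′ + n′ - 1ℚ) )
  - ι 8 * ι ⌊ n ℕ.∸ c /2⌋ * ι ⌈ n ℕ.∸ c /2⌉ *
      ((n′ - 1ℚ) * ((c′ - 1ℚ) * (c′ - 1ℚ)) + c′ * (c′ - 1ℚ))
  + ι 4 * n′ * (n′ - 1ℚ) * c′ * (c′ - 1ℚ)
  + ι 2 * (n′ - 1ℚ) * (c′ * c′) )
  where
  n′ = ι n
  c′ = ι c

PendentAt : ∀ {n} → Graph n → Fin n → Fin n → Set
PendentAt H z u = ∀ w → Adj H u w ⇔ w ≡ z

-- H consists of the path π, a pendent vertices attached to its end x and b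
-- attached to its end y.  Chords of π are not mentioned: they cannot occur
-- when H is a tree.
record PathWithPendents {n : ℕ} (H : Graph n) {ℓ : ℕ} {x y : Fin n}
                        (π : Path H ℓ x y) (a b : ℕ) : Set where
  field
    atStart   : Fin a → Fin n
    atEnd     : Fin b → Fin n
    vertices  : Bijective _≡_ _≡_ [ Path.vertex π , [ atStart , atEnd ] ]
    pendStart : ∀ i → PendentAt H x (atStart i)
    pendEnd   : ∀ i → PendentAt H y (atEnd i)

Balanced : ∀ {n} (H : Graph n) {ℓ : ℕ} {x y : Fin n} → Path H ℓ x y → Set
Balanced {n} H {ℓ} π =
  PathWithPendents H π ⌊ n ℕ.∸ suc ℓ /2⌋ ⌈ n ℕ.∸ suc ℓ /2⌉ ⊎
  PathWithPendents H π ⌈ n ℕ.∸ suc ℓ /2⌉ ⌊ n ℕ.∸ suc ℓ /2⌋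

{-# OPTIONS --safe #-}
module Submission where

-- If a matrix R satisfies L R(·,k) = τ - 2 δₖ for the Laplacian L of a connected
-- graph (R is then its matrix of effective resistances), a Dirichlet uniqueness
-- argument identifies the mean first passage times as
-- m(j,k) = ½ ∑ₗ dₗ (R(j,k) + R(k,l) - R(j,l)), whence 2 vol · 𝒦 = ∑ dₖ dₗ R(k,l).
-- For a tree, R is the distance D.  A vertex i has a foot p(i) on the path and a
-- height h(i) above it, D(i, πₛ) = |s - p(i)| + h(i), and the new edge changes R to
-- D(i,k) - (p(i) - p(k))² / c.  Since h and p never change along the same edge,
-- ∑ dᵢ F(p(i)) = 2 ∑ F(p(i)) for the degrees d of T + xy, and everything
-- reduces to maximising a convex function of the distances |p(i) - p(j)|, using
-- D(i,j) ≤ |p(i) - p(j)| + h(i) + h(j): the vertices off the path have to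
-- project to its ends, as evenly as possible, and to be pendent.

open import Defs
open import Algebra.Bundles using (CommutativeRing)
open import Data.Bool.Base using (Bool; true; false; T; _∧_; _∨_; if_then_else_)
open import Data.Bool.Properties using (T?; ¬-not)
open import Data.Empty using (⊥; ⊥-elim)
open import Data.Fin.Base using (Fin; zero; suc; toℕ; fromℕ; fromℕ<; inject₁)
import Data.Fin.Properties as Fin
open import Data.Fin.Properties using (_≟_)
import Data.Integer.Base as ℤ
import Data.Integer.Properties as ℤ
open import Data.Nat.Base as ℕ using (ℕ; zero; suc; ⌊_/2⌋; ⌈_/2⌉)
import Data.Nat.Coprimality as Coprimality
import Data.Nat.Properties as ℕ
open import Data.Product.Base using (_×_; _,_; proj₁; proj₂; ∃; Σ-syntax)
open import Data.Rational.Base using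
  (ℚ; mkℚ; 0ℚ; 1ℚ; ½; _/_; _+_; _*_; _-_; -_; 1/_; ∣_∣; _≤_; _<_; _≥_; *≤*; Positive; nonNegative; positive; ≢-nonZero)
import Data.Rational.Properties as ℚ
open import Algebra.Properties.Semiring.Sum (CommutativeRing.semiring ℚ.+-*-commutativeRing)
  using (sum-cong-≗; ∑-distrib-+; ∑-comm; *-distribˡ-sum; *-distribʳ-sum; sum-replicate-zero)
import Data.Sum.Base as Sum
open import Data.Sum.Base using (_⊎_; inj₁; inj₂)
open import Data.Sum.Properties using (inj₁-injective; inj₂-injective)
open import Data.Unit.Base using (tt)
open import Function.Base using (_∘_)
open import Function.Bundles using (_⇔_; mk⇔; module Equivalence)
open import Level using (0ℓ)
open import Relation.Binary.Construct.Closure.ReflexiveTransitive as Star using (Star; ε; _◅_; _◅◅_)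
open import Relation.Binary.Definitions using (tri<; tri≈; tri>)
open import Relation.Binary.PropositionalEquality
  using (_≡_; _≢_; refl; sym; trans; cong; cong₂; subst; subst₂; module ≡-Reasoning)
open import Relation.Nullary using (¬_; Dec; yes; no; does)
open import Relation.Nullary.Decidable using (¬?; _×-dec_; dec⇒maybe)
open import Tactic.RingSolver using (solve-∀)
open import Tactic.RingSolver.Core.AlmostCommutativeRing using (AlmostCommutativeRing; fromCommutativeRing)

open ≡-Reasoning

-- The bound rests on one certificate: `excess≡` writes `l` times the scaled gap as a sum of five
-- nonnegative terms, so the inequality and the equality case come from the same identity. Two
-- obstacles shape it. First, for odd n - c the floor and ceiling make the bound sharp only for an
-- integral splitting: the concave expression `Q * (r * l - Q)` alone can exceed its target by l²/4,
-- when a foot inside the path evens out the two sides. The penalty `P` for interior feet pays for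
-- exactly this, which is the content of `rounding`. Second, mean first passage times are given only
-- as limits of series. The first-step equations, and even the fact that the passage probabilities
-- sum to one, have to be extracted from that convergence; the uniqueness argument does so without
-- any estimate of decay.

ℚ-ring : AlmostCommutativeRing 0ℓ 0ℓ
ℚ-ring = fromCommutativeRing ℚ.+-*-commutativeRing (λ x → dec⇒maybe (0ℚ ℚ.≟ x))

-- Naturals inside the rationals, and ordered-field facts

ι≡mkℚ : ∀ k → ι k ≡ mkℚ (ℤ.+ k) 0 (Coprimality.sym (Coprimality.1-coprimeTo k))
ι≡mkℚ k = ℚ.normalize-coprime (Coprimality.sym (Coprimality.1-coprimeTo k))

ι-+ : ∀ a b → ι (a ℕ.+ b) ≡ ι a + ι b
ι-+ a b rewrite ι≡mkℚ a | ι≡mkℚ b =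
  cong (_/ 1) (sym (cong₂ ℤ._+_ (ℤ.*-identityʳ (ℤ.+ a)) (ℤ.*-identityʳ (ℤ.+ b))))

ι-* : ∀ a b → ι (a ℕ.* b) ≡ ι a * ι b
ι-* a b rewrite ι≡mkℚ a | ι≡mkℚ b = cong (_/ 1) (ℤ.pos-* a b)

ι-suc : ∀ a → ι (suc a) ≡ 1ℚ + ι a
ι-suc = ι-+ 1

ι-mono-≤ : ∀ {a b} → a ℕ.≤ b → ι a ≤ ι b
ι-mono-≤ {a} {b} a≤b rewrite ι≡mkℚ a | ι≡mkℚ b =
  *≤* (subst₂ ℤ._≤_ (sym (ℤ.*-identityʳ (ℤ.+ a))) (sym (ℤ.*-identityʳ (ℤ.+ b))) (ℤ.+≤+ a≤b))

ι-injective : ∀ {a b} → ι a ≡ ι b → a ≡ b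
ι-injective {a} {b} eq = ℤ.+-injective (ℚ.mkℚ-injective (trans (sym (ι≡mkℚ a)) (trans eq (ι≡mkℚ b))) .proj₁)

0≤ι : ∀ a → 0ℚ ≤ ι a
0≤ι a = ι-mono-≤ {0} {a} ℕ.z≤n

ι-∸ : ∀ {a b} → b ℕ.≤ a → ι (a ℕ.∸ b) ≡ ι a - ι b
ι-∸ {a} {b} b≤a = begin
  ι (a ℕ.∸ b)                    ≡⟨ ring (ι (a ℕ.∸ b)) (ι b) ⟩
  (ι (a ℕ.∸ b) + ι b) - ι b      ≡⟨ cong (_- ι b) (trans (sym (ι-+ (a ℕ.∸ b) b)) (cong ι (ℕ.m∸n+n≡m b≤a))) ⟩
  ι a - ι b                      ∎
  where
  ring : ∀ x y → x ≡ (x + y) - y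
  ring = solve-∀ ℚ-ring

ι≢0 : ∀ {a} → a ≢ 0 → ι a ≢ 0ℚ
ι≢0 {a} a≢0 eq = a≢0 (ι-injective {a} {0} eq)

+-nonNeg : ∀ {a b} → 0ℚ ≤ a → 0ℚ ≤ b → 0ℚ ≤ a + b
+-nonNeg 0≤a 0≤b = ℚ.+-mono-≤ 0≤a 0≤b

*-nonNeg : ∀ {a b} → 0ℚ ≤ a → 0ℚ ≤ b → 0ℚ ≤ a * b
*-nonNeg {a} {b} 0≤a 0≤b =
  ℚ.nonNegative⁻¹ (a * b) {{ℚ.nonNeg*nonNeg⇒nonNeg a {{nonNegative 0≤a}} b {{nonNegative 0≤b}}}}

x-y≡0⇒x≡y : ∀ {a b} → a - b ≡ 0ℚ → a ≡ b
x-y≡0⇒x≡y {a} {b} eq = begin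
  a            ≡⟨ ring a b ⟩
  (a - b) + b  ≡⟨ cong (_+ b) eq ⟩
  0ℚ + b       ≡⟨ ℚ.+-identityˡ b ⟩
  b            ∎
  where
  ring : ∀ x y → x ≡ (x - y) + y
  ring = solve-∀ ℚ-ring

x≤y⇒0≤y-x : ∀ {a b} → a ≤ b → 0ℚ ≤ b - a
x≤y⇒0≤y-x {a} {b} a≤b = subst (_≤ b - a) (ℚ.+-inverseʳ a) (ℚ.+-monoˡ-≤ (- a) a≤b)

0≤y-x⇒x≤y : ∀ {a b} → 0ℚ ≤ b - a → a ≤ b
0≤y-x⇒x≤y {a} {b} p = subst₂ _≤_ (ℚ.+-identityˡ a) (ring b a) (ℚ.+-monoˡ-≤ a p)
  where
  ring : ∀ x y → (x - y) + y ≡ x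
  ring = solve-∀ ℚ-ring

square-nonNeg : ∀ a → 0ℚ ≤ a * a
square-nonNeg a with ℚ.≤-total 0ℚ a
... | inj₁ 0≤a = *-nonNeg 0≤a 0≤a
... | inj₂ a≤0 = subst (0ℚ ≤_) (ring a) (*-nonNeg 0≤-a 0≤-a)
  where
  0≤-a : 0ℚ ≤ - a
  0≤-a = subst (0ℚ ≤_) (ℚ.+-identityˡ (- a)) (x≤y⇒0≤y-x a≤0)
  ring : ∀ x → (- x) * (- x) ≡ x * x
  ring = solve-∀ ℚ-ring

nonNeg+nonNeg≡0⇒≡0 : ∀ {a b} → 0ℚ ≤ a → 0ℚ ≤ b → a + b ≡ 0ℚ → a ≡ 0ℚ
nonNeg+nonNeg≡0⇒≡0 {a} {b} 0≤a 0≤b eq =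
  ℚ.≤-antisym (subst₂ _≤_ (ℚ.+-identityʳ a) eq (ℚ.+-monoʳ-≤ a 0≤b)) 0≤a

*-zero-factor : ∀ {a b} → a ≢ 0ℚ → a * b ≡ 0ℚ → b ≡ 0ℚ
*-zero-factor {a} {b} a≢0 eq = begin
  b                      ≡⟨ ℚ.*-identityˡ b ⟨
  1ℚ * b                 ≡⟨ cong (_* b) (ℚ.*-inverseˡ a {{≢-nonZero a≢0}}) ⟨
  a⁻¹ * a * b            ≡⟨ ℚ.*-assoc a⁻¹ a b ⟩
  a⁻¹ * (a * b)          ≡⟨ cong (a⁻¹ *_) eq ⟩
  a⁻¹ * 0ℚ               ≡⟨ ℚ.*-zeroʳ a⁻¹ ⟩
  0ℚ                     ∎
  where a⁻¹ = (1/ a) {{≢-nonZero a≢0}}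

*-cancelˡ : ∀ {a b c} → a ≢ 0ℚ → a * b ≡ a * c → b ≡ c
*-cancelˡ {a} {b} {c} a≢0 eq = x-y≡0⇒x≡y (*-zero-factor a≢0 (begin
  a * (b - c)      ≡⟨ ring a b c ⟩
  a * b - a * c    ≡⟨ cong (_- a * c) eq ⟩
  a * c - a * c    ≡⟨ ℚ.+-inverseʳ (a * c) ⟩
  0ℚ               ∎))
  where
  ring : ∀ x y z → x * (y - z) ≡ x * y - x * z
  ring = solve-∀ ℚ-ring

square≡0⇒≡0 : ∀ {a} → a * a ≡ 0ℚ → a ≡ 0ℚ
square≡0⇒≡0 {a} eq with a ℚ.≟ 0ℚ
... | yes a≡0 = a≡0
... | no a≢0  = *-zero-factor a≢0 eq

*-cancelˡ-nonNeg : ∀ {a b} → 0ℚ ≤ a → a ≢ 0ℚ → 0ℚ ≤ a * b → 0ℚ ≤ b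
*-cancelˡ-nonNeg {a} {b} 0≤a a≢0 0≤ab = ℚ.*-cancelˡ-≤-pos a
  {{ℚ.nonNeg∧nonZero⇒pos a {{nonNegative 0≤a}} {{≢-nonZero a≢0}}}} (subst (_≤ a * b) (sym (ℚ.*-zeroʳ a)) 0≤ab)

recip-inverse : ∀ k → k ≢ 0 → recip k * ι k ≡ 1ℚ
recip-inverse zero    k≢0 = ⊥-elim (k≢0 refl)
recip-inverse (suc k) _ = begin
  ℤ.+ 1 / suc k * ι (suc k)   ≡⟨ cong₂ _*_ (ℚ.normalize-coprime (Coprimality.1-coprimeTo (suc k))) (ι≡mkℚ (suc k)) ⟩
  mkℚ (ℤ.+ 1) k (Coprimality.1-coprimeTo (suc k)) * mkℚ (ℤ.+ suc k) 0 (Coprimality.sym (Coprimality.1-coprimeTo (suc k)))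
                            ≡⟨ ℚ.*-inverseˡ (mkℚ (ℤ.+ suc k) 0 (Coprimality.sym (Coprimality.1-coprimeTo (suc k)))) ⟩
  1ℚ ∎

-- Finite sums

-- sum unfolds to a foldr, which blocks the inference of summands; ∑ does not unfold.
opaque
  ∑ : ∀ {n} → (Fin n → ℚ) → ℚ
  ∑ = sum

opaque
  unfolding ∑

  ∑≡sum : ∀ {n} (f : Fin n → ℚ) → ∑ f ≡ sum f
  ∑≡sum f = refl

  ∑-suc : ∀ {n} (f : Fin (suc n) → ℚ) → ∑ f ≡ f zero + ∑ (f ∘ suc)
  ∑-suc f = refl

  ∑-cong : ∀ {n} {f g : Fin n → ℚ} → (∀ i → f i ≡ g i) → ∑ f ≡ ∑ g
  ∑-cong = sum-cong-≗

  ∑-zero : ∀ {n} {f : Fin n → ℚ} → (∀ i → f i ≡ 0ℚ) → ∑ f ≡ 0ℚ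
  ∑-zero {n} f≡0 = trans (∑-cong f≡0) (sum-replicate-zero n)

  ∑-+ : ∀ {n} (f g : Fin n → ℚ) → ∑ (λ i → f i + g i) ≡ ∑ f + ∑ g
  ∑-+ = ∑-distrib-+

  ∑-neg : ∀ {n} (f : Fin n → ℚ) → ∑ (λ i → - f i) ≡ - ∑ f
  ∑-neg {zero}  f = refl
  ∑-neg {suc n} f = trans (cong (_+_ (- f zero)) (∑-neg (f ∘ suc))) (sym (ℚ.neg-distrib-+ (f zero) _))

  ∑-- : ∀ {n} (f g : Fin n → ℚ) → ∑ (λ i → f i - g i) ≡ ∑ f - ∑ g
  ∑-- f g = trans (∑-+ f (λ i → - g i)) (cong (_+_ (∑ f)) (∑-neg g))

  ∑-*ˡ : ∀ {n} c (f : Fin n → ℚ) → ∑ (λ i → c * f i) ≡ c * ∑ f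
  ∑-*ˡ c f = sym (*-distribˡ-sum c f)

  ∑-*ʳ : ∀ {n} c (f : Fin n → ℚ) → ∑ (λ i → f i * c) ≡ ∑ f * c
  ∑-*ʳ c f = sym (*-distribʳ-sum c f)

  ∑-const : ∀ n c → ∑ {n} (λ _ → c) ≡ ι n * c
  ∑-const zero    c = sym (ℚ.*-zeroˡ c)
  ∑-const (suc n) c = begin
    c + ∑ {n} (λ _ → c)  ≡⟨ cong (c +_) (∑-const n c) ⟩
    c + ι n * c            ≡⟨ ring c (ι n) ⟩
    (1ℚ + ι n) * c         ≡⟨ cong (_* c) (ι-suc n) ⟨
    ι (suc n) * c          ∎
    where
    ring : ∀ x y → x + y * x ≡ (1ℚ + y) * x
    ring = solve-∀ ℚ-ring

  ∑-swap : ∀ {m n} (f : Fin m → Fin n → ℚ) →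
             ∑ (λ i → ∑ (λ j → f i j)) ≡ ∑ (λ j → ∑ (λ i → f i j))
  ∑-swap = ∑-comm

  ∑-nonNeg : ∀ {n} {f : Fin n → ℚ} → (∀ i → 0ℚ ≤ f i) → 0ℚ ≤ ∑ f
  ∑-nonNeg {zero}  0≤f = ℚ.≤-refl
  ∑-nonNeg {suc n} 0≤f = +-nonNeg (0≤f zero) (∑-nonNeg (0≤f ∘ suc))

  ∑-nonNeg≡0 : ∀ {n} {f : Fin n → ℚ} → (∀ i → 0ℚ ≤ f i) → ∑ f ≡ 0ℚ → ∀ i → f i ≡ 0ℚ
  ∑-nonNeg≡0 0≤f eq zero    = nonNeg+nonNeg≡0⇒≡0 (0≤f zero) (∑-nonNeg (0≤f ∘ suc)) eq
  ∑-nonNeg≡0 {suc n} {f} 0≤f eq (suc i) = ∑-nonNeg≡0 (0≤f ∘ suc)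
    (nonNeg+nonNeg≡0⇒≡0 (∑-nonNeg (0≤f ∘ suc)) (0≤f zero) (trans (ℚ.+-comm _ (f zero)) eq)) i

δ : ∀ {n} → Fin n → Fin n → ℚ
δ i j = if does (i ≟ j) then 1ℚ else 0ℚ

δ-refl : ∀ {n} (i : Fin n) → δ i i ≡ 1ℚ
δ-refl i with i ≟ i
... | yes _   = refl
... | no  i≢i = ⊥-elim (i≢i refl)

δ-≢ : ∀ {n} {i j : Fin n} → i ≢ j → δ i j ≡ 0ℚ
δ-≢ {i = i} {j} i≢j with i ≟ j
... | yes i≡j = ⊥-elim (i≢j i≡j)
... | no  _   = refl

δ-suc : ∀ {n} (i j : Fin n) → δ (suc i) (suc j) ≡ δ i j
δ-suc i j with i ≟ j
... | yes _ = refl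
... | no  _ = refl

δ-sym : ∀ {n} (i j : Fin n) → δ i j ≡ δ j i
δ-sym i j with i ≟ j
... | yes refl = sym (δ-refl i)
... | no  i≢j  = sym (δ-≢ (i≢j ∘ sym))

opaque
  unfolding ∑

  ∑-δ : ∀ {n} (k : Fin n) (f : Fin n → ℚ) → ∑ (λ i → δ i k * f i) ≡ f k
  ∑-δ {suc n} zero f = begin
    1ℚ * f zero + ∑ (λ i → 0ℚ * f (suc i))  ≡⟨ cong₂ _+_ (ℚ.*-identityˡ (f zero)) (∑-zero (λ i → ℚ.*-zeroˡ (f (suc i)))) ⟩
    f zero + 0ℚ                               ≡⟨ ℚ.+-identityʳ (f zero) ⟩
    f zero                                    ∎
  ∑-δ {suc n} (suc k) f = begin
    0ℚ * f zero + ∑ (λ i → δ (suc i) (suc k) * f (suc i))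
      ≡⟨ cong₂ _+_ (ℚ.*-zeroˡ (f zero)) (∑-cong (λ i → cong (_* f (suc i)) (δ-suc i k))) ⟩
    0ℚ + ∑ (λ i → δ i k * f (suc i))  ≡⟨ ℚ.+-identityˡ _ ⟩
    ∑ (λ i → δ i k * f (suc i))       ≡⟨ ∑-δ k (f ∘ suc) ⟩
    f (suc k)                           ∎

∑-δ′ : ∀ {n} (k : Fin n) (f : Fin n → ℚ) → ∑ (λ i → δ k i * f i) ≡ f k
∑-δ′ k f = trans (∑-cong (λ i → cong (_* f i) (δ-sym k i))) (∑-δ k f)

-- Limits of rational sequences

ε/2>0 : ∀ {e} → 0ℚ < e → 0ℚ < ½ * e
ε/2>0 {e} 0<e = ℚ.positive⁻¹ (½ * e) {{ℚ.pos*pos⇒pos ½ e {{positive 0<e}}}}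

half+half : ∀ e → ½ * e + ½ * e ≡ e
half+half e = trans (sym (ℚ.*-distribʳ-+ e ½ ½)) (ℚ.*-identityˡ e)

converges-cong : ∀ {a b : ℕ → ℚ} {x} → (∀ m → a m ≡ b m) → ConvergesTo a x → ConvergesTo b x
converges-cong {x = x} a≡b a→x e 0<e with a→x e 0<e
... | N , close = N , λ m N≤m → subst (λ y → ∣ y - x ∣ < e) (a≡b m) (close m N≤m)

converges-const : ∀ c → ConvergesTo (λ _ → c) c
converges-const c e 0<e = 0 , λ m _ → subst (_< e) (sym (cong ∣_∣ (ℚ.+-inverseʳ c))) 0<e

converges-tail : ∀ {a : ℕ → ℚ} {x} → ConvergesTo a x → ConvergesTo (a ∘ suc) x
converges-tail a→x e 0<e with a→x e 0<e
... | N , close = N , λ m N≤m → close (suc m) (ℕ.m≤n⇒m≤1+n N≤m)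

converges-+ : ∀ {a b : ℕ → ℚ} {x y} → ConvergesTo a x → ConvergesTo b y →
              ConvergesTo (λ m → a m + b m) (x + y)
converges-+ {a} {b} {x} {y} a→x b→y e 0<e
  with a→x (½ * e) (ε/2>0 0<e) | b→y (½ * e) (ε/2>0 0<e)
... | N , closeA | M , closeB = N ℕ.+ M , λ m N+M≤m →
  subst (∣ (a m + b m) - (x + y) ∣ <_) (half+half e)
    (ℚ.≤-<-trans
      (subst (λ z → ∣ z ∣ ≤ ∣ a m - x ∣ + ∣ b m - y ∣) (ring (a m) (b m) x y)
        (ℚ.∣p+q∣≤∣p∣+∣q∣ (a m - x) (b m - y)))
      (ℚ.+-mono-< (closeA m (ℕ.≤-trans (ℕ.m≤m+n N M) N+M≤m))
                  (closeB m (ℕ.≤-trans (ℕ.m≤n+m M N) N+M≤m))))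
  where
  ring : ∀ p q r s → (p - r) + (q - s) ≡ (p + q) - (r + s)
  ring = solve-∀ ℚ-ring

converges-*ˡ : ∀ {a : ℕ → ℚ} {x} c → ConvergesTo a x → ConvergesTo (λ m → c * a m) (c * x)
converges-*ˡ {a} {x} c a→x e 0<e = N , λ m N≤m →
    ℚ.≤-<-trans (bound-by m) (subst (K * ∣ a m - x ∣ <_) K*e/K (ℚ.*-monoʳ-<-pos K {{K>0}} (close m N≤m)))
  where
  -- Adding one keeps `K` positive for `c` zero, so the tolerance e / K makes sense.
  K = 1ℚ + ∣ c ∣
  K>0 : Positive K
  K>0 = ℚ.pos+nonNeg⇒pos 1ℚ ∣ c ∣ {{nonNegative (ℚ.0≤∣p∣ c)}}
  instance
    K≢0 = ℚ.pos⇒nonZero K {{K>0}}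
  e/K>0 : 0ℚ < (1/ K) * e
  e/K>0 = ℚ.positive⁻¹ ((1/ K) * e) {{ℚ.pos*pos⇒pos (1/ K) {{ℚ.1/pos⇒pos K {{K>0}}}} e {{positive 0<e}}}}
  N = a→x ((1/ K) * e) e/K>0 .proj₁
  close = a→x ((1/ K) * e) e/K>0 .proj₂
  K*e/K : K * ((1/ K) * e) ≡ e
  K*e/K = trans (sym (ℚ.*-assoc K (1/ K) e)) (trans (cong (_* e) (ℚ.*-inverseʳ K)) (ℚ.*-identityˡ e))
  ring : ∀ p q r → p * (q - r) ≡ p * q - p * r
  ring = solve-∀ ℚ-ring
  ring′ : ∀ p q → p * q + q ≡ (1ℚ + p) * q
  ring′ = solve-∀ ℚ-ring
  bound-by : ∀ m → ∣ c * a m - c * x ∣ ≤ K * ∣ a m - x ∣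
  bound-by m = subst₂ _≤_ (ℚ.+-identityʳ _) (ring′ ∣ c ∣ ∣ a m - x ∣)
    (ℚ.+-mono-≤ (ℚ.≤-reflexive (trans (cong ∣_∣ (sym (ring c (a m) x))) (ℚ.∣p*q∣≡∣p∣*∣q∣ c (a m - x))))
                (ℚ.0≤∣p∣ (a m - x)))

opaque
  unfolding ∑

  converges-∑ : ∀ {n} {a : Fin n → ℕ → ℚ} {x : Fin n → ℚ} → (∀ i → ConvergesTo (a i) (x i)) →
                  ConvergesTo (λ m → ∑ (λ i → a i m)) (∑ x)
  converges-∑ {zero}  a→x = converges-const 0ℚ
  converges-∑ {suc n} {a} {x} a→x = converges-+ {a zero} {λ m → ∑ (λ i → a (suc i) m)} {x zero} {∑ (x ∘ suc)}
    (a→x zero) (converges-∑ {a = a ∘ suc} {x ∘ suc} (a→x ∘ suc))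

limit-unique : ∀ {a : ℕ → ℚ} {x y} → ConvergesTo a x → ConvergesTo a y → x ≡ y
limit-unique {a} {x} {y} a→x a→y with x ℚ.≟ y
... | yes x≡y = x≡y
... | no  x≢y = ⊥-elim (ℚ.<-irrefl refl e<e)
  where
  e = ∣ x - y ∣
  0<e : 0ℚ < e
  0<e with ℚ.<-cmp 0ℚ e
  ... | tri< 0<e _ _ = 0<e
  ... | tri≈ _ 0≡e _ = ⊥-elim (x≢y (x-y≡0⇒x≡y (ℚ.∣p∣≡0⇒p≡0 (x - y) (sym 0≡e))))
  ... | tri> _ _ e<0 = ⊥-elim (ℚ.<-irrefl refl (ℚ.<-≤-trans e<0 (ℚ.0≤∣p∣ (x - y))))
  cx = a→x (½ * e) (ε/2>0 0<e)
  cy = a→y (½ * e) (ε/2>0 0<e)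
  m = cx .proj₁ ℕ.+ cy .proj₁
  ring : ∀ p q r → (p - r) - (p - q) ≡ q - r
  ring = solve-∀ ℚ-ring
  e<e : e < e
  e<e = subst (e <_) (half+half e) (ℚ.≤-<-trans
    (subst (λ z → ∣ z ∣ ≤ ∣ a m - y ∣ + ∣ a m - x ∣) (ring (a m) x y) (ℚ.∣p-q∣≤∣p∣+∣q∣ (a m - y) (a m - x)))
    (ℚ.+-mono-< (cy .proj₂ m (ℕ.m≤n+m _ (cx .proj₁))) (cx .proj₂ m (ℕ.m≤m+n (cx .proj₁) _))))

-- Graph Laplacians

A : ∀ {n} → Graph n → Fin n → Fin n → ℚ
A H i j = if Graph.adj H i j then 1ℚ else 0ℚ

d : ∀ {n} → Graph n → Fin n → ℚ
d H i = ∑ (A H i)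

vol : ∀ {n} → Graph n → ℚ
vol H = ∑ (d H)

L : ∀ {n} → Graph n → (Fin n → ℚ) → Fin n → ℚ
L H f j = ∑ (λ l → A H j l * (f j - f l))

A-sym : ∀ {n} (H : Graph n) i j → A H i j ≡ A H j i
A-sym H i j = cong (if_then 1ℚ else 0ℚ) (Graph.adj-sym H i j)

adj⇒A≡1 : ∀ {n} (H : Graph n) i j → Adj H i j → A H i j ≡ 1ℚ
adj⇒A≡1 H i j adj with Graph.adj H i j
... | true = refl

0≤A : ∀ {n} (H : Graph n) i j → 0ℚ ≤ A H i j
0≤A H i j with Graph.adj H i j
... | true  = 0≤ι 1
... | false = ℚ.≤-refl

A-cong : ∀ {n} (H : Graph n) i j {x y : ℚ} → (Adj H i j → x ≡ y) → A H i j * x ≡ A H i j * y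
A-cong H i j {x} {y} x≡y with Graph.adj H i j
... | true  = cong (1ℚ *_) (x≡y tt)
... | false = trans (ℚ.*-zeroˡ x) (sym (ℚ.*-zeroˡ y))

ι-degree : ∀ {n} (H : Graph n) i → ι (degree H i) ≡ d H i
ι-degree H i = ι-sum (Graph.adj H i)
  where
  ι-sum : ∀ {m} (b : Fin m → Bool) → ι (sumℕ (λ j → if b j then 1 else 0)) ≡ ∑ (λ j → if b j then 1ℚ else 0ℚ)
  ι-sum {zero}  b = sym (∑-zero {f = λ j → if b j then 1ℚ else 0ℚ} (λ ()))
  ι-sum {suc m} b = trans (ι-+ (if b zero then 1 else 0) _)
    (trans (cong₂ _+_ (ι-if (b zero)) (ι-sum (b ∘ suc))) (sym (∑-suc (λ j → if b j then 1ℚ else 0ℚ))))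
    where
    ι-if : ∀ b → ι (if b then 1 else 0) ≡ (if b then 1ℚ else 0ℚ)
    ι-if true  = refl
    ι-if false = refl

L≡d-A : ∀ {n} (H : Graph n) f j → L H f j ≡ d H j * f j - ∑ (λ l → A H j l * f l)
L≡d-A H f j = begin
  ∑ (λ l → A H j l * (f j - f l))              ≡⟨ ∑-cong (λ l → ring (A H j l) (f j) (f l)) ⟩
  ∑ (λ l → A H j l * f j - A H j l * f l)      ≡⟨ ∑-- (λ l → A H j l * f j) (λ l → A H j l * f l) ⟩
  ∑ (λ l → A H j l * f j) - ∑ (λ l → A H j l * f l)
    ≡⟨ cong (_- ∑ (λ l → A H j l * f l)) (∑-*ʳ (f j) (A H j)) ⟩
  d H j * f j - ∑ (λ l → A H j l * f l)        ∎
  where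
  ring : ∀ a x y → a * (x - y) ≡ a * x - a * y
  ring = solve-∀ ℚ-ring

L-+ : ∀ {n} (H : Graph n) f g j → L H (λ i → f i + g i) j ≡ L H f j + L H g j
L-+ H f g j = trans (∑-cong (λ l → ring (A H j l) (f j) (g j) (f l) (g l))) (∑-+ _ _)
  where
  ring : ∀ a x y z w → a * ((x + y) - (z + w)) ≡ a * (x - z) + a * (y - w)
  ring = solve-∀ ℚ-ring

L-- : ∀ {n} (H : Graph n) f g j → L H (λ i → f i - g i) j ≡ L H f j - L H g j
L-- H f g j = trans (∑-cong (λ l → ring (A H j l) (f j) (g j) (f l) (g l))) (∑-- _ _)
  where
  ring : ∀ a x y z w → a * ((x - y) - (z - w)) ≡ a * (x - z) - a * (y - w)
  ring = solve-∀ ℚ-ring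

L-* : ∀ {n} (H : Graph n) c f j → L H (λ i → c * f i) j ≡ c * L H f j
L-* H c f j = trans (∑-cong (λ l → ring c (A H j l) (f j) (f l))) (∑-*ˡ c _)
  where
  ring : ∀ c a x z → a * (c * x - c * z) ≡ c * (a * (x - z))
  ring = solve-∀ ℚ-ring

L-∑ : ∀ {n m} (H : Graph n) (f : Fin m → Fin n → ℚ) j → L H (λ i → ∑ (λ k → f k i)) j ≡ ∑ (λ k → L H (f k) j)
L-∑ H f j = begin
  ∑ (λ l → A H j l * (∑ (λ k → f k j) - ∑ (λ k → f k l)))
    ≡⟨ ∑-cong (λ l → trans (cong (A H j l *_) (sym (∑-- (λ k → f k j) (λ k → f k l)))) (sym (∑-*ˡ (A H j l) _))) ⟩
  ∑ (λ l → ∑ (λ k → A H j l * (f k j - f k l)))  ≡⟨ ∑-swap _ ⟩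
  ∑ (λ k → L H (f k) j) ∎

L-const : ∀ {n} (H : Graph n) c j → L H (λ _ → c) j ≡ 0ℚ
L-const H c j = ∑-zero (λ l → trans (cong (A H j l *_) (ℚ.+-inverseʳ c)) (ℚ.*-zeroʳ (A H j l)))

edgeForm : ∀ {n} → Graph n → (f g : Fin n → ℚ) → ℚ
edgeForm H f g = ∑ (λ j → ∑ (λ l → A H j l * ((f j - f l) * (g j - g l))))

-- Summation by parts; edgeForm counts every edge twice.
green : ∀ {n} (H : Graph n) f g → ι 2 * ∑ (λ j → f j * L H g j) ≡ edgeForm H f g
green H f g = begin
  ι 2 * X                                              ≡⟨ two X ⟩
  X + X                                                ≡⟨ cong₂ _+_ X≡ (trans X≡ (trans (∑-swap _) (∑-cong (λ l → ∑-cong (λ j → sym′ j l))))) ⟩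
  ∑ (λ j → ∑ (λ l → A H j l * (f j * (g j - g l)))) + ∑ (λ j → ∑ (λ l → A H j l * (f l * (g l - g j))))
    ≡⟨ ∑-+ _ _ ⟨
  ∑ (λ j → ∑ (λ l → A H j l * (f j * (g j - g l))) + ∑ (λ l → A H j l * (f l * (g l - g j))))
    ≡⟨ ∑-cong (λ j → trans (sym (∑-+ _ _)) (∑-cong (λ l → ring′ (A H j l) (f j) (f l) (g j) (g l)))) ⟩
  edgeForm H f g                                       ∎
  where
  X = ∑ (λ j → f j * L H g j)
  two : ∀ x → ι 2 * x ≡ x + x
  two = solve-∀ ℚ-ring
  ring : ∀ f a x → f * (a * x) ≡ a * (f * x)
  ring = solve-∀ ℚ-ring
  ring′ : ∀ a x y z w → a * (x * (z - w)) + a * (y * (w - z)) ≡ a * ((x - y) * (z - w))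
  ring′ = solve-∀ ℚ-ring
  X≡ : X ≡ ∑ (λ j → ∑ (λ l → A H j l * (f j * (g j - g l))))
  X≡ = ∑-cong (λ j → trans (sym (∑-*ˡ (f j) _)) (∑-cong (λ l → ring (f j) (A H j l) (g j - g l))))
  sym′ : ∀ j l → A H j l * (f j * (g j - g l)) ≡ A H l j * (f j * (g j - g l))
  sym′ j l = cong (_* (f j * (g j - g l))) (A-sym H j l)

-- Summing the hypothesis gives zero Dirichlet energy by `green`; each edge term then vanishes and a
-- walk carries the value along. The pointwise hypothesis covers both a harmonic `g` and a `g` that
-- vanishes wherever it is not harmonic.
zero-energy⇒constant : ∀ {n} (H : Graph n) → Connected H → ∀ g → (∀ j → g j * L H g j ≡ 0ℚ) → ∀ i j → g i ≡ g j
zero-energy⇒constant H conn g gLg≡0 i j = walk (conn i j)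
  where
  energy≡0 : edgeForm H g g ≡ 0ℚ
  energy≡0 = trans (sym (green H g g)) (cong (ι 2 *_) (∑-zero gLg≡0))
  term≥0 : ∀ a b → 0ℚ ≤ A H a b * ((g a - g b) * (g a - g b))
  term≥0 a b = *-nonNeg (0≤A H a b) (square-nonNeg (g a - g b))
  edge : ∀ a b → Adj H a b → g a ≡ g b
  edge a b adj = x-y≡0⇒x≡y (square≡0⇒≡0 (begin
    (g a - g b) * (g a - g b)            ≡⟨ ℚ.*-identityˡ _ ⟨
    1ℚ * ((g a - g b) * (g a - g b))     ≡⟨ cong (_* ((g a - g b) * (g a - g b))) (adj⇒A≡1 H a b adj) ⟨
    A H a b * ((g a - g b) * (g a - g b))  ≡⟨ ∑-nonNeg≡0 (term≥0 a) (∑-nonNeg≡0 (λ j → ∑-nonNeg (term≥0 j)) energy≡0 a) b ⟩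
    0ℚ ∎))
  walk : ∀ {a b} → Star (Adj H) a b → g a ≡ g b
  walk ε = refl
  walk {a} (_◅_ {j = c} adj w) = trans (edge a c adj) (walk w)

dirichlet-unique : ∀ {n} (H : Graph n) → Connected H → ∀ k g → g k ≡ 0ℚ → (∀ j → j ≢ k → L H g j ≡ 0ℚ) → ∀ j → g j ≡ 0ℚ
dirichlet-unique H conn k g gk≡0 harmonic j = trans (zero-energy⇒constant H conn g gLg≡0 j k) gk≡0
  where
  gLg≡0 : ∀ j → g j * L H g j ≡ 0ℚ
  gLg≡0 j with j ≟ k
  ... | yes refl = trans (cong (_* L H g j) gk≡0) (ℚ.*-zeroˡ (L H g j))
  ... | no  j≢k  = trans (cong (g j *_) (harmonic j j≢k)) (ℚ.*-zeroʳ (g j))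

neighbour : ∀ {n} (H : Graph n) → Connected H → ∀ {i j} → i ≢ j → ∃ λ u → Adj H i u
neighbour H conn {i} {j} i≢j with conn i j
... | ε                  = ⊥-elim (i≢j refl)
... | _◅_ {j = u} adj _  = u , adj

∃≢ : ∀ {n} → 2 ℕ.≤ n → (i : Fin n) → ∃ λ j → i ≢ j
∃≢ (ℕ.s≤s (ℕ.s≤s _)) zero    = suc zero , λ ()
∃≢ (ℕ.s≤s (ℕ.s≤s _)) (suc i) = zero , λ ()

d≢0 : ∀ {n} (H : Graph n) → 2 ℕ.≤ n → Connected H → ∀ i → d H i ≢ 0ℚ
d≢0 H 2≤n conn i d≡0 with ∃≢ 2≤n i
... | _ , i≢j with neighbour H conn i≢j
... | u , adj = ℚ.1≢0 (trans (sym (adj⇒A≡1 H i u adj)) (∑-nonNeg≡0 (0≤A H i) d≡0 u))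

recip-degree : ∀ {n} (H : Graph n) → 2 ℕ.≤ n → Connected H → ∀ i → d H i * recip (degree H i) ≡ 1ℚ
recip-degree H 2≤n conn i = begin
  d H i * recip (degree H i)             ≡⟨ cong (_* recip (degree H i)) (ι-degree H i) ⟨
  ι (degree H i) * recip (degree H i)    ≡⟨ ℚ.*-comm (ι (degree H i)) (recip (degree H i)) ⟩
  recip (degree H i) * ι (degree H i)    ≡⟨ recip-inverse (degree H i) (λ eq → d≢0 H 2≤n conn i (trans (sym (ι-degree H i)) (cong ι eq))) ⟩
  1ℚ ∎

-- Kemeny's constant through effective resistances

-- The matrix of effective resistances of H satisfies these equations.
record IsResistance {n} (H : Graph n) (R : Matrix n) : Set where
  field
    symmetric : ∀ i j → R i j ≡ R j i
    diagonal  : ∀ i → R i i ≡ 0ℚ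
    τ         : Fin n → ℚ
    laplacian : ∀ j k → L H (λ i → R i k) j ≡ τ j - ι 2 * δ j k

-- This turns a sum avoiding `k` into a full sum to which the Laplacian applies, and it imposes the
-- boundary value 0 at `k` on hitting times.
zeroAt : ∀ {n} → Fin n → (Fin n → ℚ) → Fin n → ℚ
zeroAt k f i = if does (i ≟ k) then 0ℚ else f i

zeroAt-≡ : ∀ {n} (k : Fin n) f → zeroAt k f k ≡ 0ℚ
zeroAt-≡ k f with k ≟ k
... | yes _   = refl
... | no  k≢k = ⊥-elim (k≢k refl)

zeroAt-≢ : ∀ {n} {k : Fin n} f {i} → i ≢ k → zeroAt k f i ≡ f i
zeroAt-≢ {k = k} f {i} i≢k with i ≟ k
... | yes i≡k = ⊥-elim (i≢k i≡k)
... | no  _   = refl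

zeroAt-δ : ∀ {n} (k : Fin n) f i → zeroAt k f i ≡ f i - δ i k * f i
zeroAt-δ k f i with i ≟ k
... | yes _ = ring (f i)
  where
  ring : ∀ x → 0ℚ ≡ x - 1ℚ * x
  ring = solve-∀ ℚ-ring
... | no  _ = ring (f i)
  where
  ring : ∀ x → x ≡ x - 0ℚ * x
  ring = solve-∀ ℚ-ring

zeroAt-* : ∀ {n} (k : Fin n) (a f : Fin n → ℚ) i → zeroAt k (λ l → a l * f l) i ≡ a i * zeroAt k f i
zeroAt-* k a f i with i ≟ k
... | yes _ = sym (ℚ.*-zeroʳ (a i))
... | no  _ = refl

sum≢≡∑ : ∀ {n} (k : Fin n) f → sum≢ k f ≡ ∑ (zeroAt k f)
sum≢≡∑ k f = sym (∑≡sum (zeroAt k f))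

-- Grows at the last index, whereas `sum` peels off the first; recurrences in the horizon `N` then
-- hold by unfolding.
sumTo : (ℕ → ℚ) → ℕ → ℚ
sumTo g zero    = 0ℚ
sumTo g (suc N) = sumTo g N + g N

sumTo-sum : ∀ g N → sumTo g N ≡ sum {N} (λ t → g (toℕ t))
sumTo-sum g zero    = refl
sumTo-sum g (suc N) = trans (shift N) (cong (_+_ (g 0)) (sumTo-sum (g ∘ suc) N))
  where
  shift : ∀ N → sumTo g N + g N ≡ g 0 + sumTo (g ∘ suc) N
  shift zero    = ℚ.+-comm 0ℚ (g 0)
  shift (suc N) = trans (cong (_+ g (suc N)) (shift N)) (ℚ.+-assoc (g 0) _ _)

-- First-step equations of the random walk

module Walk {n} (H : Graph n) (2≤n : 2 ℕ.≤ n) (conn : Connected H) where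

  P : Matrix n
  P = transition H

  ∑P : ∀ j (g : Fin n → ℚ) → d H j * ∑ (λ l → P j l * g l) ≡ ∑ (λ l → A H j l * g l)
  ∑P j g = begin
    d H j * ∑ (λ l → r * A H j l * g l)     ≡⟨ cong (d H j *_) (trans (∑-cong (λ l → ℚ.*-assoc r (A H j l) (g l))) (∑-*ˡ r _)) ⟩
    d H j * (r * ∑ (λ l → A H j l * g l))   ≡⟨ ℚ.*-assoc (d H j) r _ ⟨
    d H j * r * ∑ (λ l → A H j l * g l)     ≡⟨ cong (_* ∑ (λ l → A H j l * g l)) (recip-degree H 2≤n conn j) ⟩
    1ℚ * ∑ (λ l → A H j l * g l)            ≡⟨ ℚ.*-identityˡ _ ⟩
    ∑ (λ l → A H j l * g l)                 ∎
    where r = recip (degree H j)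

  -- Multiplying a first-step equation by the degree clears `recip` and replaces transition
  -- probabilities by adjacency entries.
  average⇒L : ∀ {f : Fin n → ℚ} {j c} → f j ≡ c + ∑ (λ l → P j l * f l) → L H f j ≡ d H j * c
  average⇒L {f} {j} {c} eq = begin
    L H f j                                                   ≡⟨ L≡d-A H f j ⟩
    d H j * f j - ∑ (λ l → A H j l * f l)                     ≡⟨ cong (λ x → d H j * x - ∑ (λ l → A H j l * f l)) eq ⟩
    d H j * (c + Pf) - ∑ (λ l → A H j l * f l)                ≡⟨ cong (_-_ (d H j * (c + Pf))) (∑P j f) ⟨
    d H j * (c + Pf) - d H j * Pf                             ≡⟨ ring (d H j) c Pf ⟩
    d H j * c                                                 ∎
    where
    Pf = ∑ (λ l → P j l * f l)
    ring : ∀ x y z → x * (y + z) - x * z ≡ x * y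
    ring = solve-∀ ℚ-ring

  ∑P≡1 : ∀ j → ∑ (λ l → P j l) ≡ 1ℚ
  ∑P≡1 j = *-cancelˡ (d≢0 H 2≤n conn j) (begin
    d H j * ∑ (λ l → P j l)         ≡⟨ cong (d H j *_) (∑-cong (λ l → sym (ℚ.*-identityʳ (P j l)))) ⟩
    d H j * ∑ (λ l → P j l * 1ℚ)    ≡⟨ ∑P j (λ _ → 1ℚ) ⟩
    ∑ (λ l → A H j l * 1ℚ)          ≡⟨ ∑-cong (λ l → ℚ.*-identityʳ (A H j l)) ⟩
    d H j                           ≡⟨ ℚ.*-identityʳ (d H j) ⟨
    d H j * 1ℚ                      ∎)

  module Target (k : Fin n) where

    avg : (Fin n → ℚ) → Fin n → ℚ
    avg g j = ∑ (λ l → P j l * zeroAt k g l)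

    avg-δ : ∀ g j → avg g j ≡ ∑ (λ l → P j l * g l) - P j k * g k
    avg-δ g j = begin
      ∑ (λ l → P j l * zeroAt k g l)                             ≡⟨ ∑-cong (λ l → trans (cong (P j l *_) (zeroAt-δ k g l)) (ring (P j l) (g l) (δ l k))) ⟩
      ∑ (λ l → P j l * g l - δ l k * (P j l * g l))              ≡⟨ ∑-- _ _ ⟩
      ∑ (λ l → P j l * g l) - ∑ (λ l → δ l k * (P j l * g l))    ≡⟨ cong (_-_ (∑ (λ l → P j l * g l))) (∑-δ k (λ l → P j l * g l)) ⟩
      ∑ (λ l → P j l * g l) - P j k * g k                        ∎
      where
      ring : ∀ p x e → p * (x - e * x) ≡ p * x - e * (p * x)
      ring = solve-∀ ℚ-ring

    avg-+ : ∀ f g j → avg (λ l → f l + g l) j ≡ avg f j + avg g j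
    avg-+ f g j = trans (∑-cong term) (∑-+ _ _)
      where
      ring : ∀ p x y e → p * ((x + y) - e * (x + y)) ≡ p * (x - e * x) + p * (y - e * y)
      ring = solve-∀ ℚ-ring
      term : ∀ l → P j l * zeroAt k (λ i → f i + g i) l ≡ P j l * zeroAt k f l + P j l * zeroAt k g l
      term l rewrite zeroAt-δ k (λ i → f i + g i) l | zeroAt-δ k f l | zeroAt-δ k g l = ring (P j l) (f l) (g l) (δ l k)

    avg-* : ∀ c f j → avg (λ l → c * f l) j ≡ c * avg f j
    avg-* c f j = trans (∑-cong term) (∑-*ˡ c _)
      where
      ring : ∀ c p x → p * (c * x) ≡ c * (p * x)
      ring = solve-∀ ℚ-ring
      term : ∀ l → P j l * zeroAt k (λ i → c * f i) l ≡ c * (P j l * zeroAt k f l)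
      term l = trans (cong (P j l *_) (zeroAt-* k (λ _ → c) f l)) (ring c (P j l) (zeroAt k f l))

    avg-cong : ∀ {f g} → (∀ l → f l ≡ g l) → ∀ j → avg f j ≡ avg g j
    avg-cong f≡g j = ∑-cong (λ l → cong (P j l *_) (cong (if does (l ≟ k) then 0ℚ else_) (f≡g l)))

    avg-zero : ∀ {f} → (∀ l → f l ≡ 0ℚ) → ∀ j → avg f j ≡ 0ℚ
    avg-zero {f} f≡0 j = begin
      avg f j                     ≡⟨ avg-cong (λ l → trans (f≡0 l) (sym (ℚ.*-zeroˡ (f l)))) j ⟩
      avg (λ l → 0ℚ * f l) j      ≡⟨ avg-* 0ℚ f j ⟩
      0ℚ * avg f j                ≡⟨ ℚ.*-zeroˡ (avg f j) ⟩
      0ℚ                          ∎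

    -- The hypothesis makes `zeroAt k h` harmonic off `k` and zero at `k`, hence zero; the equation
    -- then determines `h` everywhere, at `k` included.
    average-unique : ∀ h → (∀ j → h j ≡ avg h j) → ∀ j → h j ≡ 0ℚ
    average-unique h h≡avg j = begin
      h j                                ≡⟨ h≡avg j ⟩
      ∑ (λ l → P j l * zeroAt k h l)     ≡⟨ ∑-zero (λ l → trans (cong (P j l *_) (g≡0 l)) (ℚ.*-zeroʳ (P j l))) ⟩
      0ℚ                                 ∎
      where
      g≡0 : ∀ l → zeroAt k h l ≡ 0ℚ
      g≡0 = dirichlet-unique H conn k (zeroAt k h) (zeroAt-≡ k h) (λ j j≢k →
        trans (average⇒L {zeroAt k h} {j} {0ℚ} (trans (zeroAt-≢ h j≢k) (trans (h≡avg j) (sym (ℚ.+-identityˡ _)))))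
              (ℚ.*-zeroʳ (d H j)))

    f : ℕ → Fin n → ℚ
    f = firstPassage P k

    f-step : ∀ t j → f (suc (suc t)) j ≡ avg (f (suc t)) j
    f-step t j = trans (sum≢≡∑ k (λ l → P j l * f (suc t) l)) (∑-cong (λ l → zeroAt-* k (P j) (f (suc t)) l))

    S M : ℕ → Fin n → ℚ
    S N j = sumTo (λ t → f t j) N
    M N j = sumTo (λ t → ι t * f t j) N

    -- Conditioning on the first step leaves a walk with a horizon shorter by one. The recursion
    -- starts at two summands because `f 0` is zero and `f 1` is the direct passage, the
    -- inhomogeneous term `P j k`.
    S-step : ∀ N j → S (suc (suc N)) j ≡ P j k + avg (S (suc N)) j
    S-step zero j = begin
      0ℚ + 0ℚ + P j k              ≡⟨ ℚ.+-comm 0ℚ (P j k) ⟩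
      P j k + 0ℚ                   ≡⟨ cong (P j k +_) (avg-zero (λ l → refl) j) ⟨
      P j k + avg (S 1) j          ∎
    S-step (suc N) j = begin
      S (suc (suc N)) j + f (suc (suc N)) j                   ≡⟨ cong₂ _+_ (S-step N j) (f-step N j) ⟩
      P j k + avg (S (suc N)) j + avg (f (suc N)) j           ≡⟨ ℚ.+-assoc (P j k) _ _ ⟩
      P j k + (avg (S (suc N)) j + avg (f (suc N)) j)         ≡⟨ cong (P j k +_) (avg-+ (S (suc N)) (f (suc N)) j) ⟨
      P j k + avg (S (suc (suc N))) j                         ∎

    ι*f : ∀ N j → ι (suc N) * f (suc N) j ≡ f (suc N) j + avg (λ l → ι N * f N l) j
    ι*f zero j = begin
      1ℚ * P j k        ≡⟨ ring (P j k) ⟩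
      P j k + 0ℚ        ≡⟨ cong (P j k +_) (avg-zero {λ l → 0ℚ * 0ℚ} (λ l → refl) j) ⟨
      P j k + avg (λ l → 0ℚ * 0ℚ) j ∎
      where
      ring : ∀ x → 1ℚ * x ≡ x + 0ℚ
      ring = solve-∀ ℚ-ring
    ι*f (suc N) j = begin
      ι (suc (suc N)) * f (suc (suc N)) j    ≡⟨ cong (_* f (suc (suc N)) j) (ι-suc (suc N)) ⟩
      (1ℚ + ι (suc N)) * f (suc (suc N)) j   ≡⟨ ring (ι (suc N)) (f (suc (suc N)) j) ⟩
      f (suc (suc N)) j + ι (suc N) * f (suc (suc N)) j
        ≡⟨ cong (λ x → f (suc (suc N)) j + x) (trans (cong (ι (suc N) *_) (f-step N j)) (sym (avg-* (ι (suc N)) (f (suc N)) j))) ⟩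
      f (suc (suc N)) j + avg (λ l → ι (suc N) * f (suc N) l) j ∎
      where
      ring : ∀ x y → (1ℚ + x) * y ≡ y + x * y
      ring = solve-∀ ℚ-ring

    -- A passage time is one plus the time remaining after the first step: the one contributes `S`,
    -- the remainder `avg (M N)`. Read backwards, this expresses `S` through `M`, so convergence of
    -- `M` forces convergence of `S`.
    M-step : ∀ N j → M (suc N) j ≡ S (suc N) j + avg (M N) j
    M-step zero j = sym (trans (cong (_+_ (0ℚ + 0ℚ)) (avg-zero (λ l → refl) j)) refl)
    M-step (suc N) j = begin
      M (suc N) j + ι (suc N) * f (suc N) j      ≡⟨ cong₂ _+_ (M-step N j) (ι*f N j) ⟩
      (S (suc N) j + avg (M N) j) + (f (suc N) j + avg (λ l → ι N * f N l) j)
        ≡⟨ ring (S (suc N) j) (avg (M N) j) (f (suc N) j) _ ⟩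
      (S (suc N) j + f (suc N) j) + (avg (M N) j + avg (λ l → ι N * f N l) j)
        ≡⟨ cong (_+_ (S (suc (suc N)) j)) (avg-+ (M N) (λ l → ι N * f N l) j) ⟨
      S (suc (suc N)) j + avg (M (suc N)) j  ∎
      where
      ring : ∀ x y z w → (x + y) + (z + w) ≡ (x + z) + (y + w)
      ring = solve-∀ ℚ-ring

    module _ (m : Fin n → ℚ) (M→m : ∀ j → ConvergesTo (λ N → M N j) (m j)) where

      avg-converges : ∀ {a : ℕ → Fin n → ℚ} {x} → (∀ j → ConvergesTo (λ N → a N j) (x j)) →
                      ∀ j → ConvergesTo (λ N → avg (a N) j) (avg x j)
      avg-converges {a} {x} a→x j = converges-∑ {a = λ l N → P j l * zeroAt k (a N) l} {x = λ l → P j l * zeroAt k x l}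
        (λ l → converges-*ˡ {a = λ N → zeroAt k (a N) l} {x = zeroAt k x l} (P j l) (zeroAt-converges l))
        where
        zeroAt-converges : ∀ l → ConvergesTo (λ N → zeroAt k (a N) l) (zeroAt k x l)
        zeroAt-converges l with l ≟ k
        ... | yes _ = converges-const 0ℚ
        ... | no  _ = a→x l

      -- The probability of ever passing through `k`, obtained as a limit from `M-step` since only
      -- `M` is assumed to converge.
      s : Fin n → ℚ
      s j = m j - avg m j

      S→s : ∀ j → ConvergesTo (λ N → S (suc N) j) (s j)
      S→s j = subst (ConvergesTo (λ N → S (suc N) j)) (ring′ (m j) (avg m j))
        (converges-cong {a = λ N → M (suc N) j + (- 1ℚ) * avg (M N) j} {b = λ N → S (suc N) j} {x = m j + (- 1ℚ) * avg m j}
          (λ N → trans (cong (_+ (- 1ℚ) * avg (M N) j) (M-step N j)) (ring (S (suc N) j) (avg (M N) j)))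
          (converges-+ {a = λ N → M (suc N) j} {b = λ N → (- 1ℚ) * avg (M N) j} {x = m j} {y = (- 1ℚ) * avg m j}
            (converges-tail {a = λ N → M N j} {x = m j} (M→m j))
            (converges-*ˡ {a = λ N → avg (M N) j} {x = avg m j} (- 1ℚ) (avg-converges {a = M} {x = m} M→m j))))
        where
        ring : ∀ x y → (x + y) + (- 1ℚ) * y ≡ x
        ring = solve-∀ ℚ-ring
        ring′ : ∀ x y → x + (- 1ℚ) * y ≡ x - y
        ring′ = solve-∀ ℚ-ring

      s-harmonic : ∀ j → s j ≡ P j k + avg s j
      s-harmonic j = limit-unique {a = λ N → S (suc (suc N)) j} {x = s j} {y = P j k + avg s j}
        (converges-tail {a = λ N → S (suc N) j} {x = s j} (S→s j))
        (converges-cong {a = λ N → P j k + avg (S (suc N)) j} {b = λ N → S (suc (suc N)) j} {x = P j k + avg s j}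
          (λ N → sym (S-step N j))
          (converges-+ {a = λ _ → P j k} {b = λ N → avg (S (suc N)) j} {x = P j k} {y = avg s j}
            (converges-const (P j k)) (avg-converges {a = λ N → S (suc N)} {x = s} S→s j)))

      -- Recurrence of the chain: the escape probability `1ℚ - s` satisfies the homogeneous
      -- first-step equation because the rows of `P` sum to one, and `average-unique` makes it
      -- vanish.
      s≡1 : ∀ j → s j ≡ 1ℚ
      s≡1 j = sym (x-y≡0⇒x≡y (average-unique (λ l → 1ℚ - s l) escape j))
        where
        ring : ∀ p x → 1ℚ - (p + x) ≡ (1ℚ - p) - x
        ring = solve-∀ ℚ-ring
        ring′ : ∀ p a y → (1ℚ - p * 1ℚ) - (a - p * y) ≡ (1ℚ - a) - p * (1ℚ - y)
        ring′ = solve-∀ ℚ-ring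
        ring″ : ∀ p x → p - p * x ≡ p * (1ℚ - x)
        ring″ = solve-∀ ℚ-ring
        escape : ∀ l → 1ℚ - s l ≡ avg (λ i → 1ℚ - s i) l
        escape l = begin
          1ℚ - s l                              ≡⟨ cong (_-_ 1ℚ) (s-harmonic l) ⟩
          1ℚ - (P l k + avg s l)                ≡⟨ ring (P l k) (avg s l) ⟩
          (1ℚ - P l k) - avg s l                ≡⟨ cong₂ (λ x y → (1ℚ - x) - y) (sym (ℚ.*-identityʳ (P l k))) (avg-δ s l) ⟩
          (1ℚ - P l k * 1ℚ) - (∑ (λ i → P l i * s i) - P l k * s k)  ≡⟨ ring′ (P l k) (∑ (λ i → P l i * s i)) (s k) ⟩
          (1ℚ - ∑ (λ i → P l i * s i)) - P l k * (1ℚ - s k)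
            ≡⟨ cong (λ x → (x - ∑ (λ i → P l i * s i)) - P l k * (1ℚ - s k)) (∑P≡1 l) ⟨
          (∑ (λ i → P l i) - ∑ (λ i → P l i * s i)) - P l k * (1ℚ - s k)
            ≡⟨ cong (_- P l k * (1ℚ - s k)) (trans (sym (∑-- _ _)) (∑-cong (λ i → ring″ (P l i) (s i)))) ⟩
          ∑ (λ i → P l i * (1ℚ - s i)) - P l k * (1ℚ - s k)   ≡⟨ avg-δ (λ i → 1ℚ - s i) l ⟨
          avg (λ i → 1ℚ - s i) l ∎

      m-step : ∀ j → m j ≡ 1ℚ + avg m j
      m-step j = begin
        m j                          ≡⟨ ring (m j) (avg m j) ⟩
        (m j - avg m j) + avg m j    ≡⟨ cong (_+ avg m j) (s≡1 j) ⟩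
        1ℚ + avg m j                 ∎
        where
        ring : ∀ x y → x ≡ (x - y) + y
        ring = solve-∀ ℚ-ring

      module _ {R : Matrix n} (res : IsResistance H R) where
        open IsResistance res

        ν : Fin n → ℚ
        ν j = ∑ (λ l → d H l * (R j k + R k l - R j l))

        -- The unknown `τ` cancels between `R i k` and `R i l`; off `k` only the term with `δ j l`
        -- survives.
        L-ν : ∀ j → j ≢ k → L H ν j ≡ ι 2 * d H j
        L-ν j j≢k = begin
          L H ν j                                     ≡⟨ L-∑ H (λ l i → d H l * (R i k + R k l - R i l)) j ⟩
          ∑ (λ l → L H (λ i → d H l * (R i k + R k l - R i l)) j)   ≡⟨ ∑-cong term ⟩
          ∑ (λ l → ι 2 * (δ j l * d H l))             ≡⟨ ∑-*ˡ (ι 2) _ ⟩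
          ι 2 * ∑ (λ l → δ j l * d H l)               ≡⟨ cong (ι 2 *_) (∑-δ′ j (d H)) ⟩
          ι 2 * d H j                                 ∎
          where
          ring : ∀ d t x → d * ((t - ι 2 * 0ℚ) + 0ℚ - (t - ι 2 * x)) ≡ ι 2 * (x * d)
          ring = solve-∀ ℚ-ring
          term : ∀ l → L H (λ i → d H l * (R i k + R k l - R i l)) j ≡ ι 2 * (δ j l * d H l)
          term l = begin
            L H (λ i → d H l * (R i k + R k l - R i l)) j    ≡⟨ L-* H (d H l) (λ i → R i k + R k l - R i l) j ⟩
            d H l * L H (λ i → R i k + R k l - R i l) j      ≡⟨ cong (d H l *_) (trans (L-- H (λ i → R i k + R k l) (λ i → R i l) j)
                                                                  (cong (_- L H (λ i → R i l) j) (L-+ H (λ i → R i k) (λ _ → R k l) j))) ⟩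
            d H l * (L H (λ i → R i k) j + L H (λ _ → R k l) j - L H (λ i → R i l) j)
              ≡⟨ cong (d H l *_) (cong₂ _-_ (cong₂ _+_ (trans (laplacian j k) (cong (λ x → τ j - ι 2 * x) (δ-≢ j≢k))) (L-const H (R k l) j)) (laplacian j l)) ⟩
            d H l * ((τ j - ι 2 * 0ℚ) + 0ℚ - (τ j - ι 2 * δ j l))   ≡⟨ ring (d H l) (τ j) (δ j l) ⟩
            ι 2 * (δ j l * d H l) ∎

        -- The two sides have the same Laplacian off `k` and both vanish at `k`. There `m k` itself
        -- would be the mean return time, which `zeroAt` replaces by zero.
        2m≡ν : ∀ j → ι 2 * zeroAt k m j ≡ ν j
        2m≡ν j = x-y≡0⇒x≡y (dirichlet-unique H conn k (λ i → ι 2 * zeroAt k m i - ν i) at-k off-k j)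
          where
          ring : ∀ x y → (ι 2 * (x * 1ℚ)) - ι 2 * x ≡ 0ℚ * y
          ring = solve-∀ ℚ-ring
          ring′ : ∀ d r → d * (0ℚ + r - r) ≡ 0ℚ
          ring′ = solve-∀ ℚ-ring
          at-k : ι 2 * zeroAt k m k - ν k ≡ 0ℚ
          at-k = cong₂ (λ x y → ι 2 * x - y) (zeroAt-≡ k m) (∑-zero (λ l →
            trans (cong (λ x → d H l * (x + R k l - R k l)) (diagonal k)) (ring′ (d H l) (R k l))))
          off-k : ∀ j → j ≢ k → L H (λ i → ι 2 * zeroAt k m i - ν i) j ≡ 0ℚ
          off-k j j≢k = begin
            L H (λ i → ι 2 * zeroAt k m i - ν i) j       ≡⟨ L-- H (λ i → ι 2 * zeroAt k m i) ν j ⟩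
            L H (λ i → ι 2 * zeroAt k m i) j - L H ν j   ≡⟨ cong₂ _-_ (trans (L-* H (ι 2) (zeroAt k m) j)
                (cong (ι 2 *_) (average⇒L {zeroAt k m} {j} {1ℚ} (trans (zeroAt-≢ m j≢k) (m-step j))))) (L-ν j j≢k) ⟩
            ι 2 * (d H j * 1ℚ) - ι 2 * d H j             ≡⟨ ring (d H j) 1ℚ ⟩
            0ℚ * 1ℚ                                      ≡⟨ ℚ.*-zeroˡ 1ℚ ⟩
            0ℚ                                           ∎

  -- Invariance says that `w i` divided by the degree of `i` is harmonic on the whole graph, hence a
  -- constant `γ`, which normalisation then fixes.
  stationary : ∀ {w} → IsStationary P w → ∃ λ γ → vol H * γ ≡ 1ℚ × (∀ i → w i ≡ d H i * γ)
  stationary {w} st = γ , vol*γ , w≡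
    where
    open IsStationary st
    r : Fin n → ℚ
    r i = recip (degree H i)
    g : Fin n → ℚ
    g i = w i * r i
    dg≡w : ∀ i → d H i * g i ≡ w i
    dg≡w i = trans (ring (d H i) (w i) (r i)) (trans (cong (_* w i) (recip-degree H 2≤n conn i)) (ℚ.*-identityˡ (w i)))
      where
      ring : ∀ x y z → x * (y * z) ≡ x * z * y
      ring = solve-∀ ℚ-ring
    Lg≡0 : ∀ j → L H g j ≡ 0ℚ
    Lg≡0 j = begin
      L H g j                                        ≡⟨ L≡d-A H g j ⟩
      d H j * g j - ∑ (λ l → A H j l * g l)          ≡⟨ cong₂ _-_ (dg≡w j) (trans (∑-cong term) (trans (∑≡sum _) (invariant j))) ⟩
      w j - w j                                      ≡⟨ ℚ.+-inverseʳ (w j) ⟩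
      0ℚ                                             ∎
      where
      ring : ∀ a w r → a * (w * r) ≡ w * (r * a)
      ring = solve-∀ ℚ-ring
      term : ∀ l → A H j l * g l ≡ w l * P l j
      term l = trans (cong (_* g l) (A-sym H j l)) (ring (A H l j) (w l) (r l))
    o : Fin n
    o = 2≤n-elem 2≤n
      where
      2≤n-elem : ∀ {m} → 2 ℕ.≤ m → Fin m
      2≤n-elem (ℕ.s≤s _) = zero
    γ = g o
    w≡ : ∀ i → w i ≡ d H i * γ
    w≡ i = trans (sym (dg≡w i)) (cong (d H i *_)
      (zero-energy⇒constant H conn g (λ j → trans (cong (g j *_) (Lg≡0 j)) (ℚ.*-zeroʳ (g j))) i o))
    vol*γ : vol H * γ ≡ 1ℚ
    vol*γ = begin
      vol H * γ              ≡⟨ ∑-*ʳ γ (d H) ⟨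
      ∑ (λ i → d H i * γ)    ≡⟨ ∑-cong w≡ ⟨
      ∑ w                    ≡⟨ ∑≡sum w ⟩
      sum w                  ≡⟨ normalised ⟩
      1ℚ                     ∎

kemeny-resistance : ∀ {n} (H : Graph n) → 2 ℕ.≤ n → Connected H → ∀ {R} → IsResistance H R → ∀ {κ} → IsKemenyConstant H κ →
                    ι 2 * vol H * κ ≡ ∑ (λ k → ∑ (λ l → d H k * d H l * R k l))
kemeny-resistance {n} H 2≤n conn {R} res {κ} (w , m , st , passage , j , κ≡) = begin
  ι 2 * vol H * κ                             ≡⟨ ring₁ (vol H) κ ⟩
  vol H * (ι 2 * κ)                           ≡⟨ cong (vol H *_) 2κ≡ ⟩
  vol H * (γ * X)                             ≡⟨ ℚ.*-assoc (vol H) γ X ⟨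
  vol H * γ * X                               ≡⟨ cong (_* X) vol*γ ⟩
  1ℚ * X                                      ≡⟨ ℚ.*-identityˡ X ⟩
  X                                           ∎
  where
  open Walk H 2≤n conn
  X = ∑ (λ k → ∑ (λ l → d H k * d H l * R k l))
  γ = stationary st .proj₁
  vol*γ = stationary st .proj₂ .proj₁
  w≡ = stationary st .proj₂ .proj₂
  ring₁ : ∀ x y → ι 2 * x * y ≡ x * (ι 2 * y)
  ring₁ = solve-∀ ℚ-ring
  M→m : ∀ k i → ConvergesTo (λ N → Target.M k N i) (m i k)
  M→m k i = converges-cong {a = λ N → sum {N} (λ t → ι (toℕ t) * firstPassage P k (toℕ t) i)} {b = λ N → Target.M k N i} {x = m i k}
    (λ N → sym (sumTo-sum (λ t → ι t * firstPassage P k t i) N)) (passage i k)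
  νⱼ : Fin n → ℚ
  νⱼ k = ∑ (λ l → d H l * (R j k + R k l - R j l))
  2m≡ν : ∀ k → ι 2 * zeroAt k (λ i → m i k) j ≡ νⱼ k
  2m≡ν k = Target.2m≡ν k (λ i → m i k) (M→m k) res j
  term : ∀ k → ι 2 * zeroAt j (λ i → m j i * w i) k ≡ νⱼ k * w k
  term k = trans (cong (ι 2 *_) (split (k ≟ j))) (trans (sym (ℚ.*-assoc (ι 2) (zeroAt k (λ i → m i k) j) (w k))) (cong (_* w k) (2m≡ν k)))
    where
    split : Dec (k ≡ j) → zeroAt j (λ i → m j i * w i) k ≡ zeroAt k (λ i → m i k) j * w k
    split (yes refl) = trans (zeroAt-≡ k (λ i → m j i * w i))
                         (trans (sym (ℚ.*-zeroˡ (w k))) (cong (_* w k) (sym (zeroAt-≡ k (λ i → m i k)))))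
    split (no k≢j)   = trans (zeroAt-≢ (λ i → m j i * w i) k≢j)
                         (cong (_* w k) (sym (zeroAt-≢ (λ i → m i k) (k≢j ∘ sym))))
  dd : Fin n → Fin n → ℚ
  dd k l = d H k * d H l
  ring₂ : ∀ v d g → v * (d * g) ≡ g * (d * v)
  ring₂ = solve-∀ ℚ-ring
  ring₃ : ∀ a b x y z → a * (b * (x + y - z)) ≡ a * b * y + (a * b * x - a * b * z)
  ring₃ = solve-∀ ℚ-ring
  -- The weights `dd` are symmetric, so the terms with `R j k` and `R j l` cancel and the dependence
  -- on the start `j` disappears.
  swap : ∑ (λ k → ∑ (λ l → dd k l * R j k)) ≡ ∑ (λ k → ∑ (λ l → dd k l * R j l))
  swap = trans (∑-swap _) (∑-cong (λ k → ∑-cong (λ l → cong (_* R j l) (ℚ.*-comm (d H l) (d H k)))))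
  ∑dν : ∑ (λ k → d H k * νⱼ k) ≡ X
  ∑dν = begin
    ∑ (λ k → d H k * νⱼ k)
      ≡⟨ ∑-cong (λ k → trans (sym (∑-*ˡ (d H k) _)) (trans (∑-cong (λ l → ring₃ (d H k) (d H l) (R j k) (R k l) (R j l)))
           (trans (∑-+ _ _) (cong (_+_ (∑ (λ l → dd k l * R k l))) (∑-- _ _))))) ⟩
    ∑ (λ k → ∑ (λ l → dd k l * R k l) + (∑ (λ l → dd k l * R j k) - ∑ (λ l → dd k l * R j l)))
      ≡⟨ trans (∑-+ _ _) (cong (X +_) (∑-- _ _)) ⟩
    X + (∑ (λ k → ∑ (λ l → dd k l * R j k)) - ∑ (λ k → ∑ (λ l → dd k l * R j l)))
      ≡⟨ cong (λ y → X + (y - ∑ (λ k → ∑ (λ l → dd k l * R j l)))) swap ⟩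
    X + (∑ (λ k → ∑ (λ l → dd k l * R j l)) - ∑ (λ k → ∑ (λ l → dd k l * R j l)))
      ≡⟨ cong (X +_) (ℚ.+-inverseʳ (∑ (λ k → ∑ (λ l → dd k l * R j l)))) ⟩
    X + 0ℚ ≡⟨ ℚ.+-identityʳ X ⟩
    X ∎
  2κ≡ : ι 2 * κ ≡ γ * X
  2κ≡ = begin
    ι 2 * κ                                            ≡⟨ cong (ι 2 *_) (trans κ≡ (sum≢≡∑ j _)) ⟩
    ι 2 * ∑ (zeroAt j (λ i → m j i * w i))             ≡⟨ ∑-*ˡ (ι 2) _ ⟨
    ∑ (λ k → ι 2 * zeroAt j (λ i → m j i * w i) k)     ≡⟨ ∑-cong (λ k → trans (term k) (trans (cong (νⱼ k *_) (w≡ k)) (ring₂ (νⱼ k) (d H k) γ))) ⟩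
    ∑ (λ k → γ * (d H k * νⱼ k))                       ≡⟨ ∑-*ˡ γ _ ⟩
    γ * ∑ (λ k → d H k * νⱼ k)                         ≡⟨ cong (γ *_) ∑dν ⟩
    γ * X                                              ∎

-- Distances in trees

module _ {P : ℕ → Set} (P? : ∀ m → Dec (P m)) where
  least : ∀ m → P m → ∃ λ l → P l × (∀ j → P j → l ℕ.≤ j)
  least = search P?
    where
    search : ∀ {Q : ℕ → Set} → (∀ m → Dec (Q m)) → ∀ m → Q m → ∃ λ l → Q l × (∀ j → Q j → l ℕ.≤ j)
    search Q? m q with Q? 0
    ... | yes q₀ = 0 , q₀ , λ _ _ → ℕ.z≤n
    search Q? zero    q | no ¬q₀ = ⊥-elim (¬q₀ q)
    search {Q} Q? (suc m) q | no ¬q₀ with search (λ l → Q? (suc l)) m q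
    ... | l , ql , min = suc l , ql , minimal
      where
      minimal : ∀ j → Q j → suc l ℕ.≤ j
      minimal zero    q₀ = ⊥-elim (¬q₀ q₀)
      minimal (suc j) qj = ℕ.s≤s (min j qj)

data Walk-of {n} (H : Graph n) : Fin n → Fin n → ℕ → Set where
  []  : ∀ {i} → Walk-of H i i 0
  _∷_ : ∀ {i j k m} → Adj H i j → Walk-of H j k m → Walk-of H i k (suc m)

Adj-sym : ∀ {n} (H : Graph n) {i j} → Adj H i j → Adj H j i
Adj-sym H {i} {j} = subst T (Graph.adj-sym H i j)

Adj⇒≢ : ∀ {n} (H : Graph n) {i j} → Adj H i j → i ≢ j
Adj⇒≢ H {i} adj refl = subst T (Graph.adj-irrefl H i) adj

tailPath : ∀ {n} {H : Graph n} {ℓ x y} (p : Path H (suc ℓ) x y) → Path H ℓ (Path.vertex p (suc zero)) y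
tailPath p = record
  { vertex    = Path.vertex p ∘ suc
  ; injective = λ eq → Fin.suc-injective (Path.injective p eq)
  ; start     = refl
  ; end       = Path.end p
  ; step      = λ i → Path.step p (suc i)
  }

suffix : ∀ {n} {H : Graph n} {ℓ x y} (p : Path H ℓ x y) (s : Fin (suc ℓ)) →
         ∃ λ ℓ′ → Σ[ q ∈ Path H ℓ′ (Path.vertex p s) y ] (∀ t → ∃ λ t′ → Path.vertex q t ≡ Path.vertex p t′)
suffix {ℓ = ℓ} p zero = ℓ , record
  { vertex = Path.vertex p ; injective = Path.injective p ; start = refl ; end = Path.end p ; step = Path.step p }
  , λ t → t , refl
suffix {ℓ = suc ℓ} p (suc s) with suffix (tailPath p) s
... | ℓ′ , q , inside = ℓ′ , q , λ t → suc (inside t .proj₁) , inside t .proj₂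

consPath : ∀ {n} {H : Graph n} {ℓ x y} u → Adj H u x → (p : Path H ℓ x y) → (∀ s → Path.vertex p s ≢ u) → Path H (suc ℓ) u y
consPath {n} {H} {ℓ} {x} {y} u adj p fresh = record
  { vertex = v ; injective = inj ; start = refl ; end = Path.end p ; step = st }
  where
  v : Fin (suc (suc ℓ)) → Fin n
  v zero    = u
  v (suc s) = Path.vertex p s
  inj : ∀ {a b} → v a ≡ v b → a ≡ b
  inj {zero}  {zero}  eq = refl
  inj {zero}  {suc b} eq = ⊥-elim (fresh b (sym eq))
  inj {suc a} {zero}  eq = ⊥-elim (fresh a eq)
  inj {suc a} {suc b} eq = cong suc (Path.injective p eq)
  st : ∀ i → Adj H (v (inject₁ i)) (v (suc i))
  st zero    = subst (Adj H u) (sym (Path.start p)) adj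
  st (suc i) = Path.step p i

module _ {n} (H : Graph n) (avoided : Fin n) where

  data Step : Fin n → Fin n → Set where
    step : ∀ {a b} → Adj H a b → a ≢ avoided → b ≢ avoided → Step a b

  Step-sym : ∀ {a b} → Step a b → Step b a
  Step-sym (step adj a≢ b≢) = step (Adj-sym H adj) b≢ a≢

  -- `Acyclic` speaks of paths, so walks must lose their repetitions: if `u` already lies on the
  -- path built from the rest of the walk, that path is cut back to `u`; otherwise `u` is prepended.
  loop-erase : ∀ {u v} → u ≢ avoided → Star Step u v →
               ∃ λ ℓ → Σ[ p ∈ Path H ℓ u v ] (∀ s → Path.vertex p s ≢ avoided)
  loop-erase {u} u≢ ε = 0 , record
    { vertex = λ _ → u ; injective = λ { {zero} {zero} _ → refl } ; start = refl ; end = refl ; step = λ () }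
    , λ _ → u≢
  loop-erase {u} u≢ (step adj _ b≢ ◅ w) with loop-erase b≢ w
  ... | ℓ , p , avoids with Fin.any? (λ s → Path.vertex p s ≟ u)
  ... | no  u∉p = suc ℓ , consPath u adj p (λ s eq → u∉p (s , eq)) , λ { zero → u≢ ; (suc s) → avoids s }
  ... | yes (s , refl) with suffix p s
  ... | ℓ′ , q , inside = ℓ′ , q , λ t eq → avoids (inside t .proj₁) (trans (sym (inside t .proj₂)) eq)

  -- Such a walk, made into a path and closed up through `avoided`, would be a cycle; `u ≢ v` rules
  -- out the degenerate path of length zero.
  no-detour : Acyclic H → ∀ {u v} → Adj H avoided u → Adj H avoided v → u ≢ v → ¬ Star Step u v
  no-detour acyclic {u} {v} adjᵤ adjᵥ u≢v w with loop-erase (Adj⇒≢ H adjᵤ ∘ sym) w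
  ... | zero  , p , _      = u≢v (trans (sym (Path.start p)) (Path.end p))
  ... | suc ℓ , p , avoids =
    acyclic (suc (suc ℓ)) avoided v (ℕ.s≤s (ℕ.s≤s ℕ.z≤n)) (consPath avoided adjᵤ p avoids) (Adj-sym H adjᵥ)

module Distance {n} (H : Graph n) (conn : Connected H) where

  walk? : ∀ m i k → Dec (Walk-of H i k m)
  walk? zero i k with i ≟ k
  ... | yes refl = yes []
  ... | no  i≢k  = no λ { [] → i≢k refl }
  walk? (suc m) i k with Fin.any? (λ j → T? (Graph.adj H i j) ×-dec walk? m j k)
  ... | yes (j , adj , w) = yes (adj ∷ w)
  ... | no  none          = no λ { (_∷_ {j = j} adj w) → none (j , adj , w) }

  star⇒walk : ∀ {i k} → Star (Adj H) i k → ∃ (Walk-of H i k)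
  star⇒walk ε         = 0 , []
  star⇒walk (adj ◅ w) = suc (star⇒walk w .proj₁) , adj ∷ star⇒walk w .proj₂

  snoc : ∀ {i j k m} → Walk-of H i j m → Adj H j k → Walk-of H i k (suc m)
  snoc []      e = e ∷ []
  snoc (x ∷ w) e = x ∷ snoc w e

  reverse-walk : ∀ {i k m} → Walk-of H i k m → Walk-of H k i m
  reverse-walk []      = []
  reverse-walk (x ∷ w) = snoc (reverse-walk w) (Adj-sym H x)

  _++_ : ∀ {i j k l m} → Walk-of H i j l → Walk-of H j k m → Walk-of H i k (l ℕ.+ m)
  []      ++ w = w
  (x ∷ v) ++ w = x ∷ (v ++ w)

  opaque
    shortest : ∀ i k → ∃ λ l → Walk-of H i k l × (∀ m → Walk-of H i k m → l ℕ.≤ m)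
    shortest i k = least (λ m → walk? m i k) (star⇒walk (conn i k) .proj₁) (star⇒walk (conn i k) .proj₂)

  D : Fin n → Fin n → ℕ
  D i k = shortest i k .proj₁

  geodesic : ∀ i k → Walk-of H i k (D i k)
  geodesic i k = shortest i k .proj₂ .proj₁

  D-min : ∀ {i k m} → Walk-of H i k m → D i k ℕ.≤ m
  D-min {i} {k} {m} = shortest i k .proj₂ .proj₂ m

  D-refl : ∀ i → D i i ≡ 0
  D-refl i = ℕ.n≤0⇒n≡0 (D-min [])

  D≡0⇒≡ : ∀ {i k} → D i k ≡ 0 → i ≡ k
  D≡0⇒≡ {i} {k} eq with subst (Walk-of H i k) eq (geodesic i k)
  ... | [] = refl

  D-sym : ∀ i k → D i k ≡ D k i
  D-sym i k = ℕ.≤-antisym (D-min (reverse-walk (geodesic k i))) (D-min (reverse-walk (geodesic i k)))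

  D-triangle : ∀ i j k → D i k ℕ.≤ D i j ℕ.+ D j k
  D-triangle i j k = D-min (geodesic i j ++ geodesic j k)

  D-adj : ∀ {i j} → Adj H i j → ∀ k → D i k ℕ.≤ suc (D j k)
  D-adj {j = j} adj k = D-min (adj ∷ geodesic j k)

  closer : ∀ {i k} → i ≢ k → ∃ λ u → Adj H i u × D i k ≡ suc (D u k)
  closer {i} {k} i≢k = from (geodesic i k) refl
    where
    from : ∀ {m} → Walk-of H i k m → D i k ≡ m → ∃ λ u → Adj H i u × D i k ≡ suc (D u k)
    from []                 eq = ⊥-elim (i≢k refl)
    from (_∷_ {j = u} adj w) eq = u , adj ,
      ℕ.≤-antisym (D-adj adj k) (ℕ.≤-trans (ℕ.s≤s (D-min w)) (ℕ.≤-reflexive (sym eq)))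

  -- Always step to a nearer neighbour: from a start no farther from `k` than `i`, all later
  -- vertices are strictly nearer than `i` and so differ from it. The argument `m` is the distance,
  -- on which the recursion runs.
  descend : ∀ {i k} m a → D a k ≡ m → a ≢ i → D a k ℕ.≤ D i k → Star (Step H i) a k
  descend {i} {k} zero a eq a≢i le with D≡0⇒≡ {a} {k} eq
  ... | refl = ε
  descend {i} {k} (suc m) a eq a≢i le with a ≟ k
  ... | yes refl = ε
  ... | no  a≢k with closer a≢k
  ... | b , adj , a≡1+b = step adj a≢i b≢i ◅ descend m b (ℕ.suc-injective (trans (sym a≡1+b) eq)) b≢i (ℕ.<⇒≤ b<i)
    where
    b<i : D b k ℕ.< D i k
    b<i = ℕ.≤-trans (ℕ.≤-reflexive (sym a≡1+b)) le
    b≢i : b ≢ i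
    b≢i refl = ℕ.<-irrefl refl b<i

  module _ (acyclic : Acyclic H) where

    -- Otherwise the descents from `u` and from `v` join into a detour around `i`. The inequalities
    -- are weak so that `D-step` can also use a neighbour at equal distance.
    unique-closer′ : ∀ {i k u v} → Adj H i u → Adj H i v → D u k ℕ.≤ D i k → D v k ℕ.≤ D i k → u ≡ v
    unique-closer′ {i} {k} {u} {v} adjᵤ adjᵥ u≤i v≤i with u ≟ v
    ... | yes u≡v = u≡v
    ... | no  u≢v = ⊥-elim (no-detour H i acyclic adjᵤ adjᵥ u≢v
      (descend (D u k) u refl (Adj⇒≢ H adjᵤ ∘ sym) u≤i
       ◅◅ Star.reverse (Step-sym H i) (descend (D v k) v refl (Adj⇒≢ H adjᵥ ∘ sym) v≤i)))

    -- Trees are bipartite: a neighbour `j` exactly as far from `k` as `i` would have to coincide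
    -- with the neighbour `u` of `i` that is nearer.
    D-step : ∀ {i j} → Adj H i j → ∀ k → D i k ≡ suc (D j k) ⊎ D j k ≡ suc (D i k)
    D-step {i} {j} adj k with ℕ.<-cmp (D i k) (D j k)
    ... | tri< i<j _ _ = inj₂ (ℕ.≤-antisym (D-adj (Adj-sym H adj) k) i<j)
    ... | tri> _ _ j<i = inj₁ (ℕ.≤-antisym (D-adj adj k) j<i)
    ... | tri≈ _ i≡j _ with i ≟ k
    ... | yes refl = ⊥-elim (Adj⇒≢ H adj (sym (D≡0⇒≡ {j} {i} (trans (sym i≡j) (D-refl i)))))
    ... | no  i≢k with closer i≢k
    ... | u , adjᵤ , i≡1+u = ⊥-elim (ℕ.m≢1+m+n (D j k)
            (trans (trans (sym i≡j) i≡1+u) (cong suc (trans (cong (λ w → D w k)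
              (unique-closer′ adjᵤ adj (ℕ.≤-trans (ℕ.n≤1+n _) (ℕ.≤-reflexive (sym i≡1+u))) (ℕ.≤-reflexive (sym i≡j))))
              (sym (ℕ.+-identityʳ (D j k)))))))

    unique-closer : ∀ {i k u v} → Adj H i u → Adj H i v → D i k ≡ suc (D u k) → D i k ≡ suc (D v k) → u ≡ v
    unique-closer adjᵤ adjᵥ i≡1+u i≡1+v = unique-closer′ adjᵤ adjᵥ
      (ℕ.≤-trans (ℕ.n≤1+n _) (ℕ.≤-reflexive (sym i≡1+u))) (ℕ.≤-trans (ℕ.n≤1+n _) (ℕ.≤-reflexive (sym i≡1+v)))

-- Indices with `suc i ≡ inject₁ j` are consecutive steps, so the third hypothesis propagates the
-- initial rise to the end.
rising : ∀ {ℓ} (g : Fin (suc ℓ) → ℕ) →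
         (∀ (i : Fin ℓ) → g (inject₁ i) ≡ suc (g (suc i)) ⊎ g (suc i) ≡ suc (g (inject₁ i))) →
         (∀ (i j : Fin ℓ) → suc i ≡ inject₁ j → g (suc i) ≡ suc (g (inject₁ i)) → g (suc j) ≡ suc (g (inject₁ j))) →
         (∀ (i : Fin ℓ) → toℕ i ≡ 0 → g (suc i) ≡ suc (g (inject₁ i))) →
         ∀ s → g s ≡ toℕ s ℕ.+ g zero
rising         g ±1 no-peak up zero    = refl
rising {suc ℓ} g ±1 no-peak up (suc s) =
  trans (rising (g ∘ suc) (λ i → ±1 (suc i)) (λ i j eq → no-peak (suc i) (suc j) (cong suc eq)) next s)
        (trans (cong (toℕ s ℕ.+_) (up zero refl)) (ℕ.+-suc (toℕ s) (g zero)))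
  where
  next : ∀ i → toℕ i ≡ 0 → g (suc (suc i)) ≡ suc (g (suc (inject₁ i)))
  next zero _ = no-peak zero (suc zero) refl (up zero refl)

-- A ±1 sequence that never turns downwards after a rise is a shifted absolute value.
valley : ∀ {ℓ} (g : Fin (suc ℓ) → ℕ) →
         (∀ (i : Fin ℓ) → g (inject₁ i) ≡ suc (g (suc i)) ⊎ g (suc i) ≡ suc (g (inject₁ i))) →
         (∀ (i j : Fin ℓ) → suc i ≡ inject₁ j → g (suc i) ≡ suc (g (inject₁ i)) → g (suc j) ≡ suc (g (inject₁ j))) →
         ∃ λ p → ∃ λ h → p ℕ.≤ ℓ × (∀ s → g s ≡ ℕ.∣ toℕ s - p ∣ ℕ.+ h)
valley {zero} g ±1 no-peak = 0 , g zero , ℕ.z≤n , λ { zero → refl }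
valley {suc ℓ} g ±1 no-peak with ±1 zero
... | inj₂ up = 0 , g zero , ℕ.z≤n , λ s →
      trans (rising g ±1 no-peak (λ { zero _ → up }) s) (cong (ℕ._+ g zero) (sym (ℕ.∣-∣-identityʳ (toℕ s))))
... | inj₁ down with valley (g ∘ suc) (λ i → ±1 (suc i)) (λ i j eq → no-peak (suc i) (suc j) (cong suc eq))
... | p , h , p≤ℓ , eq = suc p , h , ℕ.s≤s p≤ℓ , λ { zero → trans down (cong suc (eq zero)) ; (suc s) → eq s }

-- Feet and heights over a path

module PathProfile {n} (H : Graph n) (conn : Connected H) (acyclic : Acyclic H)
                   {ℓ x y} (π : Path H ℓ x y) where
  open Distance H conn
  open Path π renaming (vertex to v)

  abstract
    profile : ∀ k → ∃ λ p → ∃ λ h → p ℕ.≤ ℓ × (∀ s → D (v s) k ≡ ℕ.∣ toℕ s - p ∣ ℕ.+ h)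
    profile k = valley (λ s → D (v s) k) (λ i → D-step acyclic (Path.step π i) k) no-peak
      where
      no-peak : ∀ i j → suc i ≡ inject₁ j → D (v (suc i)) k ≡ suc (D (v (inject₁ i)) k) → D (v (suc j)) k ≡ suc (D (v (inject₁ j)) k)
      no-peak i j i+1≡j up with D-step acyclic (Path.step π j) k
      ... | inj₂ up′  = up′
      -- A rise followed by a fall makes both outer vertices the nearer neighbour of the middle one,
      -- so they coincide; injectivity then gives i = j + 1 beside j = i + 1.
      ... | inj₁ down = ⊥-elim (ℕ.m≢1+n+m (toℕ i) {1} (trans i≡1+j (cong suc j≡1+i)))
        where
        i≡j+1 : v (inject₁ i) ≡ v (suc j)
        i≡j+1 = unique-closer acyclic
          (subst (λ w → Adj H w (v (inject₁ i))) (cong v i+1≡j) (Adj-sym H (Path.step π i))) (Path.step π j)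
          (subst (λ w → D w k ≡ suc (D (v (inject₁ i)) k)) (cong v i+1≡j) up) down
        j≡1+i : toℕ j ≡ suc (toℕ i)
        j≡1+i = trans (sym (Fin.toℕ-inject₁ j)) (sym (cong toℕ i+1≡j))
        i≡1+j : toℕ i ≡ suc (toℕ j)
        i≡1+j = trans (sym (Fin.toℕ-inject₁ i)) (cong toℕ (injective i≡j+1))

  pos height : Fin n → ℕ
  pos k = profile k .proj₁
  height k = profile k .proj₂ .proj₁

  pos≤ℓ : ∀ k → pos k ℕ.≤ ℓ
  pos≤ℓ k = profile k .proj₂ .proj₂ .proj₁

  D-v : ∀ s k → D (v s) k ≡ ℕ.∣ toℕ s - pos k ∣ ℕ.+ height k
  D-v s k = profile k .proj₂ .proj₂ .proj₂ s

  D-start : ∀ k → D x k ≡ pos k ℕ.+ height k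
  D-start k = trans (cong (λ w → D w k) (sym start)) (D-v zero k)

  D-end : ∀ k → D y k ≡ (ℓ ℕ.∸ pos k) ℕ.+ height k
  D-end k = trans (cong (λ w → D w k) (sym end)) (trans (D-v (fromℕ ℓ) k)
    (cong (ℕ._+ height k) (trans (cong (λ a → ℕ.∣ a - pos k ∣) (Fin.toℕ-fromℕ ℓ)) (ℕ.m≤n⇒∣n-m∣≡n∸m (pos≤ℓ k)))))

  height-v : ∀ s → height (v s) ≡ 0
  height-v s = ℕ.m+n≡0⇒n≡0 ℕ.∣ toℕ s - pos (v s) ∣ (trans (sym (D-v s (v s))) (D-refl (v s)))

  pos-v : ∀ s → pos (v s) ≡ toℕ s
  pos-v s = sym (ℕ.∣m-n∣≡0⇒m≡n (ℕ.m+n≡0⇒m≡0 ℕ.∣ toℕ s - pos (v s) ∣ (trans (sym (D-v s (v s))) (D-refl (v s)))))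

  foot : Fin n → Fin (suc ℓ)
  foot k = fromℕ< (ℕ.s≤s (pos≤ℓ k))

  toℕ-foot : ∀ k → toℕ (foot k) ≡ pos k
  toℕ-foot k = Fin.toℕ-fromℕ< (ℕ.s≤s (pos≤ℓ k))

  D-foot : ∀ k → D (v (foot k)) k ≡ height k
  D-foot k = trans (D-v (foot k) k) (cong (ℕ._+ height k) (ℕ.m≡n⇒∣m-n∣≡0 (toℕ-foot k)))

  height≡0⇒on-path : ∀ k → height k ≡ 0 → k ≡ v (foot k)
  height≡0⇒on-path k h≡0 = sym (D≡0⇒≡ (trans (D-foot k) h≡0))

  -- Go from `i` down to its foot, along the path, and up to `j`. What this route wastes is later
  -- measured by `slack`.
  D-upper : ∀ i j → D i j ℕ.≤ ℕ.∣ pos i - pos j ∣ ℕ.+ height i ℕ.+ height j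
  D-upper i j = ℕ.≤-trans (D-triangle i a j) (ℕ.≤-trans (ℕ.+-monoʳ-≤ (D i a) (D-triangle a b j)) (ℕ.≤-reflexive (begin
    D i a ℕ.+ (D a b ℕ.+ D b j)                            ≡⟨ cong₂ ℕ._+_ (trans (D-sym i a) (D-foot i)) (cong₂ ℕ._+_ D-ab (D-foot j)) ⟩
    height i ℕ.+ (ℕ.∣ pos i - pos j ∣ ℕ.+ height j)        ≡⟨ ℕ.+-assoc (height i) _ _ ⟨
    (height i ℕ.+ ℕ.∣ pos i - pos j ∣) ℕ.+ height j        ≡⟨ cong (ℕ._+ height j) (ℕ.+-comm (height i) _) ⟩
    ℕ.∣ pos i - pos j ∣ ℕ.+ height i ℕ.+ height j          ∎)))
    where
    a = v (foot i)
    b = v (foot j)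
    D-ab : D a b ≡ ℕ.∣ pos i - pos j ∣
    D-ab = trans (D-v (foot i) b) (trans (cong₂ ℕ._+_ (cong₂ ℕ.∣_-_∣ (toℕ-foot i) (trans (pos-v (foot j)) (toℕ-foot j))) (height-v (foot j)))
             (ℕ.+-identityʳ _))

-- Laplacians of distances

module TreeLaplacian {n} (H : Graph n) (conn : Connected H) (acyclic : Acyclic H) where
  open Distance H conn

  Dℚ : Matrix n
  Dℚ i j = ι (D i j)

  adj⇒±1 : ∀ {i j} → Adj H i j → ∀ k → Dℚ i k - Dℚ j k ≡ 1ℚ ⊎ Dℚ i k - Dℚ j k ≡ - 1ℚ
  adj⇒±1 {i} {j} adj k = Sum.map
    (λ eq → trans (cong (_- Dℚ j k) (trans (cong ι eq) (ι-suc (D j k)))) (ring (Dℚ j k)))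
    (λ eq → trans (cong (_-_ (Dℚ i k)) (trans (cong ι eq) (ι-suc (D i k)))) (ring′ (Dℚ i k)))
    (D-step acyclic adj k)
    where
    ring : ∀ x → (1ℚ + x) - x ≡ 1ℚ
    ring = solve-∀ ℚ-ring
    ring′ : ∀ x → x - (1ℚ + x) ≡ - 1ℚ
    ring′ = solve-∀ ℚ-ring

  adj⇒square≡1 : ∀ {i j} → Adj H i j → ∀ k → (Dℚ i k - Dℚ j k) * (Dℚ i k - Dℚ j k) ≡ 1ℚ
  adj⇒square≡1 {i} {j} adj k = split (Dℚ i k - Dℚ j k) (adj⇒±1 {i} {j} adj k)
    where
    split : ∀ z → z ≡ 1ℚ ⊎ z ≡ - 1ℚ → z * z ≡ 1ℚ
    split z (inj₁ refl) = refl
    split z (inj₂ refl) = refl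

  -- When `j` differs from `k`, exactly one neighbour is nearer to `k` and contributes 1, all others
  -- -1; at `k` every neighbour contributes -1. Hence `τ j = ι 2 - d H j` works for all `k` at once.
  L-D : ∀ j k → L H (λ i → Dℚ i k) j ≡ (ι 2 - d H j) - ι 2 * δ j k
  L-D j k = split (j ≟ k)
    where
    split : Dec (j ≡ k) → L H (λ i → Dℚ i k) j ≡ (ι 2 - d H j) - ι 2 * δ j k
    split (yes refl) = begin
      L H (λ i → Dℚ i j) j           ≡⟨ ∑-cong (λ l → A-cong H j l (away l)) ⟩
      ∑ (λ l → A H j l * - 1ℚ)       ≡⟨ ∑-*ʳ (- 1ℚ) (A H j) ⟩
      d H j * - 1ℚ                   ≡⟨ ring (d H j) ⟩
      (ι 2 - d H j) - ι 2 * 1ℚ       ≡⟨ cong (λ x → (ι 2 - d H j) - ι 2 * x) (δ-refl j) ⟨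
      (ι 2 - d H j) - ι 2 * δ j j    ∎
      where
      ring : ∀ x → x * - 1ℚ ≡ (ι 2 - x) - ι 2 * 1ℚ
      ring = solve-∀ ℚ-ring
      away : ∀ l → Adj H j l → Dℚ j j - Dℚ l j ≡ - 1ℚ
      away l adj = Sum.[ (λ eq → ⊥-elim (ℕ.0≢1+n (trans (sym (D-refl j)) eq)))
                       , (λ eq → cong₂ (λ a b → ι a - ι b) (D-refl j) (trans eq (cong suc (D-refl j)))) ]
                       (D-step acyclic adj j)
    split (no j≢k) = begin
      L H (λ i → Dℚ i k) j                          ≡⟨ ∑-cong towards ⟩
      ∑ (λ l → A H j l * - 1ℚ + ι 2 * δ l u)        ≡⟨ ∑-+ _ _ ⟩
      ∑ (λ l → A H j l * - 1ℚ) + ∑ (λ l → ι 2 * δ l u)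
        ≡⟨ cong₂ _+_ (∑-*ʳ (- 1ℚ) (A H j)) (trans (∑-cong (λ l → ℚ.*-comm (ι 2) (δ l u))) (∑-δ u (λ _ → ι 2))) ⟩
      d H j * - 1ℚ + ι 2                            ≡⟨ ring (d H j) ⟩
      (ι 2 - d H j) - ι 2 * 0ℚ                      ≡⟨ cong (λ x → (ι 2 - d H j) - ι 2 * x) (δ-≢ j≢k) ⟨
      (ι 2 - d H j) - ι 2 * δ j k                   ∎
      where
      u = closer j≢k .proj₁
      adjᵤ = closer j≢k .proj₂ .proj₁
      j≡1+u = closer j≢k .proj₂ .proj₂
      ring : ∀ x → x * - 1ℚ + ι 2 ≡ (ι 2 - x) - ι 2 * 0ℚ
      ring = solve-∀ ℚ-ring
      ring′ : ∀ x → x + ι 2 * 0ℚ ≡ x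
      ring′ = solve-∀ ℚ-ring
      1≡ : Dℚ j k - Dℚ u k ≡ 1ℚ
      1≡ = trans (cong (_- Dℚ u k) (trans (cong ι j≡1+u) (ι-suc (D u k)))) (ring″ (Dℚ u k))
        where
        ring″ : ∀ x → (1ℚ + x) - x ≡ 1ℚ
        ring″ = solve-∀ ℚ-ring
      towards : ∀ l → A H j l * (Dℚ j k - Dℚ l k) ≡ A H j l * - 1ℚ + ι 2 * δ l u
      towards l = split′ (l ≟ u)
        where
        split′ : Dec (l ≡ u) → A H j l * (Dℚ j k - Dℚ l k) ≡ A H j l * - 1ℚ + ι 2 * δ l u
        split′ (yes refl) = trans (cong₂ _*_ (adj⇒A≡1 H j l adjᵤ) 1≡)
          (sym (cong₂ (λ a b → a * - 1ℚ + ι 2 * b) (adj⇒A≡1 H j l adjᵤ) (δ-refl l)))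
        split′ (no l≢u) = trans (A-cong H j l farther)
          (sym (trans (cong (λ b → A H j l * - 1ℚ + ι 2 * b) (δ-≢ l≢u)) (ring′ (A H j l * - 1ℚ))))
          where
          farther : Adj H j l → Dℚ j k - Dℚ l k ≡ - 1ℚ
          farther adj = Sum.[ (λ eq → ⊥-elim (l≢u (unique-closer acyclic adj adjᵤ eq j≡1+u)))
                            , (λ eq → trans (cong (λ b → Dℚ j k - b) (trans (cong ι eq) (ι-suc (D j k)))) (ring‴ (Dℚ j k))) ]
                            (D-step acyclic adj k)
            where
            ring‴ : ∀ x → x - (1ℚ + x) ≡ - 1ℚ
            ring‴ = solve-∀ ℚ-ring

  D-resistance : IsResistance H Dℚ
  D-resistance = record
    { symmetric = λ i j → cong ι (D-sym i j)
    ; diagonal  = λ i → cong ι (D-refl i)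
    ; τ         = λ j → ι 2 - d H j
    ; laplacian = L-D
    }

  edgeForm-D : ∀ k → edgeForm H (λ i → Dℚ i k) (λ i → Dℚ i k) ≡ vol H
  edgeForm-D k = ∑-cong (λ i → ∑-cong (λ j → trans (A-cong H i j (λ adj → adj⇒square≡1 adj k)) (ℚ.*-identityʳ (A H i j))))

  σ : Fin n → ℚ
  σ k = ∑ (λ i → Dℚ i k)

  -- Solving `L-D` for the degree leaves the Dirichlet energy of the distance to `k`, and that is
  -- `vol H` because the distance changes by one along every edge.
  ∑dD : ∀ k → ι 2 * ∑ (λ i → d H i * Dℚ i k) ≡ ι 4 * σ k - vol H
  ∑dD k = begin
    ι 2 * ∑ (λ i → d H i * Dℚ i k)
      ≡⟨ cong (ι 2 *_) (∑-cong (λ i → trans (ring (d H i) (Dℚ i k) (δ i k))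
           (cong (λ z → (ι 2 * Dℚ i k - ι 2 * (δ i k * Dℚ i k)) - Dℚ i k * z) (sym (L-D i k))))) ⟩
    ι 2 * ∑ (λ i → (ι 2 * Dℚ i k - ι 2 * (δ i k * Dℚ i k)) - Dℚ i k * L H (λ a → Dℚ a k) i)
      ≡⟨ cong (ι 2 *_) (trans (∑-- _ _) (cong (_- X) (trans (∑-- _ _) (cong₂ _-_ (∑-*ˡ (ι 2) _) (trans (∑-*ˡ (ι 2) _) (cong (ι 2 *_) (∑-δ k (λ i → Dℚ i k)))))))) ⟩
    ι 2 * ((ι 2 * σ k - ι 2 * Dℚ k k) - X)                   ≡⟨ cong (λ z → ι 2 * ((ι 2 * σ k - ι 2 * z) - X)) (cong ι (D-refl k)) ⟩
    ι 2 * ((ι 2 * σ k - ι 2 * 0ℚ) - X)                       ≡⟨ ring′ (σ k) X ⟩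
    ι 4 * σ k - ι 2 * X                                      ≡⟨ cong (_-_ (ι 4 * σ k)) (trans (green H (λ i → Dℚ i k) (λ i → Dℚ i k)) (edgeForm-D k)) ⟩
    ι 4 * σ k - vol H                                        ∎
    where
    X = ∑ (λ i → Dℚ i k * L H (λ a → Dℚ a k) i)
    ring : ∀ d x e → d * x ≡ (ι 2 * x - ι 2 * (e * x)) - x * ((ι 2 - d) - ι 2 * e)
    ring = solve-∀ ℚ-ring
    ring′ : ∀ s x → ι 2 * ((ι 2 * s - ι 2 * 0ℚ) - x) ≡ ι 4 * s - ι 2 * x
    ring′ = solve-∀ ℚ-ring

module PathLaplacian {n} (H : Graph n) (conn : Connected H) (acyclic : Acyclic H)
                     {ℓ x y} (π : Path H ℓ x y) where
  open Distance H conn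
  open TreeLaplacian H conn acyclic
  open PathProfile H conn acyclic π

  p h : Fin n → ℚ
  p i = ι (pos i)
  h i = ι (height i)

  D-start-ℚ : ∀ i → Dℚ i x ≡ p i + h i
  D-start-ℚ i = trans (cong ι (trans (D-sym i x) (D-start i))) (ι-+ (pos i) (height i))

  D-end-ℚ : ∀ i → Dℚ i y ≡ (ι ℓ - p i) + h i
  D-end-ℚ i = trans (cong ι (trans (D-sym i y) (D-end i)))
    (trans (ι-+ (ℓ ℕ.∸ pos i) (height i)) (cong (_+ h i) (ι-∸ (pos≤ℓ i))))

  -- Expressing `p`, and likewise `h`, through the distances to the two ends makes their Laplacians
  -- instances of `L-D`.
  p≡ : ∀ i → p i ≡ ½ * ((Dℚ i x - Dℚ i y) + ι ℓ)
  p≡ i = trans (ring (p i) (h i) (ι ℓ)) (cong₂ (λ a b → ½ * ((a - b) + ι ℓ)) (sym (D-start-ℚ i)) (sym (D-end-ℚ i)))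
    where
    ring : ∀ p h l → p ≡ ½ * (((p + h) - ((l - p) + h)) + l)
    ring = solve-∀ ℚ-ring

  h≡ : ∀ i → h i ≡ ½ * ((Dℚ i x + Dℚ i y) - ι ℓ)
  h≡ i = trans (ring (p i) (h i) (ι ℓ)) (cong₂ (λ a b → ½ * ((a + b) - ι ℓ)) (sym (D-start-ℚ i)) (sym (D-end-ℚ i)))
    where
    ring : ∀ p h l → h ≡ ½ * (((p + h) + ((l - p) + h)) - l)
    ring = solve-∀ ℚ-ring

  L-cong : ∀ {f g : Fin n → ℚ} → (∀ i → f i ≡ g i) → ∀ j → L H f j ≡ L H g j
  L-cong f≡g j = ∑-cong (λ l → cong₂ (λ a b → A H j l * (a - b)) (f≡g j) (f≡g l))

  L-p : ∀ j → L H p j ≡ δ j y - δ j x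
  L-p j = begin
    L H p j                                                        ≡⟨ L-cong p≡ j ⟩
    L H (λ i → ½ * ((Dℚ i x - Dℚ i y) + ι ℓ)) j                    ≡⟨ L-* H ½ (λ i → (Dℚ i x - Dℚ i y) + ι ℓ) j ⟩
    ½ * L H (λ i → (Dℚ i x - Dℚ i y) + ι ℓ) j                      ≡⟨ cong (½ *_) (trans (L-+ H (λ i → Dℚ i x - Dℚ i y) (λ _ → ι ℓ) j)
                                                                        (cong₂ _+_ (trans (L-- H (λ i → Dℚ i x) (λ i → Dℚ i y) j) (cong₂ _-_ (L-D j x) (L-D j y))) (L-const H (ι ℓ) j))) ⟩
    ½ * ((((ι 2 - d H j) - ι 2 * δ j x) - ((ι 2 - d H j) - ι 2 * δ j y)) + 0ℚ)  ≡⟨ ring (d H j) (δ j x) (δ j y) ⟩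
    δ j y - δ j x                                                  ∎
    where
    ring : ∀ d a b → ½ * ((((ι 2 - d) - ι 2 * a) - ((ι 2 - d) - ι 2 * b)) + 0ℚ) ≡ b - a
    ring = solve-∀ ℚ-ring

  -- The terms `ι 2 - d H j`, which cancel in `L-p`, add up here; the right side is 2 minus the
  -- degree in the graph with the new edge.
  L-h : ∀ j → L H h j ≡ ι 2 - (d H j + δ j x + δ j y)
  L-h j = begin
    L H h j                                                        ≡⟨ L-cong h≡ j ⟩
    L H (λ i → ½ * ((Dℚ i x + Dℚ i y) - ι ℓ)) j                    ≡⟨ L-* H ½ (λ i → (Dℚ i x + Dℚ i y) - ι ℓ) j ⟩
    ½ * L H (λ i → (Dℚ i x + Dℚ i y) - ι ℓ) j                      ≡⟨ cong (½ *_) (trans (L-- H (λ i → Dℚ i x + Dℚ i y) (λ _ → ι ℓ) j)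
                                                                        (cong₂ _-_ (trans (L-+ H (λ i → Dℚ i x) (λ i → Dℚ i y) j) (cong₂ _+_ (L-D j x) (L-D j y))) (L-const H (ι ℓ) j))) ⟩
    ½ * ((((ι 2 - d H j) - ι 2 * δ j x) + ((ι 2 - d H j) - ι 2 * δ j y)) - 0ℚ)  ≡⟨ ring (d H j) (δ j x) (δ j y) ⟩
    ι 2 - (d H j + δ j x + δ j y)                                  ∎
    where
    ring : ∀ d a b → ½ * ((((ι 2 - d) - ι 2 * a) + ((ι 2 - d) - ι 2 * b)) - 0ℚ) ≡ ι 2 - (d + a + b)
    ring = solve-∀ ℚ-ring

  -- Along an edge D(·,x) = p + h and D(·,y) = ℓ - p + h both change by ±1.
  adj⇒ΔpΔh≡0 : ∀ {i j} → Adj H i j → (p i - p j) * (h i - h j) ≡ 0ℚ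
  adj⇒ΔpΔh≡0 {i} {j} adj = *-cancelˡ {ι 4} (λ ()) (begin
    ι 4 * ((p i - p j) * (h i - h j))    ≡⟨ ring (p i) (p j) (h i) (h j) (ι ℓ) ⟩
    sq ((p i + h i) - (p j + h j)) - sq (((ι ℓ - p i) + h i) - ((ι ℓ - p j) + h j))
      ≡⟨ cong₂ _-_ (cong sq (cong₂ _-_ (sym (D-start-ℚ i)) (sym (D-start-ℚ j)))) (cong sq (cong₂ _-_ (sym (D-end-ℚ i)) (sym (D-end-ℚ j)))) ⟩
    sq (Dℚ i x - Dℚ j x) - sq (Dℚ i y - Dℚ j y)  ≡⟨ cong₂ _-_ (adj⇒square≡1 {i} {j} adj x) (adj⇒square≡1 {i} {j} adj y) ⟩
    0ℚ                                   ≡⟨ ℚ.*-zeroʳ (ι 4) ⟨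
    ι 4 * 0ℚ                             ∎)
    where
    sq : ℚ → ℚ
    sq z = z * z
    ring : ∀ a b u w l → ι 4 * ((a - b) * (u - w)) ≡ ((a + u) - (b + w)) * ((a + u) - (b + w)) - (((l - a) + u) - ((l - b) + w)) * (((l - a) + u) - ((l - b) + w))
    ring = solve-∀ ℚ-ring

  adj⇒ΔFΔh≡0 : ∀ (F : ℕ → ℚ) {i j} → Adj H i j → (F (pos i) - F (pos j)) * (h i - h j) ≡ 0ℚ
  adj⇒ΔFΔh≡0 F {i} {j} adj = split (pos i ℕ.≟ pos j)
    where
    split : Dec (pos i ≡ pos j) → (F (pos i) - F (pos j)) * (h i - h j) ≡ 0ℚ
    split (yes eq) = trans (cong (_* (h i - h j)) (trans (cong (λ a → F a - F (pos j)) eq) (ℚ.+-inverseʳ (F (pos j))))) (ℚ.*-zeroˡ (h i - h j))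
    split (no neq) = trans (cong ((F (pos i) - F (pos j)) *_)
      (*-zero-factor {p i - p j} {h i - h j} (λ z → neq (ι-injective {pos i} {pos j} (x-y≡0⇒x≡y {p i} {p j} z))) (adj⇒ΔpΔh≡0 {i} {j} adj))) (ℚ.*-zeroʳ (F (pos i) - F (pos j)))

  d⁺ : Fin n → ℚ
  d⁺ j = d H j + δ j x + δ j y

  -- By `L-h` the sides differ by half the mutual energy of `F ∘ pos` and `h`, which `adj⇒ΔFΔh≡0`
  -- kills edge by edge. The constant `F` already gives the edge count of a tree.
  ∑d⁺F : ∀ (F : ℕ → ℚ) → ∑ (λ j → d⁺ j * F (pos j)) ≡ ι 2 * ∑ (λ j → F (pos j))
  ∑d⁺F F = begin
    ∑ (λ j → d⁺ j * F (pos j))                              ≡⟨ ∑-cong (λ j → trans (ring (d⁺ j) (F (pos j))) (cong (λ z → ι 2 * F (pos j) - F (pos j) * z) (sym (L-h j)))) ⟩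
    ∑ (λ j → ι 2 * F (pos j) - F (pos j) * L H h j)         ≡⟨ trans (∑-- _ _) (cong (_- X) (∑-*ˡ (ι 2) _)) ⟩
    ι 2 * ∑ (λ j → F (pos j)) - X                           ≡⟨ cong (_-_ (ι 2 * ∑ (λ j → F (pos j)))) X≡0 ⟩
    ι 2 * ∑ (λ j → F (pos j)) - 0ℚ                          ≡⟨ ℚ.+-identityʳ _ ⟩
    ι 2 * ∑ (λ j → F (pos j))                               ∎
    where
    ring : ∀ d f → d * f ≡ ι 2 * f - f * (ι 2 - d)
    ring = solve-∀ ℚ-ring
    X = ∑ (λ j → F (pos j) * L H h j)
    X≡0 : X ≡ 0ℚ
    X≡0 = *-cancelˡ {ι 2} (λ ()) (trans (green H (λ j → F (pos j)) h) (trans (∑-zero (λ i → ∑-zero (λ j →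
      trans (A-cong H i j (adj⇒ΔFΔh≡0 F {i} {j})) (ℚ.*-zeroʳ (A H i j))))) (sym (ℚ.*-zeroʳ (ι 2)))))

  ∑d⁺≡2n : ∑ d⁺ ≡ ι 2 * ι n
  ∑d⁺≡2n = trans (∑-cong (λ j → sym (ℚ.*-identityʳ (d⁺ j)))) (trans (∑d⁺F (λ _ → 1ℚ))
    (cong (ι 2 *_) (trans (∑-const n 1ℚ) (ℚ.*-identityʳ (ι n)))))

  ∑d⁺g : ∀ (g : Fin n → ℚ) → ∑ (λ j → d⁺ j * g j) ≡ ∑ (λ j → d H j * g j) + g x + g y
  ∑d⁺g g = begin
    ∑ (λ j → d⁺ j * g j)                                              ≡⟨ ∑-cong (λ j → ring (d H j) (δ j x) (δ j y) (g j)) ⟩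
    ∑ (λ j → d H j * g j + δ j x * g j + δ j y * g j)                 ≡⟨ trans (∑-+ _ _) (cong (_+ ∑ (λ j → δ j y * g j)) (∑-+ _ _)) ⟩
    ∑ (λ j → d H j * g j) + ∑ (λ j → δ j x * g j) + ∑ (λ j → δ j y * g j)  ≡⟨ cong₂ (λ a b → ∑ (λ j → d H j * g j) + a + b) (∑-δ x g) (∑-δ y g) ⟩
    ∑ (λ j → d H j * g j) + g x + g y                                 ∎
    where
    ring : ∀ d a b g → (d + a + b) * g ≡ d * g + a * g + b * g
    ring = solve-∀ ℚ-ring

  vol≡2n-2 : vol H ≡ ι 2 * ι n - ι 2
  vol≡2n-2 = begin
    vol H                                            ≡⟨ ∑-cong (λ j → sym (ℚ.*-identityʳ (d H j))) ⟩
    ∑ (λ j → d H j * 1ℚ)                             ≡⟨ ring (∑ (λ j → d H j * 1ℚ)) ⟩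
    (∑ (λ j → d H j * 1ℚ) + 1ℚ + 1ℚ) - ι 2           ≡⟨ cong (_- ι 2) (∑d⁺g (λ _ → 1ℚ)) ⟨
    ∑ (λ j → d⁺ j * 1ℚ) - ι 2                        ≡⟨ cong (_- ι 2) (trans (∑-cong (λ j → ℚ.*-identityʳ (d⁺ j))) ∑d⁺≡2n) ⟩
    ι 2 * ι n - ι 2                                  ∎
    where
    ring : ∀ x → x ≡ (x + 1ℚ + 1ℚ) - ι 2
    ring = solve-∀ ℚ-ring

-- Adding an edge to a tree

if-∧ : ∀ a b → (if a then 1ℚ else 0ℚ) * (if b then 1ℚ else 0ℚ) ≡ (if a ∧ b then 1ℚ else 0ℚ)
if-∧ true  true  = refl
if-∧ true  false = refl
if-∧ false true  = refl
if-∧ false false = refl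

if-∨ : ∀ e u v → (e ≡ true → u ≡ false × v ≡ false) → (u ≡ true → v ≡ false) →
       (if e ∨ (u ∨ v) then 1ℚ else 0ℚ) ≡ (if e then 1ℚ else 0ℚ) + ((if u then 1ℚ else 0ℚ) + (if v then 1ℚ else 0ℚ))
if-∨ true  u     v     e⇒ u⇒ with e⇒ refl
... | refl , refl = refl
if-∨ false true  v     e⇒ u⇒ with u⇒ refl
... | refl = refl
if-∨ false false true  e⇒ u⇒ = refl
if-∨ false false false e⇒ u⇒ = refl

both : ∀ {n} {i j x y : Fin n} → does (i ≟ x) ∧ does (j ≟ y) ≡ true → i ≡ x × j ≡ y
both {i = i} {j} {x} {y} eq with i ≟ x | j ≟ y
... | yes i≡x | yes j≡y = i≡x , j≡y

δ-* : ∀ {n} (j x : Fin n) (f : Fin n → ℚ) → δ j x * f j ≡ δ j x * f x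
δ-* j x f with j ≟ x
... | yes refl = refl
... | no  _    = trans (ℚ.*-zeroˡ (f j)) (sym (ℚ.*-zeroˡ (f x)))

module AddEdge {n} (H : Graph n) {x y : Fin n} (x≢y : x ≢ y) (¬adj : ¬ Adj H x y) where

  G : Graph n
  G = addEdge H x y x≢y

  -- As `x` and `y` are distinct and not adjacent, the three alternatives exclude each other and the
  -- disjunction becomes a sum of indicators.
  A-addEdge : ∀ i j → A G i j ≡ A H i j + (δ i x * δ j y + δ j x * δ i y)
  A-addEdge i j = trans (if-∨ (Graph.adj H i j) (does (i ≟ x) ∧ does (j ≟ y)) (does (j ≟ x) ∧ does (i ≟ y)) old new)
    (cong₂ (λ a b → A H i j + (a + b)) (sym (if-∧ (does (i ≟ x)) (does (j ≟ y)))) (sym (if-∧ (does (j ≟ x)) (does (i ≟ y)))))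
    where
    old : Graph.adj H i j ≡ true → does (i ≟ x) ∧ does (j ≟ y) ≡ false × does (j ≟ x) ∧ does (i ≟ y) ≡ false
    old eq = ¬-not (λ t → not-xy (both {i = i} {j} t)) , ¬-not (λ t → not-yx (both {i = j} {i} t))
      where
      adj : Adj H i j
      adj = subst T (sym eq) tt
      not-xy : i ≡ x × j ≡ y → ⊥
      not-xy (refl , refl) = ¬adj adj
      not-yx : j ≡ x × i ≡ y → ⊥
      not-yx (refl , refl) = ¬adj (Adj-sym H adj)
    new : does (i ≟ x) ∧ does (j ≟ y) ≡ true → does (j ≟ x) ∧ does (i ≟ y) ≡ false
    new eq = ¬-not (λ t → x≢y (trans (sym (both {i = i} {j} eq .proj₁)) (both {i = j} {i} t .proj₂)))

  L-addEdge : ∀ f j → L G f j ≡ L H f j + (δ j x - δ j y) * (f x - f y)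
  L-addEdge f j = begin
    L G f j
      ≡⟨ ∑-cong (λ l → trans (cong (_* (f j - f l)) (A-addEdge j l)) (ring (A H j l) (δ j x) (δ l y) (δ l x) (δ j y) (f j - f l))) ⟩
    ∑ (λ l → A H j l * (f j - f l) + (δ j x * (δ l y * (f j - f l)) + δ j y * (δ l x * (f j - f l))))
      ≡⟨ trans (∑-+ _ _) (cong (_+_ (L H f j)) (trans (∑-+ _ _) (cong₂ _+_
           (trans (∑-*ˡ (δ j x) _) (cong (δ j x *_) (∑-δ y (λ l → f j - f l))))
           (trans (∑-*ˡ (δ j y) _) (cong (δ j y *_) (∑-δ x (λ l → f j - f l))))))) ⟩
    L H f j + (δ j x * (f j - f y) + δ j y * (f j - f x))
      ≡⟨ cong (_+_ (L H f j)) (cong₂ _+_ (δ-* j x (λ l → f l - f y)) (δ-* j y (λ l → f l - f x))) ⟩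
    L H f j + (δ j x * (f x - f y) + δ j y * (f y - f x))    ≡⟨ cong (_+_ (L H f j)) (ring′ (δ j x) (δ j y) (f x) (f y)) ⟩
    L H f j + (δ j x - δ j y) * (f x - f y)                  ∎
    where
    ring : ∀ a jx ly lx jy g → (a + (jx * ly + lx * jy)) * g ≡ a * g + (jx * (ly * g) + jy * (lx * g))
    ring = solve-∀ ℚ-ring
    ring′ : ∀ a b u v → a * (u - v) + b * (v - u) ≡ (a - b) * (u - v)
    ring′ = solve-∀ ℚ-ring

  d-addEdge : ∀ j → d G j ≡ d H j + δ j x + δ j y
  d-addEdge j = begin
    d G j                                                               ≡⟨ ∑-cong (A-addEdge j) ⟩
    ∑ (λ l → A H j l + (δ j x * δ l y + δ l x * δ j y))                 ≡⟨ trans (∑-+ _ _) (cong (d H j +_) (∑-+ _ _)) ⟩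
    d H j + (∑ (λ l → δ j x * δ l y) + ∑ (λ l → δ l x * δ j y))
      ≡⟨ cong (d H j +_) (cong₂ _+_ (trans (∑-cong (λ l → ℚ.*-comm (δ j x) (δ l y))) (∑-δ y (λ _ → δ j x))) (∑-δ x (λ _ → δ j y))) ⟩
    d H j + (δ j x + δ j y)                                             ≡⟨ ℚ.+-assoc (d H j) _ _ ⟨
    d H j + δ j x + δ j y                                               ∎

  connected-addEdge : Connected H → Connected G
  connected-addEdge conn i j = Star.map (λ {a} {b} → keep (Graph.adj H a b) (sameEdge x y a b)) (conn i j)
    where
    keep : ∀ a b → T a → T (a ∨ b)
    keep true b t = tt

module Unicyclic {n} (H : Graph n) (conn : Connected H) (acyclic : Acyclic H)
                 {ℓ x y} (π : Path H ℓ x y) (x≢y : x ≢ y) (¬adj : ¬ Adj H x y) where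
  open Distance H conn
  open TreeLaplacian H conn acyclic
  open PathProfile H conn acyclic π
  open PathLaplacian H conn acyclic π
  open AddEdge H x≢y ¬adj

  -- The reciprocal of the unit resistance of the new edge plus the resistance ℓ between its ends in
  -- the tree; equally, of the length of the cycle.
  ρ : ℚ
  ρ = recip (suc ℓ)

  ρ*c≡1 : ρ * (1ℚ + ι ℓ) ≡ 1ℚ
  ρ*c≡1 = trans (cong (ρ *_) (sym (ι-suc ℓ))) (recip-inverse (suc ℓ) (λ ()))

  height-start : height x ≡ 0
  height-start = trans (cong height (sym (Path.start π))) (height-v zero)

  height-end : height y ≡ 0
  height-end = trans (cong height (sym (Path.end π))) (height-v (fromℕ ℓ))

  pos-start : pos x ≡ 0
  pos-start = trans (cong pos (sym (Path.start π))) (pos-v zero)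

  pos-end : pos y ≡ ℓ
  pos-end = trans (cong pos (sym (Path.end π))) (trans (pos-v (fromℕ ℓ)) (Fin.toℕ-fromℕ ℓ))

  p² : Fin n → ℚ
  p² i = p i * p i

  gap² : Fin n → Fin n → ℚ
  gap² i k = (p i - p k) * (p i - p k)

  -- `L H p²` stays unevaluated: it depends on `j` alone and can be absorbed into `τ⁺`, so only the
  -- cross term of the square has to be computed.
  L-gap² : ∀ j k → L H (λ i → gap² i k) j ≡ L H p² j - ι 2 * p k * (δ j y - δ j x)
  L-gap² j k = begin
    L H (λ i → gap² i k) j                                              ≡⟨ L-cong (λ i → ring (p i) (p k)) j ⟩
    L H (λ i → (p² i - ι 2 * p k * p i) + p k * p k) j                  ≡⟨ L-+ H (λ i → p² i - ι 2 * p k * p i) (λ _ → p k * p k) j ⟩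
    L H (λ i → p² i - ι 2 * p k * p i) j + L H (λ _ → p k * p k) j
      ≡⟨ cong₂ _+_ (trans (L-- H p² (λ i → ι 2 * p k * p i) j) (cong (_-_ (L H p² j)) (trans (L-* H (ι 2 * p k) p j) (cong (ι 2 * p k *_) (L-p j)))))
           (L-const H (p k * p k) j) ⟩
    (L H p² j - ι 2 * p k * (δ j y - δ j x)) + 0ℚ                       ≡⟨ ℚ.+-identityʳ _ ⟩
    L H p² j - ι 2 * p k * (δ j y - δ j x)                              ∎
    where
    ring : ∀ a b → (a - b) * (a - b) ≡ (a * a - ι 2 * b * a) + b * b
    ring = solve-∀ ℚ-ring

  -- The rank-one update of the resistances of H by the new edge.
  R⁺ : Matrix n
  R⁺ i k = Dℚ i k - ρ * gap² i k

  R⁺-resistance : IsResistance G R⁺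
  R⁺-resistance = record
    { symmetric = λ i j → cong₂ (λ a b → a - ρ * b) (cong ι (D-sym i j)) (ring₀ (p i) (p j))
    ; diagonal  = λ i → trans (cong (λ a → a - ρ * gap² i i) (cong ι (D-refl i))) (ring₁ (p i) ρ)
    ; τ         = τ⁺
    ; laplacian = lap
    }
    where
    ring₀ : ∀ a b → (a - b) * (a - b) ≡ (b - a) * (b - a)
    ring₀ = solve-∀ ℚ-ring
    ring₁ : ∀ a r → 0ℚ - r * ((a - a) * (a - a)) ≡ 0ℚ
    ring₁ = solve-∀ ℚ-ring
    e : Fin n → ℚ
    e j = δ j x - δ j y
    τ⁺ : Fin n → ℚ
    τ⁺ j = ((ι 2 - d H j) - ρ * L H p² j) - e j * ι ℓ * (1ℚ - ρ * ι ℓ)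
    -- Apart from `δ`, the only term depending on `k` carries the factor 1 - ρ(1 + ℓ); here the
    -- value of `ρ` is forced.
    ring₂ : ∀ d r q pk jx jy l δk h → (((ι 2 - d) - ι 2 * δk) - r * (q - ι 2 * pk * (jy - jx)))
              + (jx - jy) * (((pk + h) - r * ((0ℚ - pk) * (0ℚ - pk))) - (((l - pk) + h) - r * ((l - pk) * (l - pk))))
            ≡ ((((ι 2 - d) - r * q) - (jx - jy) * l * (1ℚ - r * l)) - ι 2 * δk) + ι 2 * (jx - jy) * pk * (1ℚ - r * (1ℚ + l))
    ring₂ = solve-∀ ℚ-ring
    ring₃ : ∀ a e q → a + ι 2 * e * q * (1ℚ - 1ℚ) ≡ a
    ring₃ = solve-∀ ℚ-ring
    lap : ∀ j k → L G (λ i → R⁺ i k) j ≡ τ⁺ j - ι 2 * δ j k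
    lap j k = begin
      L G (λ i → R⁺ i k) j                                      ≡⟨ L-addEdge (λ i → R⁺ i k) j ⟩
      L H (λ i → R⁺ i k) j + e j * (R⁺ x k - R⁺ y k)
        ≡⟨ cong₂ (λ a b → a + e j * b)
             (trans (L-- H (λ i → Dℚ i k) (λ i → ρ * gap² i k) j) (cong₂ _-_ (L-D j k) (trans (L-* H ρ (λ i → gap² i k) j) (cong (ρ *_) (L-gap² j k)))))
             (cong₂ _-_ (cong₂ (λ a b → a - ρ * ((b - p k) * (b - p k))) (trans (cong ι (D-sym x k)) (D-start-ℚ k)) (cong ι pos-start))
                        (cong₂ (λ a b → a - ρ * ((b - p k) * (b - p k))) (trans (cong ι (D-sym y k)) (D-end-ℚ k)) (cong ι pos-end))) ⟩
      (((ι 2 - d H j) - ι 2 * δ j k) - ρ * (L H p² j - ι 2 * p k * (δ j y - δ j x)))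
        + e j * (((p k + h k) - ρ * ((0ℚ - p k) * (0ℚ - p k))) - (((ι ℓ - p k) + h k) - ρ * ((ι ℓ - p k) * (ι ℓ - p k))))
        ≡⟨ ring₂ (d H j) ρ (L H p² j) (p k) (δ j x) (δ j y) (ι ℓ) (δ j k) (h k) ⟩
      (τ⁺ j - ι 2 * δ j k) + ι 2 * e j * p k * (1ℚ - ρ * (1ℚ + ι ℓ))
        ≡⟨ cong (λ z → (τ⁺ j - ι 2 * δ j k) + ι 2 * e j * p k * (1ℚ - z)) ρ*c≡1 ⟩
      (τ⁺ j - ι 2 * δ j k) + ι 2 * e j * p k * (1ℚ - 1ℚ)        ≡⟨ ring₃ (τ⁺ j - ι 2 * δ j k) (e j) (p k) ⟩
      τ⁺ j - ι 2 * δ j k                                        ∎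

-- The difference of the two Kemeny constants

module Difference {n} (2≤n : 2 ℕ.≤ n) (H : Graph n) (conn : Connected H) (acyclic : Acyclic H)
                  {ℓ x y} (π : Path H ℓ x y) (x≢y : x ≢ y) (¬adj : ¬ Adj H x y) where
  open Distance H conn
  open TreeLaplacian H conn acyclic
  open PathProfile H conn acyclic π
  open PathLaplacian H conn acyclic π
  open AddEdge H x≢y ¬adj
  open Unicyclic H conn acyclic π x≢y ¬adj

  N = ι n
  S = ∑ σ
  Height = ∑ h
  V = ∑ (λ k → ∑ (λ l → gap² k l))

  DD : ℚ
  DD = ∑ (λ k → ∑ (λ l → d H k * d H l * Dℚ k l))

  m : Fin n → ℚ
  m k = ∑ (λ l → d H l * Dℚ l k)

  2m : ∀ k → ι 2 * m k ≡ ι 4 * σ k - vol H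
  2m = ∑dD

  DD≡∑dm : DD ≡ ∑ (λ k → d H k * m k)
  DD≡∑dm = ∑-cong (λ k → trans (∑-cong (λ l → trans (ℚ.*-assoc (d H k) (d H l) (Dℚ k l)) (cong (λ z → d H k * (d H l * z)) (cong ι (D-sym k l)))))
    (∑-*ˡ (d H k) _))

  -- `∑dD` removes one degree weight, and after exchanging the sums it removes the other.
  DD≡ : ι 2 * DD ≡ ι 8 * S - ι 2 * N * vol H - vol H * vol H
  DD≡ = begin
    ι 2 * DD                                                 ≡⟨ trans (cong (ι 2 *_) DD≡∑dm) (sym (∑-*ˡ (ι 2) _)) ⟩
    ∑ (λ k → ι 2 * (d H k * m k))                            ≡⟨ ∑-cong (λ k → trans (ring₁ (d H k) (m k)) (trans (cong (d H k *_) (2m k)) (ring₂ (d H k) (σ k) (vol H)))) ⟩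
    ∑ (λ k → ι 4 * (d H k * σ k) - d H k * vol H)            ≡⟨ trans (∑-- _ _) (cong₂ _-_ (∑-*ˡ (ι 4) _) (∑-*ʳ (vol H) (d H))) ⟩
    ι 4 * ∑ (λ k → d H k * σ k) - vol H * vol H              ≡⟨ cong (λ z → ι 4 * z - vol H * vol H) dσ≡∑m ⟩
    ι 4 * ∑ m - vol H * vol H                                ≡⟨ cong (_- vol H * vol H) (ring₃ (∑ m)) ⟩
    ι 2 * (ι 2 * ∑ m) - vol H * vol H                        ≡⟨ cong (λ z → ι 2 * z - vol H * vol H) 2∑m ⟩
    ι 2 * (ι 4 * S - N * vol H) - vol H * vol H              ≡⟨ ring₄ S N (vol H) ⟩
    ι 8 * S - ι 2 * N * vol H - vol H * vol H                ∎
    where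
    ring₁ : ∀ a b → ι 2 * (a * b) ≡ a * (ι 2 * b)
    ring₁ = solve-∀ ℚ-ring
    ring₂ : ∀ a s v → a * (ι 4 * s - v) ≡ ι 4 * (a * s) - a * v
    ring₂ = solve-∀ ℚ-ring
    ring₃ : ∀ a → ι 4 * a ≡ ι 2 * (ι 2 * a)
    ring₃ = solve-∀ ℚ-ring
    ring₄ : ∀ s n v → ι 2 * (ι 4 * s - n * v) - v * v ≡ ι 8 * s - ι 2 * n * v - v * v
    ring₄ = solve-∀ ℚ-ring
    dσ≡∑m : ∑ (λ k → d H k * σ k) ≡ ∑ m
    dσ≡∑m = trans (∑-cong (λ k → trans (sym (∑-*ˡ (d H k) _)) (∑-cong (λ i → cong (λ z → d H k * z) (cong ι (D-sym i k)))))) (∑-swap _)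
    2∑m : ι 2 * ∑ m ≡ ι 4 * S - N * vol H
    2∑m = trans (sym (∑-*ˡ (ι 2) m)) (trans (∑-cong 2m) (trans (∑-- _ _) (cong₂ _-_ (∑-*ˡ (ι 4) σ) (∑-const n (vol H)))))

  σ-ends : σ x + σ y ≡ N * ι ℓ + ι 2 * Height
  σ-ends = begin
    σ x + σ y                            ≡⟨ ∑-+ _ _ ⟨
    ∑ (λ i → Dℚ i x + Dℚ i y)            ≡⟨ ∑-cong (λ i → trans (cong₂ _+_ (D-start-ℚ i) (D-end-ℚ i)) (ring (p i) (h i) (ι ℓ))) ⟩
    ∑ (λ i → ι ℓ + ι 2 * h i)            ≡⟨ trans (∑-+ _ _) (cong₂ _+_ (∑-const n (ι ℓ)) (∑-*ˡ (ι 2) h)) ⟩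
    N * ι ℓ + ι 2 * Height               ∎
    where
    ring : ∀ p h l → (p + h) + ((l - p) + h) ≡ l + ι 2 * h
    ring = solve-∀ ℚ-ring

  DD⁺ : ℚ
  DD⁺ = ∑ (λ k → ∑ (λ l → d⁺ k * d⁺ l * Dℚ k l))

  D-yx : Dℚ y x ≡ ι ℓ
  D-yx = trans (D-start-ℚ y) (trans (cong₂ (λ a b → ι a + ι b) pos-end height-end) (ℚ.+-identityʳ (ι ℓ)))

  -- Raising the degrees of `x` and `y` by one adds `m x` and `m y` twice each and the distance ℓ
  -- twice; `σ-ends` then expresses the distance sums at the ends through the heights.
  DD⁺≡ : DD⁺ ≡ DD + ι 4 * (N * ι ℓ + ι 2 * Height) - ι 2 * vol H + ι 2 * ι ℓ
  DD⁺≡ = begin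
    DD⁺                                                     ≡⟨ ∑-cong inner ⟩
    ∑ (λ k → d⁺ k * g k)                                    ≡⟨ ∑d⁺g g ⟩
    ∑ (λ k → d H k * g k) + g x + g y                       ≡⟨ cong (λ z → z + g x + g y) ∑dg ⟩
    (DD + m x + m y) + g x + g y
      ≡⟨ cong₂ (λ a b → (DD + m x + m y) + a + b)
           (cong₂ (λ a b → m x + a + b) (cong ι (D-refl x)) D-yx)
           (cong₂ (λ a b → m y + a + b) (trans (cong ι (D-sym x y)) D-yx) (cong ι (D-refl y))) ⟩
    (DD + m x + m y) + (m x + 0ℚ + ι ℓ) + (m y + ι ℓ + 0ℚ)  ≡⟨ ring₁ DD (m x) (m y) (ι ℓ) ⟩
    DD + (ι 2 * m x + ι 2 * m y) + ι 2 * ι ℓ                ≡⟨ cong₂ (λ a b → DD + (a + b) + ι 2 * ι ℓ) (2m x) (2m y) ⟩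
    DD + ((ι 4 * σ x - vol H) + (ι 4 * σ y - vol H)) + ι 2 * ι ℓ   ≡⟨ ring₂ DD (σ x) (σ y) (vol H) (ι ℓ) ⟩
    DD + ι 4 * (σ x + σ y) - ι 2 * vol H + ι 2 * ι ℓ        ≡⟨ cong (λ z → DD + ι 4 * z - ι 2 * vol H + ι 2 * ι ℓ) σ-ends ⟩
    DD + ι 4 * (N * ι ℓ + ι 2 * Height) - ι 2 * vol H + ι 2 * ι ℓ  ∎
    where
    g : Fin n → ℚ
    g k = m k + Dℚ x k + Dℚ y k
    ring₁ : ∀ t a b l → (t + a + b) + (a + 0ℚ + l) + (b + l + 0ℚ) ≡ t + (ι 2 * a + ι 2 * b) + ι 2 * l
    ring₁ = solve-∀ ℚ-ring
    ring₂ : ∀ t a b v l → t + ((ι 4 * a - v) + (ι 4 * b - v)) + ι 2 * l ≡ t + ι 4 * (a + b) - ι 2 * v + ι 2 * l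
    ring₂ = solve-∀ ℚ-ring
    ring₃ : ∀ d m a b → d * (m + a + b) ≡ d * m + d * a + d * b
    ring₃ = solve-∀ ℚ-ring
    inner : ∀ k → ∑ (λ l → d⁺ k * d⁺ l * Dℚ k l) ≡ d⁺ k * g k
    inner k = trans (∑-cong (λ l → trans (ℚ.*-assoc (d⁺ k) (d⁺ l) (Dℚ k l)) (cong (λ z → d⁺ k * (d⁺ l * z)) (cong ι (D-sym k l)))))
      (trans (∑-*ˡ (d⁺ k) _) (cong (d⁺ k *_) (∑d⁺g (λ l → Dℚ l k))))
    ∑dg : ∑ (λ k → d H k * g k) ≡ DD + m x + m y
    ∑dg = trans (∑-cong (λ k → ring₃ (d H k) (m k) (Dℚ x k) (Dℚ y k)))
      (trans (∑-+ _ _) (cong₂ _+_ (trans (∑-+ _ _) (cong₂ _+_ (sym DD≡∑dm) (flip x))) (flip y)))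
      where
      flip : ∀ z → ∑ (λ k → d H k * Dℚ z k) ≡ m z
      flip z = ∑-cong (λ k → cong (d H k *_) (cong ι (D-sym z k)))

  -- `gap²` sees the vertices only through their positions, so `∑d⁺F` applies in each variable and
  -- removes both degrees.
  ∑d⁺gap² : ∑ (λ k → ∑ (λ l → d⁺ k * d⁺ l * gap² k l)) ≡ ι 4 * V
  ∑d⁺gap² = begin
    ∑ (λ k → ∑ (λ l → d⁺ k * d⁺ l * gap² k l))      ≡⟨ ∑-cong (λ k → trans (∑-cong (λ l → ℚ.*-assoc (d⁺ k) (d⁺ l) (gap² k l))) (∑-*ˡ (d⁺ k) _)) ⟩
    ∑ (λ k → d⁺ k * ∑ (λ l → d⁺ l * gap² k l))      ≡⟨ ∑-cong (λ k → cong (d⁺ k *_) (∑d⁺F (λ a → (p k - ι a) * (p k - ι a)))) ⟩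
    ∑ (λ k → d⁺ k * (ι 2 * ∑ (λ l → gap² k l)))     ≡⟨ ∑d⁺F (λ a → ι 2 * ∑ (λ l → (ι a - p l) * (ι a - p l))) ⟩
    ι 2 * ∑ (λ k → ι 2 * ∑ (λ l → gap² k l))        ≡⟨ cong (ι 2 *_) (∑-*ˡ (ι 2) _) ⟩
    ι 2 * (ι 2 * V)                                 ≡⟨ ring V ⟩
    ι 4 * V                                         ∎
    where
    ring : ∀ v → ι 2 * (ι 2 * v) ≡ ι 4 * v
    ring = solve-∀ ℚ-ring

  kemeny-tree : ∀ {κ} → IsKemenyConstant H κ → ι 4 * (N - 1ℚ) * κ ≡ DD
  kemeny-tree {κ} kem = trans (ring N κ) (trans (cong (λ z → ι 2 * z * κ) (sym vol≡2n-2)) (kemeny-resistance H 2≤n conn D-resistance kem))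
    where
    ring : ∀ n k → ι 4 * (n - 1ℚ) * k ≡ ι 2 * (ι 2 * n - ι 2) * k
    ring = solve-∀ ℚ-ring

  kemeny-unicyclic : ∀ {κ} → IsKemenyConstant G κ → ι 4 * N * κ ≡ DD⁺ - ρ * (ι 4 * V)
  kemeny-unicyclic {κ} kem = begin
    ι 4 * N * κ                                              ≡⟨ ring N κ ⟩
    ι 2 * (ι 2 * N) * κ                                      ≡⟨ cong (λ z → ι 2 * z * κ) (trans (∑-cong d-addEdge) ∑d⁺≡2n) ⟨
    ι 2 * vol G * κ                                          ≡⟨ kemeny-resistance G 2≤n (connected-addEdge conn) R⁺-resistance kem ⟩
    ∑ (λ k → ∑ (λ l → d G k * d G l * R⁺ k l))
      ≡⟨ ∑-cong (λ k → trans (∑-cong (λ l → trans (cong₂ (λ a b → a * b * R⁺ k l) (d-addEdge k) (d-addEdge l)) (ring′ (d⁺ k) (d⁺ l) (Dℚ k l) ρ (gap² k l)))) (∑-- _ _)) ⟩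
    ∑ (λ k → ∑ (λ l → d⁺ k * d⁺ l * Dℚ k l) - ∑ (λ l → ρ * (d⁺ k * d⁺ l * gap² k l)))
      ≡⟨ trans (∑-- _ _) (cong (_-_ DD⁺) (trans (∑-cong (λ k → ∑-*ˡ ρ _)) (∑-*ˡ ρ _))) ⟩
    DD⁺ - ρ * ∑ (λ k → ∑ (λ l → d⁺ k * d⁺ l * gap² k l))     ≡⟨ cong (λ z → DD⁺ - ρ * z) ∑d⁺gap² ⟩
    DD⁺ - ρ * (ι 4 * V)                                      ∎
    where
    ring : ∀ n k → ι 4 * n * k ≡ ι 2 * (ι 2 * n) * k
    ring = solve-∀ ℚ-ring
    ring′ : ∀ a b u r g → a * b * (u - r * g) ≡ a * b * u - r * (a * b * g)
    ring′ = solve-∀ ℚ-ring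

  c : ℚ
  c = 1ℚ + ι ℓ

  -- The prefactor is the denominator of `bound`. The two volumes weight `DD` by N - 1 and N, so one
  -- negative multiple of it remains; the cancelled factor 2 comes from `DD≡`. Minimising the
  -- difference thus means maximising c(S - 2(N - 1)·Height) + (N - 1)V.
  kemeny-difference : ∀ {κ κ⁺} → IsKemenyConstant H κ → IsKemenyConstant G κ⁺ →
    ι 4 * c * N * (N - 1ℚ) * (κ⁺ - κ) ≡
      (ι 4 * N * (N - 1ℚ) * c * (c - 1ℚ) + ι 2 * (N - 1ℚ) * (c * c))
      - ι 4 * c * (S - ι 2 * (N - 1ℚ) * Height) - ι 4 * (N - 1ℚ) * V
  kemeny-difference {κ} {κ⁺} kem kem⁺ = *-cancelˡ {ι 2} (λ ()) (begin
    ι 2 * (ι 4 * c * N * (N - 1ℚ) * (κ⁺ - κ))                 ≡⟨ ring₁ c N κ⁺ κ ⟩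
    ι 2 * c * (N - 1ℚ) * (ι 4 * N * κ⁺) - ι 2 * c * N * (ι 4 * (N - 1ℚ) * κ)
      ≡⟨ cong₂ (λ a b → ι 2 * c * (N - 1ℚ) * a - ι 2 * c * N * b)
           (trans (kemeny-unicyclic kem⁺) (cong (_- ρ * (ι 4 * V)) (trans DD⁺≡ (cong (λ v → DD + ι 4 * (N * ι ℓ + ι 2 * Height) - ι 2 * v + ι 2 * ι ℓ) vol≡2n-2))))
           (kemeny-tree kem) ⟩
    ι 2 * c * (N - 1ℚ) * ((DD + ι 4 * (N * ι ℓ + ι 2 * Height) - ι 2 * (ι 2 * N - ι 2) + ι 2 * ι ℓ) - ρ * (ι 4 * V)) - ι 2 * c * N * DD
      ≡⟨ ring₂ N DD (ι ℓ) Height ρ V ⟩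
    - (c * (ι 2 * DD)) + (ι 8 * c * (N - 1ℚ) * (N * ι ℓ + ι 2 * Height) - ι 8 * c * (N - 1ℚ) * (N - 1ℚ) + ι 4 * c * (N - 1ℚ) * ι ℓ) - ι 8 * (N - 1ℚ) * V * (ρ * c)
      ≡⟨ cong₂ (λ a b → - (c * a) + (ι 8 * c * (N - 1ℚ) * (N * ι ℓ + ι 2 * Height) - ι 8 * c * (N - 1ℚ) * (N - 1ℚ) + ι 4 * c * (N - 1ℚ) * ι ℓ) - ι 8 * (N - 1ℚ) * V * b)
           (trans DD≡ (cong (λ v → ι 8 * S - ι 2 * N * v - v * v) vol≡2n-2)) ρ*c≡1 ⟩
    - (c * (ι 8 * S - ι 2 * N * (ι 2 * N - ι 2) - (ι 2 * N - ι 2) * (ι 2 * N - ι 2)))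
      + (ι 8 * c * (N - 1ℚ) * (N * ι ℓ + ι 2 * Height) - ι 8 * c * (N - 1ℚ) * (N - 1ℚ) + ι 4 * c * (N - 1ℚ) * ι ℓ) - ι 8 * (N - 1ℚ) * V * 1ℚ
      ≡⟨ ring₃ N (ι ℓ) S Height V ⟩
    ι 2 * ((ι 4 * N * (N - 1ℚ) * c * (c - 1ℚ) + ι 2 * (N - 1ℚ) * (c * c))
      - ι 4 * c * (S - ι 2 * (N - 1ℚ) * Height) - ι 4 * (N - 1ℚ) * V)  ∎)
    where
    ring₁ : ∀ c n a b → ι 2 * (ι 4 * c * n * (n - 1ℚ) * (a - b)) ≡ ι 2 * c * (n - 1ℚ) * (ι 4 * n * a) - ι 2 * c * n * (ι 4 * (n - 1ℚ) * b)
    ring₁ = solve-∀ ℚ-ring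
    ring₂ : ∀ n t l u r v → ι 2 * (1ℚ + l) * (n - 1ℚ) * ((t + ι 4 * (n * l + ι 2 * u) - ι 2 * (ι 2 * n - ι 2) + ι 2 * l) - r * (ι 4 * v)) - ι 2 * (1ℚ + l) * n * t
      ≡ - ((1ℚ + l) * (ι 2 * t)) + (ι 8 * (1ℚ + l) * (n - 1ℚ) * (n * l + ι 2 * u) - ι 8 * (1ℚ + l) * (n - 1ℚ) * (n - 1ℚ) + ι 4 * (1ℚ + l) * (n - 1ℚ) * l) - ι 8 * (n - 1ℚ) * v * (r * (1ℚ + l))
    ring₂ = solve-∀ ℚ-ring
    ring₃ : ∀ n l s u v → - ((1ℚ + l) * (ι 8 * s - ι 2 * n * (ι 2 * n - ι 2) - (ι 2 * n - ι 2) * (ι 2 * n - ι 2)))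
      + (ι 8 * (1ℚ + l) * (n - 1ℚ) * (n * l + ι 2 * u) - ι 8 * (1ℚ + l) * (n - 1ℚ) * (n - 1ℚ) + ι 4 * (1ℚ + l) * (n - 1ℚ) * l) - ι 8 * (n - 1ℚ) * v * 1ℚ
      ≡ ι 2 * ((ι 4 * n * (n - 1ℚ) * (1ℚ + l) * ((1ℚ + l) - 1ℚ) + ι 2 * (n - 1ℚ) * ((1ℚ + l) * (1ℚ + l)))
      - ι 4 * (1ℚ + l) * (s - ι 2 * (n - 1ℚ) * u) - ι 4 * (n - 1ℚ) * v)
    ring₃ = solve-∀ ℚ-ring

-- Sums of powers and the rounding inequality

sumTo-≡ : ∀ {g h : ℕ → ℚ} N → (∀ s → s ℕ.< N → g s ≡ h s) → sumTo g N ≡ sumTo h N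
sumTo-≡ zero    g≡h = refl
sumTo-≡ (suc N) g≡h = cong₂ _+_ (sumTo-≡ N (λ s s<N → g≡h s (ℕ.m≤n⇒m≤1+n s<N))) (g≡h N ℕ.≤-refl)

∑≡sumTo : ∀ (g : ℕ → ℚ) N → ∑ {N} (λ t → g (toℕ t)) ≡ sumTo g N
∑≡sumTo g N = trans (∑≡sum {N} (λ t → g (toℕ t))) (sym (sumTo-sum g N))

⅙ : ℚ
⅙ = ℤ.+ 1 / 6

Σ₁ Σ₂ : ℚ → ℚ
Σ₁ l = ½ * (l * (1ℚ + l))
Σ₂ l = ⅙ * (l * (1ℚ + l) * (ι 2 * l + 1ℚ))

sumTo-id : ∀ m → sumTo ι (suc m) ≡ Σ₁ (ι m)
sumTo-id zero    = refl
sumTo-id (suc m) = trans (cong₂ _+_ (sumTo-id m) (ι-suc m)) (trans (ring (ι m)) (cong Σ₁ (sym (ι-suc m))))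
  where
  ring : ∀ x → ½ * (x * (1ℚ + x)) + (1ℚ + x) ≡ ½ * ((1ℚ + x) * (1ℚ + (1ℚ + x)))
  ring = solve-∀ ℚ-ring

sumTo-square : ∀ m → sumTo (λ s → ι s * ι s) (suc m) ≡ Σ₂ (ι m)
sumTo-square zero    = refl
sumTo-square (suc m) = trans (cong₂ _+_ (sumTo-square m) (cong (λ z → z * z) (ι-suc m))) (trans (ring (ι m)) (cong Σ₂ (sym (ι-suc m))))
  where
  ring : ∀ x → ⅙ * (x * (1ℚ + x) * (ι 2 * x + 1ℚ)) + (1ℚ + x) * (1ℚ + x) ≡ ⅙ * ((1ℚ + x) * (1ℚ + (1ℚ + x)) * (ι 2 * (1ℚ + x) + 1ℚ))
  ring = solve-∀ ℚ-ring

sumTo-dist-below : ∀ q m → m ℕ.≤ q → sumTo (λ s → ι ℕ.∣ q - s ∣) m ≡ ι m * ι q - ½ * (ι m * (ι m - 1ℚ))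
sumTo-dist-below q zero    _   = sym (trans (cong (_- ½ * (0ℚ * (0ℚ - 1ℚ))) (ℚ.*-zeroˡ (ι q))) refl)
sumTo-dist-below q (suc m) m<q = begin
  sumTo (λ s → ι ℕ.∣ q - s ∣) m + ι ℕ.∣ q - m ∣
    ≡⟨ cong₂ _+_ (sumTo-dist-below q m (ℕ.<⇒≤ m<q)) (trans (cong ι (ℕ.m≤n⇒∣n-m∣≡n∸m (ℕ.<⇒≤ m<q))) (ι-∸ (ℕ.<⇒≤ m<q))) ⟩
  (ι m * ι q - ½ * (ι m * (ι m - 1ℚ))) + (ι q - ι m)   ≡⟨ ring (ι m) (ι q) ⟩
  (1ℚ + ι m) * ι q - ½ * ((1ℚ + ι m) * ((1ℚ + ι m) - 1ℚ))  ≡⟨ cong (λ z → z * ι q - ½ * (z * (z - 1ℚ))) (ι-suc m) ⟨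
  ι (suc m) * ι q - ½ * (ι (suc m) * (ι (suc m) - 1ℚ)) ∎
  where
  ring : ∀ x y → (x * y - ½ * (x * (x - 1ℚ))) + (y - x) ≡ (1ℚ + x) * y - ½ * ((1ℚ + x) * ((1ℚ + x) - 1ℚ))
  ring = solve-∀ ℚ-ring

-- The summands are q, ..., 1 below `q` and 0, ..., r - 1 from `q` on.
sumTo-dist-above : ∀ q r → sumTo (λ s → ι ℕ.∣ q - s ∣) (r ℕ.+ q) ≡ ½ * (ι q * (ι q + 1ℚ)) + ½ * (ι r * (ι r - 1ℚ))
sumTo-dist-above q zero    = trans (sumTo-dist-below q q ℕ.≤-refl) (ring (ι q))
  where
  ring : ∀ x → x * x - ½ * (x * (x - 1ℚ)) ≡ ½ * (x * (x + 1ℚ)) + ½ * (0ℚ * (0ℚ - 1ℚ))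
  ring = solve-∀ ℚ-ring
sumTo-dist-above q (suc r) = begin
  sumTo (λ s → ι ℕ.∣ q - s ∣) (r ℕ.+ q) + ι ℕ.∣ q - (r ℕ.+ q) ∣
    ≡⟨ cong₂ _+_ (sumTo-dist-above q r) (cong ι (trans (cong (λ z → ℕ.∣ q - z ∣) (ℕ.+-comm r q)) (ℕ.∣m-m+n∣≡n q r))) ⟩
  (½ * (ι q * (ι q + 1ℚ)) + ½ * (ι r * (ι r - 1ℚ))) + ι r     ≡⟨ ring (ι q) (ι r) ⟩
  ½ * (ι q * (ι q + 1ℚ)) + ½ * ((1ℚ + ι r) * ((1ℚ + ι r) - 1ℚ))
    ≡⟨ cong (λ z → ½ * (ι q * (ι q + 1ℚ)) + ½ * (z * (z - 1ℚ))) (ι-suc r) ⟨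
  ½ * (ι q * (ι q + 1ℚ)) + ½ * (ι (suc r) * (ι (suc r) - 1ℚ)) ∎
  where
  ring : ∀ x y → (½ * (x * (x + 1ℚ)) + ½ * (y * (y - 1ℚ))) + y ≡ ½ * (x * (x + 1ℚ)) + ½ * ((1ℚ + y) * ((1ℚ + y) - 1ℚ))
  ring = solve-∀ ℚ-ring

-- The position enters only as the loss q(ℓ - q) compared with an end of the path. In `∑-gap²` the
-- same loss appears 1 + ℓ times, so the single sum `P` will record both.
∑-dist : ∀ {q ℓ} → q ℕ.≤ ℓ → ∑ {suc ℓ} (λ t → ι ℕ.∣ q - toℕ t ∣) ≡ Σ₁ (ι ℓ) - ι q * (ι ℓ - ι q)
∑-dist {q} {ℓ} q≤ℓ = begin
  ∑ {suc ℓ} (λ t → ι ℕ.∣ q - toℕ t ∣)           ≡⟨ ∑≡sumTo (λ s → ι ℕ.∣ q - s ∣) (suc ℓ) ⟩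
  sumTo (λ s → ι ℕ.∣ q - s ∣) (suc ℓ)           ≡⟨ cong (sumTo (λ s → ι ℕ.∣ q - s ∣)) (ℕ.m∸n+n≡m {suc ℓ} {q} (ℕ.m≤n⇒m≤1+n q≤ℓ)) ⟨
  sumTo (λ s → ι ℕ.∣ q - s ∣) (suc ℓ ℕ.∸ q ℕ.+ q)  ≡⟨ sumTo-dist-above q (suc ℓ ℕ.∸ q) ⟩
  ½ * (ι q * (ι q + 1ℚ)) + ½ * (ι (suc ℓ ℕ.∸ q) * (ι (suc ℓ ℕ.∸ q) - 1ℚ))
    ≡⟨ cong (λ z → ½ * (ι q * (ι q + 1ℚ)) + ½ * (z * (z - 1ℚ))) (trans (ι-∸ {suc ℓ} {q} (ℕ.m≤n⇒m≤1+n q≤ℓ)) (cong (_- ι q) (ι-suc ℓ))) ⟩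
  ½ * (ι q * (ι q + 1ℚ)) + ½ * (((1ℚ + ι ℓ) - ι q) * (((1ℚ + ι ℓ) - ι q) - 1ℚ))   ≡⟨ ring (ι q) (ι ℓ) ⟩
  Σ₁ (ι ℓ) - ι q * (ι ℓ - ι q)                  ∎
  where
  ring : ∀ q l → ½ * (q * (q + 1ℚ)) + ½ * (((1ℚ + l) - q) * (((1ℚ + l) - q) - 1ℚ)) ≡ ½ * (l * (1ℚ + l)) - q * (l - q)
  ring = solve-∀ ℚ-ring

∑-toℕ : ∀ ℓ → ∑ {suc ℓ} (λ t → ι (toℕ t)) ≡ Σ₁ (ι ℓ)
∑-toℕ ℓ = trans (∑≡sumTo ι (suc ℓ)) (sumTo-id ℓ)

∑-toℕ² : ∀ ℓ → ∑ {suc ℓ} (λ t → ι (toℕ t) * ι (toℕ t)) ≡ Σ₂ (ι ℓ)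
∑-toℕ² ℓ = trans (∑≡sumTo (λ s → ι s * ι s) (suc ℓ)) (sumTo-square ℓ)

∑-quadratic : ∀ ℓ a b c → ∑ {suc ℓ} (λ t → a * (ι (toℕ t) * ι (toℕ t)) + b * ι (toℕ t) + c) ≡ a * Σ₂ (ι ℓ) + b * Σ₁ (ι ℓ) + (1ℚ + ι ℓ) * c
∑-quadratic ℓ a b c = trans (∑-+ _ _) (cong₂ _+_ (trans (∑-+ _ _)
    (cong₂ _+_ (trans (∑-*ˡ a _) (cong (a *_) (∑-toℕ² ℓ))) (trans (∑-*ˡ b _) (cong (b *_) (∑-toℕ ℓ)))))
  (trans (∑-const (suc ℓ) c) (cong (_* c) (ι-suc ℓ))))

∑-gap² : ∀ q ℓ → ∑ {suc ℓ} (λ t → (q - ι (toℕ t)) * (q - ι (toℕ t))) ≡ Σ₂ (ι ℓ) - (1ℚ + ι ℓ) * (q * (ι ℓ - q))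
∑-gap² q ℓ = trans (∑-cong {suc ℓ} (λ t → ring q (ι (toℕ t)))) (trans (∑-quadratic ℓ 1ℚ (- (ι 2 * q)) (q * q)) (ring′ q (ι ℓ) (Σ₂ (ι ℓ))))
  where
  ring : ∀ q s → (q - s) * (q - s) ≡ 1ℚ * (s * s) + (- (ι 2 * q)) * s + q * q
  ring = solve-∀ ℚ-ring
  ring′ : ∀ q l s → 1ℚ * s + (- (ι 2 * q)) * (½ * (l * (1ℚ + l))) + (1ℚ + l) * (q * q) ≡ s - (1ℚ + l) * (q * (l - q))
  ring′ = solve-∀ ℚ-ring

∑∑-dist : ∀ ℓ → ∑ {suc ℓ} (λ s → ∑ {suc ℓ} (λ t → ι ℕ.∣ toℕ s - toℕ t ∣)) ≡ Σ₂ (ι ℓ) - ι ℓ * Σ₁ (ι ℓ) + (1ℚ + ι ℓ) * Σ₁ (ι ℓ)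
∑∑-dist ℓ = trans (∑-cong {suc ℓ} (λ s → trans (∑-dist (Fin.toℕ≤pred[n] s)) (ring (Σ₁ (ι ℓ)) (ι (toℕ s)) (ι ℓ))))
  (trans (∑-quadratic ℓ 1ℚ (- ι ℓ) (Σ₁ (ι ℓ))) (ring′ (Σ₂ (ι ℓ)) (ι ℓ) (Σ₁ (ι ℓ))))
  where
  ring : ∀ k s l → k - s * (l - s) ≡ 1ℚ * (s * s) + (- l) * s + k
  ring = solve-∀ ℚ-ring
  ring′ : ∀ a l b → 1ℚ * a + (- l) * b + (1ℚ + l) * b ≡ a - l * b + (1ℚ + l) * b
  ring′ = solve-∀ ℚ-ring

∑∑-gap² : ∀ ℓ → ∑ {suc ℓ} (λ s → ∑ {suc ℓ} (λ t → (ι (toℕ s) - ι (toℕ t)) * (ι (toℕ s) - ι (toℕ t)))) ≡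
          (1ℚ + ι ℓ) * (Σ₂ (ι ℓ) - ι ℓ * Σ₁ (ι ℓ) + Σ₂ (ι ℓ))
∑∑-gap² ℓ = trans (∑-cong {suc ℓ} (λ s → trans (∑-gap² (ι (toℕ s)) ℓ) (ring (Σ₂ (ι ℓ)) (ι (toℕ s)) (ι ℓ))))
  (trans (∑-quadratic ℓ (1ℚ + ι ℓ) (- ((1ℚ + ι ℓ) * ι ℓ)) (Σ₂ (ι ℓ))) (ring′ (Σ₂ (ι ℓ)) (ι ℓ) (Σ₁ (ι ℓ))))
  where
  ring : ∀ k s l → k - (1ℚ + l) * (s * (l - s)) ≡ (1ℚ + l) * (s * s) + (- ((1ℚ + l) * l)) * s + k
  ring = solve-∀ ℚ-ring
  ring′ : ∀ a l b → (1ℚ + l) * a + (- ((1ℚ + l) * l)) * b + (1ℚ + l) * a ≡ (1ℚ + l) * (a - l * b + a)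
  ring′ = solve-∀ ℚ-ring

-- The product k(k - 1) is negative only strictly between 0 and 1, where there is no integer; the
-- integer k is represented as a difference of naturals.
consecutive-product : ∀ a b → 0ℚ ≤ (ι a - ι b) * ((ι a - ι b) - 1ℚ)
consecutive-product a b = split (ℕ.≤-<-connex a b)
  where
  ring₁ : ∀ x y → (y - x) * ((y - x) + 1ℚ) ≡ (x - y) * ((x - y) - 1ℚ)
  ring₁ = solve-∀ ℚ-ring
  ring₂ : ∀ x y → (1ℚ + (x - (1ℚ + y))) * (x - (1ℚ + y)) ≡ (x - y) * ((x - y) - 1ℚ)
  ring₂ = solve-∀ ℚ-ring
  split : a ℕ.≤ b ⊎ b ℕ.< a → 0ℚ ≤ (ι a - ι b) * ((ι a - ι b) - 1ℚ)
  split (inj₁ a≤b) = subst (0ℚ ≤_) (ring₁ (ι a) (ι b)) (*-nonNeg b-a (+-nonNeg b-a (0≤ι 1)))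
    where
    b-a : 0ℚ ≤ ι b - ι a
    b-a = x≤y⇒0≤y-x (ι-mono-≤ {a} {b} a≤b)
  split (inj₂ b<a) = subst (0ℚ ≤_) (ring₂ (ι a) (ι b)) (*-nonNeg (+-nonNeg (0≤ι 1) a-b-1) a-b-1)
    where
    a-b-1 : 0ℚ ≤ ι a - (1ℚ + ι b)
    a-b-1 = subst (λ z → 0ℚ ≤ ι a - z) (ι-suc b) (x≤y⇒0≤y-x (ι-mono-≤ {suc b} {a} b<a))

-- z (z - l) + ∑ q (l - q) with z = (a - b) l + ∑ q is affine in each q ∈ [0 , l],
-- so it suffices to check q ∈ {0 , l}, where it is l² times a product of
-- consecutive integers.
rounding : ∀ {n} (l : ℚ) → 0ℚ ≤ l → (e q : Fin n → ℚ) → (∀ i → e i ≡ 0ℚ ⊎ e i ≡ 1ℚ) →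
           (∀ i → 0ℚ ≤ q i) → (∀ i → q i ≤ l) → ∀ a b →
           let z = (ι a - ι b) * l + ∑ (λ i → e i * q i) in
           l ≢ 0ℚ → 0ℚ ≤ z * (z - l) + ∑ (λ i → e i * (q i * (l - q i)))
rounding {zero} l 0≤l e q e01 0≤q q≤l a b l≢0 =
  subst (0ℚ ≤_) (trans (ring (ι a - ι b) l) (cong₂ (λ s t → ((ι a - ι b) * l + s) * (((ι a - ι b) * l + s) - l) + t)
      (sym (∑-zero {f = λ i → e i * q i} (λ ()))) (sym (∑-zero {f = λ i → e i * (q i * (l - q i))} (λ ())))))
    (*-nonNeg (square-nonNeg l) (consecutive-product a b))
  where
  ring : ∀ k l → l * l * (k * (k - 1ℚ)) ≡ (k * l + 0ℚ) * ((k * l + 0ℚ) - l) + 0ℚ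
  ring = solve-∀ ℚ-ring
rounding {suc n} l 0≤l e q e01 0≤q q≤l a b l≢0 =
  subst (0ℚ ≤_) (sym (cong₂ (λ s t → ((ι a - ι b) * l + s) * (((ι a - ι b) * l + s) - l) + t)
      (∑-suc (λ i → e i * q i)) (∑-suc (λ i → e i * (q i * (l - q i))))))
    (split (e01 zero))
  where
  Q = ∑ (λ i → e (suc i) * q (suc i))
  P = ∑ (λ i → e (suc i) * (q (suc i) * (l - q (suc i))))
  q₀ = q zero
  value : ℚ → ℚ
  value e₀ = ((ι a - ι b) * l + (e₀ * q₀ + Q)) * (((ι a - ι b) * l + (e₀ * q₀ + Q)) - l) + (e₀ * (q₀ * (l - q₀)) + P)
  IH : ∀ a b → 0ℚ ≤ ((ι a - ι b) * l + Q) * (((ι a - ι b) * l + Q) - l) + P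
  IH a b = rounding l 0≤l (e ∘ suc) (q ∘ suc) (e01 ∘ suc) (0≤q ∘ suc) (q≤l ∘ suc) a b l≢0
  ring₀ : ∀ k q s l p → (k * l + s) * ((k * l + s) - l) + p ≡ (k * l + (0ℚ * q + s)) * ((k * l + (0ℚ * q + s)) - l) + (0ℚ * (q * (l - q)) + p)
  ring₀ = solve-∀ ℚ-ring
  ring₁ : ∀ x y q s l p →
    q * ((((1ℚ + x) - y) * l + s) * ((((1ℚ + x) - y) * l + s) - l) + p) + (l - q) * (((x - y) * l + s) * (((x - y) * l + s) - l) + p)
    ≡ l * (((x - y) * l + (1ℚ * q + s)) * (((x - y) * l + (1ℚ * q + s)) - l) + (1ℚ * (q * (l - q)) + p))
  ring₁ = solve-∀ ℚ-ring
  split : e zero ≡ 0ℚ ⊎ e zero ≡ 1ℚ → 0ℚ ≤ value (e zero)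
  split (inj₁ e≡0) = subst (λ z → 0ℚ ≤ value z) (sym e≡0) (subst (0ℚ ≤_) (ring₀ (ι a - ι b) q₀ Q l P) (IH a b))
  -- The value at q₀ is interpolated with weight q₀ from the end `l` and weight l - q₀ from 0.
  -- Putting q₀ at `l` amounts to replacing `a` by `suc a`, which is why the induction needs `a` to
  -- vary.
  split (inj₂ e≡1) = subst (λ z → 0ℚ ≤ value z) (sym e≡1)
    (*-cancelˡ-nonNeg 0≤l l≢0 (subst (0ℚ ≤_)
      (trans (cong (λ z → q₀ * (((z - ι b) * l + Q) * (((z - ι b) * l + Q) - l) + P) + (l - q₀) * (((ι a - ι b) * l + Q) * (((ι a - ι b) * l + Q) - l) + P)) (ι-suc a))
             (ring₁ (ι a) (ι b) q₀ Q l P))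
      (+-nonNeg (*-nonNeg (0≤q zero) (IH (suc a) b)) (*-nonNeg (x≤y⇒0≤y-x (q≤l zero)) (IH a b)))))

-- Splitting sums along an injection

-- The number of preimages of `i`; for an injection it is the indicator of the image, usable as a
-- weight in sums over all vertices.
hits : ∀ {m n} → (Fin m → Fin n) → Fin n → ℚ
hits f i = ∑ (λ s → δ i (f s))

∑-hits : ∀ {m n} (f : Fin m → Fin n) (F : Fin n → ℚ) → ∑ (λ i → hits f i * F i) ≡ ∑ (λ s → F (f s))
∑-hits f F = trans (∑-cong (λ i → sym (∑-*ʳ (F i) _))) (trans (∑-swap _) (∑-cong (λ s → ∑-δ (f s) F)))

hits-image : ∀ {m n} (f : Fin m → Fin n) → (∀ {s t} → f s ≡ f t → s ≡ t) → ∀ s → hits f (f s) ≡ 1ℚ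
hits-image f inj s = trans (∑-cong (λ t → trans (same t (f s ≟ f t)) (sym (ℚ.*-identityʳ (δ s t))))) (∑-δ′ s (λ _ → 1ℚ))
  where
  same : ∀ t → Dec (f s ≡ f t) → δ (f s) (f t) ≡ δ s t
  same t (yes eq) rewrite inj eq = trans (δ-refl (f t)) (sym (δ-refl t))
  same t (no neq) = trans (δ-≢ neq) (sym (δ-≢ (neq ∘ cong f)))

hits-outside : ∀ {m n} (f : Fin m → Fin n) {i} → (∀ s → f s ≢ i) → hits f i ≡ 0ℚ
hits-outside f out = ∑-zero (λ s → δ-≢ (out s ∘ sym))

module OffPath {n m} (v : Fin m → Fin n) (injective : ∀ {s t} → v s ≡ v t → s ≡ t) where

  on? : ∀ i → Dec (∃ λ s → v s ≡ i)
  on? i = Fin.any? (λ s → v s ≟ i)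

  e : Fin n → ℚ
  e i = if does (on? i) then 0ℚ else 1ℚ

  e-on : ∀ {i} → (∃ λ s → v s ≡ i) → e i ≡ 0ℚ
  e-on {i} on with on? i
  ... | yes _   = refl
  ... | no  off = ⊥-elim (off on)

  e-off : ∀ {i} → ¬ (∃ λ s → v s ≡ i) → e i ≡ 1ℚ
  e-off {i} off with on? i
  ... | yes on = ⊥-elim (off on)
  ... | no  _  = refl

  e01 : ∀ i → e i ≡ 0ℚ ⊎ e i ≡ 1ℚ
  e01 i with on? i
  ... | yes _ = inj₁ refl
  ... | no  _ = inj₂ refl

  0≤e : ∀ i → 0ℚ ≤ e i
  0≤e i with on? i
  ... | yes _ = ℚ.≤-refl
  ... | no  _ = 0≤ι 1

  hits+e : ∀ i → hits v i + e i ≡ 1ℚ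
  hits+e i = split (on? i)
    where
    split : Dec (∃ λ s → v s ≡ i) → hits v i + e i ≡ 1ℚ
    split (yes (s , refl)) = cong₂ _+_ (hits-image v injective s) (e-on (s , refl))
    split (no  off)        = cong₂ _+_ (hits-outside v (λ s eq → off (s , eq))) (e-off off)

  ∑-split : ∀ (F : Fin n → ℚ) → ∑ F ≡ ∑ (λ s → F (v s)) + ∑ (λ i → e i * F i)
  ∑-split F = trans (∑-cong (λ i → trans (sym (ℚ.*-identityˡ (F i))) (trans (cong (_* F i) (sym (hits+e i))) (ℚ.*-distribʳ-+ (F i) (hits v i) (e i)))))
    (trans (∑-+ _ _) (cong (_+ ∑ (λ i → e i * F i)) (∑-hits v F)))

  ∑∑-split : ∀ (F : Fin n → Fin n → ℚ) → (∀ i j → F i j ≡ F j i) →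
             ∑ (λ i → ∑ (λ j → F i j)) ≡ ∑ (λ s → ∑ (λ t → F (v s) (v t))) + ι 2 * ∑ (λ i → e i * ∑ (λ t → F i (v t)))
                                          + ∑ (λ i → ∑ (λ j → e i * e j * F i j))
  ∑∑-split F F-sym = begin
    ∑ (λ i → ∑ (λ j → F i j))                                       ≡⟨ trans (∑-cong (λ i → ∑-split (F i))) (∑-+ _ _) ⟩
    ∑ (λ i → ∑ (λ t → F i (v t))) + ∑ (λ i → ∑ (λ j → e j * F i j))
      ≡⟨ cong₂ _+_ (∑-split (λ i → ∑ (λ t → F i (v t)))) (∑-split (λ i → ∑ (λ j → e j * F i j))) ⟩
    (PP + X) + (∑ (λ s → ∑ (λ j → e j * F (v s) j)) + ∑ (λ i → e i * ∑ (λ j → e j * F i j)))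
      ≡⟨ cong₂ (λ a b → (PP + X) + (a + b)) cross (∑-cong (λ i → trans (sym (∑-*ˡ (e i) _)) (∑-cong (λ j → sym (ℚ.*-assoc (e i) (e j) (F i j)))))) ⟩
    (PP + X) + (X + EE)                                             ≡⟨ ring PP X EE ⟩
    PP + ι 2 * X + EE                                               ∎
    where
    PP = ∑ (λ s → ∑ (λ t → F (v s) (v t)))
    X = ∑ (λ i → e i * ∑ (λ t → F i (v t)))
    EE = ∑ (λ i → ∑ (λ j → e i * e j * F i j))
    cross : ∑ (λ s → ∑ (λ j → e j * F (v s) j)) ≡ X
    cross = trans (∑-swap _) (∑-cong (λ i → trans (∑-*ˡ (e i) _) (cong (e i *_) (∑-cong (λ s → F-sym (v s) i)))))
    ring : ∀ p x q → (p + x) + (x + q) ≡ p + ι 2 * x + q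
    ring = solve-∀ ℚ-ring

⌈⌉≡⌊⌋ : ∀ r → ⌈ r /2⌉ ≡ ⌊ r /2⌋ ⊎ ⌈ r /2⌉ ≡ suc ⌊ r /2⌋
⌈⌉≡⌊⌋ zero          = inj₁ refl
⌈⌉≡⌊⌋ (suc zero)    = inj₂ refl
⌈⌉≡⌊⌋ (suc (suc r)) = Sum.map (cong suc) (cong suc) (⌈⌉≡⌊⌋ r)

-- Sums over pairs, split into path and off-path vertices

module Slack {n} (2≤n : 2 ℕ.≤ n) (H : Graph n) (conn : Connected H) (acyclic : Acyclic H)
             {ℓ x y} (π : Path H ℓ x y) (x≢y : x ≢ y) (¬adj : ¬ Adj H x y) where
  open Distance H conn
  open TreeLaplacian H conn acyclic
  open PathProfile H conn acyclic π
  open PathLaplacian H conn acyclic π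
  open AddEdge H x≢y ¬adj
  open Unicyclic H conn acyclic π x≢y ¬adj
  open Difference 2≤n H conn acyclic π x≢y ¬adj
  open Path π using (injective) renaming (vertex to v)
  open OffPath v injective

  l : ℚ
  l = ι ℓ

  t : Fin n → Fin n → ℚ
  t i j = ι ℕ.∣ pos i - pos j ∣

  t-sym : ∀ i j → t i j ≡ t j i
  t-sym i j = cong ι (ℕ.∣-∣-comm (pos i) (pos j))

  U : ℚ
  U = ∑ (λ i → ∑ (λ j → t i j))

  -- The factor with `δ` removes the diagonal, where the estimate would be 2h against distance 0.
  -- Each height then occurs 2(N - 1) times in the total, which is its coefficient in
  -- `kemeny-difference`.
  slack : Fin n → Fin n → ℚ
  slack i j = (1ℚ - δ i j) * (t i j + h i + h j) - Dℚ i j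

  0≤slack : ∀ i j → 0ℚ ≤ slack i j
  0≤slack i j = split (i ≟ j)
    where
    ring : ∀ x → (1ℚ - 1ℚ) * x - 0ℚ ≡ 0ℚ
    ring = solve-∀ ℚ-ring
    ring′ : ∀ x y → (1ℚ - 0ℚ) * x - y ≡ x - y
    ring′ = solve-∀ ℚ-ring
    split : Dec (i ≡ j) → 0ℚ ≤ slack i j
    split (yes refl) = ℚ.≤-reflexive (sym (trans (cong₂ (λ a b → (1ℚ - a) * (t i i + h i + h i) - b) (δ-refl i) (cong ι (D-refl i))) (ring (t i i + h i + h i))))
    split (no i≢j) = subst (0ℚ ≤_) (sym (trans (cong (λ a → (1ℚ - a) * (t i j + h i + h j) - Dℚ i j) (δ-≢ i≢j)) (ring′ (t i j + h i + h j) (Dℚ i j))))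
      (x≤y⇒0≤y-x (subst (Dℚ i j ≤_) (trans (ι-+ (ℕ.∣ pos i - pos j ∣ ℕ.+ height i) (height j)) (cong (_+ h j) (ι-+ ℕ.∣ pos i - pos j ∣ (height i))))
        (ι-mono-≤ {D i j} {ℕ.∣ pos i - pos j ∣ ℕ.+ height i ℕ.+ height j} (D-upper i j))))

  totalSlack : ℚ
  totalSlack = ∑ (λ i → ∑ (λ j → slack i j))

  totalSlack≡ : totalSlack ≡ U + ι 2 * (N - 1ℚ) * Height - S
  totalSlack≡ = begin
    totalSlack
      ≡⟨ ∑-cong (λ i → trans (∑-cong (λ j → ring₁ (δ i j) (t i j) (h i) (h j) (Dℚ i j)))
           (trans (∑-- _ _) (cong₂ _-_ (trans (∑-+ _ _) (cong₂ _+_ (trans (∑-+ _ _) (cong (_+_ (∑ (λ j → t i j))) (∑-const n (h i)))) refl)) (trans (∑-+ _ _) (cong₂ _+_ (∑-δ′ i (λ j → t i j + h i + h j)) refl))))) ⟩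
    ∑ (λ i → ((∑ (λ j → t i j) + N * h i) + Height) - ((t i i + h i + h i) + ∑ (λ j → Dℚ i j)))
      ≡⟨ trans (∑-- _ _) (cong₂ _-_
           (trans (∑-+ _ _) (cong₂ _+_ (trans (∑-+ _ _) (cong (U +_) (∑-*ˡ N h))) (∑-const n Height)))
           (trans (∑-+ _ _) (cong₂ _+_ (trans (∑-cong (λ i → trans (cong (λ z → z + h i + h i) (cong ι (ℕ.m≡n⇒∣m-n∣≡0 {pos i} refl))) (ring₂ (h i)))) (∑-*ˡ (ι 2) h)) (∑-swap _)))) ⟩
    ((U + N * Height) + N * Height) - (ι 2 * Height + S)   ≡⟨ ring₃ U N Height S ⟩
    U + ι 2 * (N - 1ℚ) * Height - S  ∎
    where
    ring₁ : ∀ e t a b d → (1ℚ - e) * (t + a + b) - d ≡ ((t + a) + b) - (e * (t + a + b) + d)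
    ring₁ = solve-∀ ℚ-ring
    ring₂ : ∀ a → 0ℚ + a + a ≡ ι 2 * a
    ring₂ = solve-∀ ℚ-ring
    ring₃ : ∀ u n h s → ((u + n * h) + n * h) - (ι 2 * h + s) ≡ u + ι 2 * (n - 1ℚ) * h - s
    ring₃ = solve-∀ ℚ-ring

  -- `P` vanishes exactly when every off-path vertex has its foot at an end. The bracket in `BB`
  -- interpolates l·|pᵢ - pⱼ| bilinearly from the corners of the square with side `l`; unlike `E₁`,
  -- it depends on the feet only through `r` and `Q`.
  r Q P BB E₁ E₂ : ℚ
  r  = ∑ e
  Q  = ∑ (λ i → e i * p i)
  P  = ∑ (λ i → e i * (p i * (l - p i)))
  BB = ∑ (λ i → ∑ (λ j → e i * e j * (p i * (l - p j) + p j * (l - p i))))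
  E₁ = ∑ (λ i → ∑ (λ j → e i * e j * t i j))
  E₂ = ∑ (λ i → ∑ (λ j → e i * e j * gap² i j))

  r≡N-c : r ≡ N - c
  r≡N-c = begin
    r                                       ≡⟨ ring r c ⟩
    (c * 1ℚ + r) - c                        ≡⟨ cong (_- c) (cong₂ _+_ (trans (cong (_* 1ℚ) (sym (ι-suc ℓ))) (sym (∑-const (suc ℓ) 1ℚ))) (∑-cong (λ i → sym (ℚ.*-identityʳ (e i))))) ⟩
    (∑ {suc ℓ} (λ _ → 1ℚ) + ∑ (λ i → e i * 1ℚ)) - c  ≡⟨ cong (_- c) (∑-split (λ _ → 1ℚ)) ⟨
    ∑ {n} (λ _ → 1ℚ) - c                    ≡⟨ cong (_- c) (trans (∑-const n 1ℚ) (ℚ.*-identityʳ N)) ⟩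
    N - c                                   ∎
    where
    ring : ∀ r c → r ≡ (c * 1ℚ + r) - c
    ring = solve-∀ ℚ-ring

  BB≡ : BB ≡ ι 2 * (Q * (r * l - Q))
  BB≡ = begin
    BB                                                         ≡⟨ ∑-cong (λ i → trans (∑-cong (λ j → ring₁ (e i) (e j) (p i) (p j) l))
                                                                    (trans (∑-+ _ _) (cong₂ _+_ (trans (∑-*ˡ (e i * p i) _) (cong (e i * p i *_) ∑e[l-p])) (∑-*ˡ (e i * (l - p i)) _)))) ⟩
    ∑ (λ i → e i * p i * (r * l - Q) + e i * (l - p i) * Q)    ≡⟨ trans (∑-+ _ _) (cong₂ _+_ (∑-*ʳ (r * l - Q) _) (trans (∑-*ʳ Q _) (cong (_* Q) ∑e[l-p]))) ⟩
    Q * (r * l - Q) + (r * l - Q) * Q                          ≡⟨ ring₂ Q (r * l - Q) ⟩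
    ι 2 * (Q * (r * l - Q))                                    ∎
    where
    ring₁ : ∀ a b u w l → a * b * (u * (l - w) + w * (l - u)) ≡ a * u * (b * (l - w)) + a * (l - u) * (b * w)
    ring₁ = solve-∀ ℚ-ring
    ring₂ : ∀ a b → a * b + b * a ≡ ι 2 * (a * b)
    ring₂ = solve-∀ ℚ-ring
    ring₃ : ∀ a l u → a * (l - u) ≡ a * l - a * u
    ring₃ = solve-∀ ℚ-ring
    ∑e[l-p] : ∑ (λ i → e i * (l - p i)) ≡ r * l - Q
    ∑e[l-p] = trans (∑-cong (λ i → ring₃ (e i) l (p i))) (trans (∑-- _ _) (cong (_- Q) (∑-*ʳ l e)))

  off-sum : ∀ (k a : ℚ) → ∑ (λ i → e i * (k - a * (p i * (l - p i)))) ≡ r * k - a * P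
  off-sum k a = trans (∑-cong (λ i → ring (e i) k a (p i * (l - p i)))) (trans (∑-- _ _) (cong₂ _-_ (∑-*ʳ k e) (∑-*ˡ a _)))
    where
    ring : ∀ e k a w → e * (k - a * w) ≡ e * k - a * (e * w)
    ring = solve-∀ ℚ-ring

  U≡ : U ≡ (Σ₂ l - l * Σ₁ l + c * Σ₁ l) + ι 2 * (r * Σ₁ l - 1ℚ * P) + E₁
  U≡ = trans (∑∑-split t t-sym) (cong₂ (λ a b → a + ι 2 * b + E₁)
    (trans (∑-cong (λ s → ∑-cong (λ u → cong₂ (λ a b → ι ℕ.∣ a - b ∣) (pos-v s) (pos-v u)))) (∑∑-dist ℓ))
    (trans (∑-cong (λ i → cong (e i *_) (trans (∑-cong (λ u → cong (λ b → ι ℕ.∣ pos i - b ∣) (pos-v u)))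
      (trans (∑-dist (pos≤ℓ i)) (cong (_-_ (Σ₁ l)) (sym (ℚ.*-identityˡ (p i * (l - p i))))))))) (off-sum (Σ₁ l) 1ℚ)))

  V≡ : V ≡ c * (Σ₂ l - l * Σ₁ l + Σ₂ l) + ι 2 * (r * Σ₂ l - c * P) + E₂
  V≡ = trans (∑∑-split gap² (λ i j → ring (p i) (p j))) (cong₂ (λ a b → a + ι 2 * b + E₂)
    (trans (∑-cong (λ s → ∑-cong (λ u → cong₂ (λ a b → (ι a - ι b) * (ι a - ι b)) (pos-v s) (pos-v u)))) (∑∑-gap² ℓ))
    (trans (∑-cong (λ i → cong (e i *_) (trans (∑-cong (λ u → cong (λ b → (p i - ι b) * (p i - ι b)) (pos-v u)))
      (∑-gap² (p i) ℓ)))) (off-sum (Σ₂ l) c)))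
    where
    ring : ∀ a b → (a - b) * (a - b) ≡ (b - a) * (b - a)
    ring = solve-∀ ℚ-ring

-- The lower bound

module Bound {n} (2≤n : 2 ℕ.≤ n) (H : Graph n) (conn : Connected H) (acyclic : Acyclic H)
             {ℓ x y} (π : Path H ℓ x y) (x≢y : x ≢ y) (¬adj : ¬ Adj H x y) where
  open PathProfile H conn acyclic π
  open PathLaplacian H conn acyclic π
  open AddEdge H x≢y ¬adj
  open Unicyclic H conn acyclic π x≢y ¬adj
  open Difference 2≤n H conn acyclic π x≢y ¬adj
  open Slack 2≤n H conn acyclic π x≢y ¬adj
  open Path π using (injective) renaming (vertex to v)
  open OffPath v injective

  ℓ≢0 : ℓ ≢ 0
  ℓ≢0 refl = x≢y (trans (sym (Path.start π)) (Path.end π))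

  l≢0 : l ≢ 0ℚ
  l≢0 = ι≢0 ℓ≢0

  0≤l : 0ℚ ≤ l
  0≤l = 0≤ι ℓ

  0≤p : ∀ i → 0ℚ ≤ p i
  0≤p i = 0≤ι (pos i)

  p≤l : ∀ i → p i ≤ l
  p≤l i = ι-mono-≤ {pos i} {ℓ} (pos≤ℓ i)

  0≤l-p : ∀ i → 0ℚ ≤ l - p i
  0≤l-p i = x≤y⇒0≤y-x (p≤l i)

  f g : ℚ
  f = ι ⌊ n ℕ.∸ suc ℓ /2⌋
  g = ι ⌈ n ℕ.∸ suc ℓ /2⌉

  f+g≡r : f + g ≡ r
  f+g≡r = begin
    f + g                                                     ≡⟨ ι-+ ⌊ n ℕ.∸ suc ℓ /2⌋ ⌈ n ℕ.∸ suc ℓ /2⌉ ⟨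
    ι (⌊ n ℕ.∸ suc ℓ /2⌋ ℕ.+ ⌈ n ℕ.∸ suc ℓ /2⌉)               ≡⟨ cong ι (ℕ.⌊n/2⌋+⌈n/2⌉≡n (n ℕ.∸ suc ℓ)) ⟩
    ι (n ℕ.∸ suc ℓ)                                           ≡⟨ ι-∸ {n} {suc ℓ} (Fin.injective⇒≤ injective) ⟩
    N - ι (suc ℓ)                                             ≡⟨ cong (_-_ N) (ι-suc ℓ) ⟩
    N - c                                                     ≡⟨ r≡N-c ⟨
    r                                                         ∎

  -- With all feet at the ends, `Q * (r * l - Q)` is l² times the product of the two counts, hence
  -- at most `f * g * (l * l)`. The summand `P` compensates for interior feet.
  deficit : ℚ
  deficit = P + f * g * (l * l) - Q * (r * l - Q)

  0≤P-term : ∀ i → 0ℚ ≤ e i * (p i * (l - p i))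
  0≤P-term i = *-nonNeg (0≤e i) (*-nonNeg (0≤p i) (0≤l-p i))

  0≤P : 0ℚ ≤ P
  0≤P = ∑-nonNeg 0≤P-term

  -- For even `r` the terms besides `P` form the square of Q - f·l. For odd `r` they form z(z - l)
  -- with z = Q - f·l, which can be negative, and `rounding` applies with `a` zero and `b` the
  -- floor.
  0≤deficit : 0ℚ ≤ deficit
  0≤deficit = split (⌈⌉≡⌊⌋ (n ℕ.∸ suc ℓ))
    where
    k = ⌊ n ℕ.∸ suc ℓ /2⌋
    with-g : ∀ {g′} → g ≡ g′ → deficit ≡ P + f * g′ * (l * l) - Q * ((f + g′) * l - Q)
    with-g refl = cong (λ z → P + f * g * (l * l) - Q * (z * l - Q)) (sym f+g≡r)
    ring₁ : ∀ s f l q → s + (q - f * l) * (q - f * l) ≡ s + f * f * (l * l) - q * ((f + f) * l - q)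
    ring₁ = solve-∀ ℚ-ring
    ring₂ : ∀ s f l q → ((0ℚ - f) * l + q) * (((0ℚ - f) * l + q) - l) + s ≡ s + f * (1ℚ + f) * (l * l) - q * ((f + (1ℚ + f)) * l - q)
    ring₂ = solve-∀ ℚ-ring
    split : ⌈ n ℕ.∸ suc ℓ /2⌉ ≡ k ⊎ ⌈ n ℕ.∸ suc ℓ /2⌉ ≡ suc k → 0ℚ ≤ deficit
    split (inj₁ eq) = subst (0ℚ ≤_) (trans (ring₁ P f l Q) (sym (with-g (cong ι eq)))) (+-nonNeg 0≤P (square-nonNeg (Q - f * l)))
    split (inj₂ eq) = subst (0ℚ ≤_) (trans (ring₂ P f l Q) (sym (with-g (trans (cong ι eq) (ι-suc k)))))
      (rounding l 0≤l e p e01 0≤p p≤l 0 k l≢0)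

  -- The interpolation error: twice the smaller position times the length of path beyond the larger
  -- one, as `order` shows.
  chord : Fin n → Fin n → ℚ
  chord i j = (p i * (l - p j) + p j * (l - p i)) - l * t i j

  order : ∀ i j → (p i ≤ p j × chord i j ≡ ι 2 * (p i * (l - p j))) ⊎ (p j ≤ p i × chord i j ≡ ι 2 * (p j * (l - p i)))
  order i j = split (ℕ.≤-total (pos i) (pos j))
    where
    ring₁ : ∀ a b l → (a * (l - b) + b * (l - a)) - l * (b - a) ≡ ι 2 * (a * (l - b))
    ring₁ = solve-∀ ℚ-ring
    ring₂ : ∀ a b l → (a * (l - b) + b * (l - a)) - l * (a - b) ≡ ι 2 * (b * (l - a))
    ring₂ = solve-∀ ℚ-ring
    split : pos i ℕ.≤ pos j ⊎ pos j ℕ.≤ pos i → (p i ≤ p j × chord i j ≡ ι 2 * (p i * (l - p j))) ⊎ (p j ≤ p i × chord i j ≡ ι 2 * (p j * (l - p i)))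
    split (inj₁ i≤j) = inj₁ (ι-mono-≤ {pos i} {pos j} i≤j
      , trans (cong (λ z → (p i * (l - p j) + p j * (l - p i)) - l * z) (trans (cong ι (ℕ.m≤n⇒∣m-n∣≡n∸m i≤j)) (ι-∸ i≤j))) (ring₁ (p i) (p j) l))
    split (inj₂ j≤i) = inj₂ (ι-mono-≤ {pos j} {pos i} j≤i
      , trans (cong (λ z → (p i * (l - p j) + p j * (l - p i)) - l * z) (trans (cong ι (ℕ.m≤n⇒∣n-m∣≡n∸m j≤i)) (ι-∸ j≤i))) (ring₂ (p i) (p j) l))

  0≤chord : ∀ i j → 0ℚ ≤ chord i j
  0≤chord i j = split (order i j)
    where
    split : (p i ≤ p j × chord i j ≡ ι 2 * (p i * (l - p j))) ⊎ (p j ≤ p i × chord i j ≡ ι 2 * (p j * (l - p i))) → 0ℚ ≤ chord i j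
    split (inj₁ (_ , eq)) = subst (0ℚ ≤_) (sym eq) (*-nonNeg (0≤ι 2) (*-nonNeg (0≤p i) (0≤l-p j)))
    split (inj₂ (_ , eq))       = subst (0ℚ ≤_) (sym eq) (*-nonNeg (0≤ι 2) (*-nonNeg (0≤p j) (0≤l-p i)))

  totalChord : ℚ
  totalChord = ∑ (λ i → ∑ (λ j → e i * e j * chord i j))

  0≤totalChord : 0ℚ ≤ totalChord
  0≤totalChord = ∑-nonNeg (λ i → ∑-nonNeg (λ j → *-nonNeg (*-nonNeg (0≤e i) (0≤e j)) (0≤chord i j)))

  totalChord≡ : totalChord ≡ BB - l * E₁
  totalChord≡ = trans (∑-cong (λ i → trans (∑-cong (λ j → ring (e i * e j) (p i * (l - p j) + p j * (l - p i)) l (t i j)))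
      (trans (∑-- _ _) (cong (_-_ (∑ (λ j → e i * e j * (p i * (l - p j) + p j * (l - p i))))) (∑-*ˡ l _))))) (trans (∑-- _ _) (cong (_-_ BB) (∑-*ˡ l _)))
    where
    ring : ∀ a b l t → a * (b - l * t) ≡ a * b - l * (a * t)
    ring = solve-∀ ℚ-ring

  -- The square (u - w)² is the bracket of `BB` minus u(l - u) and w(l - w); summing either of the
  -- latter over the other vertex gives `r * P`.
  E₂≡ : E₂ ≡ BB - ι 2 * (r * P)
  E₂≡ = begin
    E₂                                                          ≡⟨ ∑-cong (λ i → ∑-cong (λ j → ring₁ (e i) (e j) (p i) (p j) l)) ⟩
    ∑ (λ i → ∑ (λ j → b i j - (u i * e j + e i * u j)))         ≡⟨ trans (∑-cong (λ i → ∑-- _ _)) (∑-- _ _) ⟩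
    BB - ∑ (λ i → ∑ (λ j → u i * e j + e i * u j))
      ≡⟨ cong (_-_ BB) (trans (∑-cong (λ i → trans (∑-+ _ _) (cong₂ _+_ (∑-*ˡ (u i) e) (∑-*ˡ (e i) u)))) (trans (∑-+ _ _) (cong₂ _+_ (∑-*ʳ r u) (∑-*ʳ P e)))) ⟩
    BB - (P * r + r * P)                                        ≡⟨ ring₂ BB P r ⟩
    BB - ι 2 * (r * P)                                          ∎
    where
    b : Fin n → Fin n → ℚ
    b i j = e i * e j * (p i * (l - p j) + p j * (l - p i))
    u : Fin n → ℚ
    u i = e i * (p i * (l - p i))
    ring₁ : ∀ a b u w l → a * b * ((u - w) * (u - w)) ≡ a * b * (u * (l - w) + w * (l - u)) - (a * (u * (l - u)) * b + a * (b * (w * (l - w))))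
    ring₁ = solve-∀ ℚ-ring
    ring₂ : ∀ b p r → b - (p * r + r * p) ≡ b - ι 2 * (r * p)
    ring₂ = solve-∀ ℚ-ring

  -- The bracket of `bound` with rational arguments, so that it can be evaluated at 1 + l, the form
  -- the ring solver works with.
  numerator : ℚ → ℚ → ℚ
  numerator n′ c′ =
    - ((ℤ.+ 2 / 3) * (n′ + 1ℚ) * (c′ * c′) * (c′ * c′ - 1ℚ))
    - ι 8 * (n′ - c′) * ( - (n′ * (c′ * c′)) + (c′ * (c′ + 1ℚ) * (ℤ.+ 1 / 6)) * ((ι 2 * n′ + 1ℚ) * c′ + n′ - 1ℚ) )
    - ι 8 * f * g * ((n′ - 1ℚ) * ((c′ - 1ℚ) * (c′ - 1ℚ)) + c′ * (c′ - 1ℚ))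
    + ι 4 * n′ * (n′ - 1ℚ) * c′ * (c′ - 1ℚ)
    + ι 2 * (n′ - 1ℚ) * (c′ * c′)

  -- The losses, in order: replacing distances by feet and heights, replacing l·|pᵢ - pⱼ| by its
  -- interpolation (whence the overall factor `l`), the correction in `E₂≡`, imbalance, and interior
  -- feet. The sums to the path supply c·l·N copies of 8P; `deficit` takes c + (N - 1)l of them and
  -- l²N - 1 remain. That this is positive forces `P` to vanish in the equality case.
  w₁ w₂ w₃ w₄ w₅ : ℚ
  w₁ = ι 4 * c * l * totalSlack
  w₂ = ι 4 * c * totalChord
  w₃ = ι 8 * (N - 1ℚ) * l * (r * P)
  w₄ = ι 8 * (c + (N - 1ℚ) * l) * deficit
  w₅ = ι 8 * (l * l * N - 1ℚ) * P

  N-1≡ : N - 1ℚ ≡ ι (n ℕ.∸ 1)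
  N-1≡ = sym (ι-∸ {n} {1} (ℕ.≤-trans (ℕ.s≤s ℕ.z≤n) 2≤n))

  c≡ : c ≡ ι (suc ℓ)
  c≡ = sym (ι-suc ℓ)

  c*l≡ : ι 4 * c * l ≡ ι (4 ℕ.* suc ℓ ℕ.* ℓ)
  c*l≡ = trans (cong (λ z → ι 4 * z * l) c≡) (trans (cong (_* l) (sym (ι-* 4 (suc ℓ)))) (sym (ι-* (4 ℕ.* suc ℓ) ℓ)))

  c+[N-1]l≡ : ι 8 * (c + (N - 1ℚ) * l) ≡ ι (8 ℕ.* (suc ℓ ℕ.+ (n ℕ.∸ 1) ℕ.* ℓ))
  c+[N-1]l≡ = trans (cong (ι 8 *_) (trans (cong₂ (λ a b → a + b * l) c≡ N-1≡)
    (trans (cong (_+_ (ι (suc ℓ))) (sym (ι-* (n ℕ.∸ 1) ℓ))) (sym (ι-+ (suc ℓ) ((n ℕ.∸ 1) ℕ.* ℓ)))))) (sym (ι-* 8 (suc ℓ ℕ.+ (n ℕ.∸ 1) ℕ.* ℓ)))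

  2≤ℓℓn : 2 ℕ.≤ ℓ ℕ.* ℓ ℕ.* n
  2≤ℓℓn = ℕ.*-mono-≤ {1} {ℓ ℕ.* ℓ} {2} {n} (ℕ.*-mono-≤ {1} {ℓ} {1} {ℓ} (ℕ.n≢0⇒n>0 ℓ≢0) (ℕ.n≢0⇒n>0 ℓ≢0)) 2≤n

  l²N-1≡ : ι 8 * (l * l * N - 1ℚ) ≡ ι (8 ℕ.* (ℓ ℕ.* ℓ ℕ.* n ℕ.∸ 1))
  l²N-1≡ = trans (cong (ι 8 *_) (trans (cong (_- 1ℚ) (trans (cong (_* N) (sym (ι-* ℓ ℓ))) (sym (ι-* (ℓ ℕ.* ℓ) n))))
    (sym (ι-∸ {ℓ ℕ.* ℓ ℕ.* n} {1} (ℕ.≤-trans (ℕ.s≤s ℕ.z≤n) 2≤ℓℓn))))) (sym (ι-* 8 (ℓ ℕ.* ℓ ℕ.* n ℕ.∸ 1)))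

  0≤ι-scaled : ∀ {a z} k → a ≡ ι k → 0ℚ ≤ z → 0ℚ ≤ a * z
  0≤ι-scaled k refl 0≤z = *-nonNeg (0≤ι k) 0≤z

  0≤r : 0ℚ ≤ r
  0≤r = ∑-nonNeg 0≤e

  0≤totalSlack : 0ℚ ≤ totalSlack
  0≤totalSlack = ∑-nonNeg (λ i → ∑-nonNeg (0≤slack i))

  0≤w₁ : 0ℚ ≤ w₁
  0≤w₁ = 0≤ι-scaled (4 ℕ.* suc ℓ ℕ.* ℓ) c*l≡ 0≤totalSlack

  0≤w₂ : 0ℚ ≤ w₂
  0≤w₂ = *-nonNeg (*-nonNeg (0≤ι 4) (subst (0ℚ ≤_) (sym c≡) (0≤ι (suc ℓ)))) 0≤totalChord

  0≤w₃ : 0ℚ ≤ w₃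
  0≤w₃ = *-nonNeg (*-nonNeg (*-nonNeg (0≤ι 8) (subst (0ℚ ≤_) (sym N-1≡) (0≤ι (n ℕ.∸ 1)))) 0≤l) (*-nonNeg 0≤r 0≤P)

  0≤w₄ : 0ℚ ≤ w₄
  0≤w₄ = 0≤ι-scaled (8 ℕ.* (suc ℓ ℕ.+ (n ℕ.∸ 1) ℕ.* ℓ)) c+[N-1]l≡ 0≤deficit

  0≤w₅ : 0ℚ ≤ w₅
  0≤w₅ = 0≤ι-scaled (8 ℕ.* (ℓ ℕ.* ℓ ℕ.* n ℕ.∸ 1)) l²N-1≡ 0≤P

  ι-scaled≡0 : ∀ {a z} k → a ≡ ι k → k ≢ 0 → a * z ≡ 0ℚ → z ≡ 0ℚ
  ι-scaled≡0 k refl k≢0 = *-zero-factor (ι≢0 k≢0)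

  -- At the ends of the path the interpolation bound for |pᵢ - pⱼ| is exact.
  P≡0⇒totalChord≡0 : P ≡ 0ℚ → totalChord ≡ 0ℚ
  P≡0⇒totalChord≡0 P≡0 = ∑-zero (λ i → ∑-zero (λ j → split i j (order i j)))
    where
    ends : ∀ i → e i * (p i * (l - p i)) ≡ 0ℚ
    ends = ∑-nonNeg≡0 0≤P-term P≡0
    zero-between : ∀ {u w z} → 0ℚ ≤ w → w ≤ z → z ≤ l → 0ℚ ≤ u → u * (w * (l - w)) ≡ 0ℚ → u * (w * (l - z)) ≡ 0ℚ
    zero-between {u} {w} {z} 0≤w w≤z z≤l 0≤u eq = ℚ.≤-antisym
      (subst (u * (w * (l - z)) ≤_) eq (0≤y-x⇒x≤y (subst (0ℚ ≤_) (ring u w l z) (*-nonNeg 0≤u (*-nonNeg 0≤w (x≤y⇒0≤y-x w≤z))))))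
      (*-nonNeg 0≤u (*-nonNeg 0≤w (x≤y⇒0≤y-x z≤l)))
      where
      ring : ∀ u w l z → u * (w * (z - w)) ≡ u * (w * (l - w)) - u * (w * (l - z))
      ring = solve-∀ ℚ-ring
    ring₁ : ∀ a b u → a * b * (ι 2 * u) ≡ ι 2 * b * (a * u)
    ring₁ = solve-∀ ℚ-ring
    split : ∀ i j → (p i ≤ p j × chord i j ≡ ι 2 * (p i * (l - p j))) ⊎ (p j ≤ p i × chord i j ≡ ι 2 * (p j * (l - p i))) →
            e i * e j * chord i j ≡ 0ℚ
    split i j (inj₁ (i≤j , eq)) = trans (cong (e i * e j *_) eq) (trans (ring₁ (e i) (e j) (p i * (l - p j)))
      (trans (cong (ι 2 * e j *_) (zero-between (0≤p i) i≤j (p≤l j) (0≤e i) (ends i))) (ℚ.*-zeroʳ (ι 2 * e j))))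
    split i j (inj₂ (j≤i , eq)) = trans (cong (e i * e j *_) eq) (trans (cong (_* (ι 2 * (p j * (l - p i)))) (ℚ.*-comm (e i) (e j)))
      (trans (ring₁ (e j) (e i) (p j * (l - p i)))
      (trans (cong (ι 2 * e i *_) (zero-between (0≤p j) j≤i (p≤l i) (0≤e j) (ends j))) (ℚ.*-zeroʳ (ι 2 * e i)))))

  -- In tree terms: the height bound on distances is attained, all feet are ends, and the ends are
  -- balanced. The terms `w₂` and `w₃` vanish together with `P`.
  Tight : Set
  Tight = (∀ i j → slack i j ≡ 0ℚ) × P ≡ 0ℚ × deficit ≡ 0ℚ

  module _ {κ κ⁺ : ℚ} (kem : IsKemenyConstant H κ) (kem⁺ : IsKemenyConstant G κ⁺) where

    excess : ℚ
    excess = ι 4 * c * N * (N - 1ℚ) * (κ⁺ - κ) - numerator N c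

    excess≡ : l * excess ≡ w₁ + (w₂ + (w₃ + (w₄ + w₅)))
    excess≡ = begin
      l * excess                                             ≡⟨ cong (λ z → l * (z - numerator N c)) (kemeny-difference kem kem⁺) ⟩
      l * ((K₀ - ι 4 * c * (S - ι 2 * (N - 1ℚ) * Height) - ι 4 * (N - 1ℚ) * V) - numerator N c)
        ≡⟨ ring₁ l K₀ c S (N - 1ℚ) Height (ι 4 * (N - 1ℚ) * V) (numerator N c) U ⟩
      l * ((K₀ - ι 4 * c * (U - (U + ι 2 * (N - 1ℚ) * Height - S)) - ι 4 * (N - 1ℚ) * V) - numerator N c)
        ≡⟨ cong₂ (λ a b → l * ((K₀ - ι 4 * c * a - ι 4 * (N - 1ℚ) * b) - numerator N c))
             (cong₂ _-_ (trans U≡ (cong (λ z → (Σ₂ l - l * Σ₁ l + c * Σ₁ l) + ι 2 * (z * Σ₁ l - 1ℚ * P) + E₁) r≡N-c)) (sym totalSlack≡))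
             (trans V≡ (cong₂ (λ z b → c * (Σ₂ l - l * Σ₁ l + Σ₂ l) + ι 2 * (z * Σ₂ l - c * P) + b) r≡N-c
                (trans E₂≡ (cong₂ (λ a z → a - ι 2 * (z * P)) (trans BB≡ (cong (λ z → ι 2 * (Q * (z * l - Q))) r≡N-c)) r≡N-c)))) ⟩
      l * ((K₀ - ι 4 * c * (((Σ₂ l - l * Σ₁ l + c * Σ₁ l) + ι 2 * ((N - c) * Σ₁ l - 1ℚ * P) + E₁) - totalSlack)
               - ι 4 * (N - 1ℚ) * (c * (Σ₂ l - l * Σ₁ l + Σ₂ l) + ι 2 * ((N - c) * Σ₂ l - c * P) + (ι 2 * (Q * ((N - c) * l - Q)) - ι 2 * ((N - c) * P)))) - numerator N c)
        ≡⟨ ring₂ N l totalSlack P Q E₁ f g ⟩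
      w₁ + (ι 4 * c * (ι 2 * (Q * ((N - c) * l - Q)) - l * E₁) + (ι 8 * (N - 1ℚ) * l * ((N - c) * P)
         + (ι 8 * (c + (N - 1ℚ) * l) * (P + f * g * (l * l) - Q * ((N - c) * l - Q)) + w₅)))
        ≡⟨ cong₂ (λ z b → w₁ + (ι 4 * c * (b - l * E₁) + (ι 8 * (N - 1ℚ) * l * (z * P)
             + (ι 8 * (c + (N - 1ℚ) * l) * (P + f * g * (l * l) - Q * (z * l - Q)) + w₅)))) (sym r≡N-c) (trans (cong (λ z → ι 2 * (Q * (z * l - Q))) (sym r≡N-c)) (sym BB≡)) ⟩
      w₁ + (ι 4 * c * (BB - l * E₁) + (w₃ + (w₄ + w₅)))      ≡⟨ cong (λ z → w₁ + (ι 4 * c * z + (w₃ + (w₄ + w₅)))) totalChord≡ ⟨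
      w₁ + (w₂ + (w₃ + (w₄ + w₅)))                           ∎
      where
      K₀ = ι 4 * N * (N - 1ℚ) * c * (c - 1ℚ) + ι 2 * (N - 1ℚ) * (c * c)
      ring₁ : ∀ l k c s m h v b u → l * ((k - ι 4 * c * (s - ι 2 * m * h) - v) - b) ≡ l * ((k - ι 4 * c * (u - (u + ι 2 * m * h - s)) - v) - b)
      ring₁ = solve-∀ ℚ-ring
      -- A polynomial identity with `r` eliminated as n - c; `t`, `p`, `q`, `u` stand for
      -- `totalSlack`, `P`, `Q`, `E₁`.
      ring₂ : ∀ n l t p q u f g →
        l * (((ι 4 * n * (n - 1ℚ) * (1ℚ + l) * ((1ℚ + l) - 1ℚ) + ι 2 * (n - 1ℚ) * ((1ℚ + l) * (1ℚ + l)))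
            - ι 4 * (1ℚ + l) * (((⅙ * (l * (1ℚ + l) * (ι 2 * l + 1ℚ)) - l * (½ * (l * (1ℚ + l))) + (1ℚ + l) * (½ * (l * (1ℚ + l)))) + ι 2 * ((n - (1ℚ + l)) * (½ * (l * (1ℚ + l))) - 1ℚ * p) + u) - t)
            - ι 4 * (n - 1ℚ) * ((1ℚ + l) * (⅙ * (l * (1ℚ + l) * (ι 2 * l + 1ℚ)) - l * (½ * (l * (1ℚ + l))) + ⅙ * (l * (1ℚ + l) * (ι 2 * l + 1ℚ))) + ι 2 * ((n - (1ℚ + l)) * (⅙ * (l * (1ℚ + l) * (ι 2 * l + 1ℚ))) - (1ℚ + l) * p) + (ι 2 * (q * ((n - (1ℚ + l)) * l - q)) - ι 2 * ((n - (1ℚ + l)) * p))))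
          - ( - ((ℤ.+ 2 / 3) * (n + 1ℚ) * ((1ℚ + l) * (1ℚ + l)) * ((1ℚ + l) * (1ℚ + l) - 1ℚ))
              - ι 8 * (n - (1ℚ + l)) * ( - (n * ((1ℚ + l) * (1ℚ + l))) + ((1ℚ + l) * ((1ℚ + l) + 1ℚ) * (ℤ.+ 1 / 6)) * ((ι 2 * n + 1ℚ) * (1ℚ + l) + n - 1ℚ) )
              - ι 8 * f * g * ((n - 1ℚ) * (((1ℚ + l) - 1ℚ) * ((1ℚ + l) - 1ℚ)) + (1ℚ + l) * ((1ℚ + l) - 1ℚ))
              + ι 4 * n * (n - 1ℚ) * (1ℚ + l) * ((1ℚ + l) - 1ℚ)
              + ι 2 * (n - 1ℚ) * ((1ℚ + l) * (1ℚ + l)) ))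
        ≡ ι 4 * (1ℚ + l) * l * t + (ι 4 * (1ℚ + l) * (ι 2 * (q * ((n - (1ℚ + l)) * l - q)) - l * u) + (ι 8 * (n - 1ℚ) * l * ((n - (1ℚ + l)) * p)
         + (ι 8 * ((1ℚ + l) + (n - 1ℚ) * l) * (p + f * g * (l * l) - q * ((n - (1ℚ + l)) * l - q)) + ι 8 * (l * l * n - 1ℚ) * p)))
      ring₂ = solve-∀ ℚ-ring

    0≤excess : 0ℚ ≤ excess
    0≤excess = *-cancelˡ-nonNeg 0≤l l≢0 (subst (0ℚ ≤_) (sym excess≡)
      (+-nonNeg 0≤w₁ (+-nonNeg 0≤w₂ (+-nonNeg 0≤w₃ (+-nonNeg 0≤w₄ 0≤w₅)))))

    excess≡0⇒tight : excess ≡ 0ℚ → Tight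
    excess≡0⇒tight eq = (λ i → ∑-nonNeg≡0 (0≤slack i) (∑-nonNeg≡0 (λ i → ∑-nonNeg (0≤slack i)) totalSlack≡0 i))
                      , ι-scaled≡0 (8 ℕ.* (ℓ ℕ.* ℓ ℕ.* n ℕ.∸ 1)) l²N-1≡ k₅≢0 w₅≡0
                      , ι-scaled≡0 (8 ℕ.* (suc ℓ ℕ.+ (n ℕ.∸ 1) ℕ.* ℓ)) c+[N-1]l≡ (λ ()) w₄≡0
      where
      all≡0 : w₁ + (w₂ + (w₃ + (w₄ + w₅))) ≡ 0ℚ
      all≡0 = trans (sym excess≡) (trans (cong (l *_) eq) (ℚ.*-zeroʳ l))
      0≤w₄₅ : 0ℚ ≤ w₄ + w₅
      0≤w₄₅ = +-nonNeg 0≤w₄ 0≤w₅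
      0≤w₃₅ : 0ℚ ≤ w₃ + (w₄ + w₅)
      0≤w₃₅ = +-nonNeg 0≤w₃ 0≤w₄₅
      0≤w₂₅ : 0ℚ ≤ w₂ + (w₃ + (w₄ + w₅))
      0≤w₂₅ = +-nonNeg 0≤w₂ 0≤w₃₅
      second : ∀ {a b} → 0ℚ ≤ a → 0ℚ ≤ b → a + b ≡ 0ℚ → b ≡ 0ℚ
      second {a} {b} 0≤a 0≤b eq = nonNeg+nonNeg≡0⇒≡0 0≤b 0≤a (trans (ℚ.+-comm b a) eq)
      w₁≡0 : w₁ ≡ 0ℚ
      w₁≡0 = nonNeg+nonNeg≡0⇒≡0 0≤w₁ 0≤w₂₅ all≡0
      w₄₅≡0 : w₄ + w₅ ≡ 0ℚ
      w₄₅≡0 = second 0≤w₃ 0≤w₄₅ (second 0≤w₂ 0≤w₃₅ (second 0≤w₁ 0≤w₂₅ all≡0))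
      w₄≡0 : w₄ ≡ 0ℚ
      w₄≡0 = nonNeg+nonNeg≡0⇒≡0 0≤w₄ 0≤w₅ w₄₅≡0
      w₅≡0 : w₅ ≡ 0ℚ
      w₅≡0 = second 0≤w₄ 0≤w₅ w₄₅≡0
      k₁≢0 : 4 ℕ.* suc ℓ ℕ.* ℓ ≢ 0
      k₁≢0 z = Sum.[ (λ ()) , ℓ≢0 ] (ℕ.m*n≡0⇒m≡0∨n≡0 (4 ℕ.* suc ℓ) z)
      k₅≢0 : 8 ℕ.* (ℓ ℕ.* ℓ ℕ.* n ℕ.∸ 1) ≢ 0
      k₅≢0 z = Sum.[ (λ ()) , (λ z′ → ℕ.<⇒≱ 2≤ℓℓn (ℕ.m∸n≡0⇒m≤n z′)) ] (ℕ.m*n≡0⇒m≡0∨n≡0 8 z)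
      totalSlack≡0 : totalSlack ≡ 0ℚ
      totalSlack≡0 = ι-scaled≡0 (4 ℕ.* suc ℓ ℕ.* ℓ) c*l≡ k₁≢0 w₁≡0

    tight⇒excess≡0 : Tight → excess ≡ 0ℚ
    tight⇒excess≡0 (slack≡0 , P≡0 , deficit≡0) = *-cancelˡ l≢0 (trans excess≡ (begin
      w₁ + (w₂ + (w₃ + (w₄ + w₅)))
        ≡⟨ cong₂ _+_ (cong (ι 4 * c * l *_) (∑-zero (λ i → ∑-zero (slack≡0 i))))
             (cong₂ _+_ (cong (ι 4 * c *_) (P≡0⇒totalChord≡0 P≡0))
               (cong₂ _+_ (cong (λ z → ι 8 * (N - 1ℚ) * l * (r * z)) P≡0)
                 (cong₂ _+_ (cong (ι 8 * (c + (N - 1ℚ) * l) *_) deficit≡0) (cong (ι 8 * (l * l * N - 1ℚ) *_) P≡0)))) ⟩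
      ι 4 * c * l * 0ℚ + (ι 4 * c * 0ℚ + (ι 8 * (N - 1ℚ) * l * (r * 0ℚ) + (ι 8 * (c + (N - 1ℚ) * l) * 0ℚ + ι 8 * (l * l * N - 1ℚ) * 0ℚ)))
        ≡⟨ ring c l N r ⟩
      l * 0ℚ ∎))
      where
      ring : ∀ c l n r → ι 4 * c * l * 0ℚ + (ι 4 * c * 0ℚ + (ι 8 * (n - 1ℚ) * l * (r * 0ℚ) + (ι 8 * (c + (n - 1ℚ) * l) * 0ℚ + ι 8 * (l * l * n - 1ℚ) * 0ℚ))) ≡ l * 0ℚ
      ring = solve-∀ ℚ-ring

    K : ℕ
    K = 4 ℕ.* suc ℓ ℕ.* n ℕ.* (n ℕ.∸ 1)

    K≢0 : K ≢ 0
    K≢0 z = Sum.[ Sum.[ (λ ()) , (λ n≡0 → ℕ.<⇒≱ 2≤n (ℕ.≤-trans (ℕ.≤-reflexive n≡0) ℕ.z≤n)) ] ∘ ℕ.m*n≡0⇒m≡0∨n≡0 (4 ℕ.* suc ℓ)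
                , (λ n-1≡0 → ℕ.<⇒≱ 2≤n (ℕ.m∸n≡0⇒m≤n n-1≡0)) ] (ℕ.m*n≡0⇒m≡0∨n≡0 (4 ℕ.* suc ℓ ℕ.* n) z)

    ιK≡ : ι K ≡ ι 4 * c * N * (N - 1ℚ)
    ιK≡ = trans (ι-* (4 ℕ.* suc ℓ ℕ.* n) (n ℕ.∸ 1)) (cong₂ _*_ (trans (ι-* (4 ℕ.* suc ℓ) n) (cong (_* N) (trans (ι-* 4 (suc ℓ)) (cong (ι 4 *_) (sym c≡))))) (sym N-1≡))

    scaled-excess : ι K * ((κ⁺ - κ) - bound n (suc ℓ)) ≡ excess
    scaled-excess = begin
      ι K * ((κ⁺ - κ) - recip K * numerator N (ι (suc ℓ)))               ≡⟨ ring (ι K) (κ⁺ - κ) (recip K) (numerator N (ι (suc ℓ))) ⟩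
      ι K * (κ⁺ - κ) - (recip K * ι K) * numerator N (ι (suc ℓ))         ≡⟨ cong₂ (λ a b → a * (κ⁺ - κ) - b * numerator N (ι (suc ℓ))) ιK≡ (recip-inverse K K≢0) ⟩
      ι 4 * c * N * (N - 1ℚ) * (κ⁺ - κ) - 1ℚ * numerator N (ι (suc ℓ))   ≡⟨ cong (_-_ (ι 4 * c * N * (N - 1ℚ) * (κ⁺ - κ))) (trans (ℚ.*-identityˡ (numerator N (ι (suc ℓ)))) (cong (numerator N) (ι-suc ℓ))) ⟩
      excess                                                             ∎
      where
      ring : ∀ k x r b → k * (x - r * b) ≡ k * x - (r * k) * b
      ring = solve-∀ ℚ-ring

    difference≥bound : κ⁺ - κ ≥ bound n (suc ℓ)
    difference≥bound = 0≤y-x⇒x≤y (*-cancelˡ-nonNeg (0≤ι K) (ι≢0 K≢0) (subst (0ℚ ≤_) (sym scaled-excess) 0≤excess))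

    equality⇒tight : κ⁺ - κ ≡ bound n (suc ℓ) → Tight
    equality⇒tight eq = excess≡0⇒tight (trans (sym scaled-excess)
      (trans (cong (ι K *_) (trans (cong (_- bound n (suc ℓ)) eq) (ℚ.+-inverseʳ (bound n (suc ℓ))))) (ℚ.*-zeroʳ (ι K))))

    tight⇒equality : Tight → κ⁺ - κ ≡ bound n (suc ℓ)
    tight⇒equality tight = x-y≡0⇒x≡y (*-zero-factor (ι≢0 K≢0) (trans scaled-excess (tight⇒excess≡0 tight)))

-- The extremal trees

-- Supplies the families of pendent vertices, whose lengths only the equality argument determines.
enumerate : ∀ {n} {X : Fin n → Set} → (∀ i → Dec (X i)) →
            ∃ λ a → Σ[ φ ∈ (Fin a → Fin n) ] (∀ {s t} → φ s ≡ φ t → s ≡ t) × (∀ s → X (φ s)) × (∀ i → X i → ∃ λ s → φ s ≡ i)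
enumerate {zero}  X? = 0 , (λ ()) , (λ { {()} }) , (λ ()) , λ ()
enumerate {suc n} {X} X? with X? zero | enumerate (λ i → X? (suc i))
... | no ¬x₀ | a , φ , inj , sound , complete = a , suc ∘ φ , inj ∘ Fin.suc-injective , sound , complete′
  where
  complete′ : ∀ i → X i → ∃ λ s → suc (φ s) ≡ i
  complete′ zero    x = ⊥-elim (¬x₀ x)
  complete′ (suc i) x = complete i x .proj₁ , cong suc (complete i x .proj₂)
... | yes x₀ | a , φ , inj , sound , complete = suc a , φ′ , inj′ , sound′ , complete′
  where
  φ′ : Fin (suc a) → Fin (suc n)
  φ′ zero    = zero
  φ′ (suc s) = suc (φ s)
  inj′ : ∀ {s t} → φ′ s ≡ φ′ t → s ≡ t
  inj′ {zero}  {zero}  eq = refl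
  inj′ {suc s} {suc t} eq = cong suc (inj (Fin.suc-injective eq))
  sound′ : ∀ s → X (φ′ s)
  sound′ zero    = x₀
  sound′ (suc s) = sound s
  complete′ : ∀ i → X i → ∃ λ s → φ′ s ≡ i
  complete′ zero    x = zero , refl
  complete′ (suc i) x = suc (complete i x .proj₁) , cong suc (complete i x .proj₂)

-- `a` is a root of the quadratic with roots `c` and `d`, so (a - c)(a - d) vanishes.
sum-product : ∀ {a b c d : ℚ} → a + b ≡ c + d → a * b ≡ c * d → (a ≡ c × b ≡ d) ⊎ (a ≡ d × b ≡ c)
sum-product {a} {b} {c} {d} sum≡ product≡ = split (a ℚ.≟ c)
  where
  ring : ∀ a b c d → (a - c) * (a - d) ≡ (a * ((a + b) - (c + d))) + (c * d - a * b)
  ring = solve-∀ ℚ-ring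
  ring′ : ∀ s p a → (a * (s - s)) + (p - p) ≡ 0ℚ
  ring′ = solve-∀ ℚ-ring
  ring″ : ∀ a b → b ≡ (a + b) - a
  ring″ = solve-∀ ℚ-ring
  ring‴ : ∀ c d → (c + d) - d ≡ c
  ring‴ = solve-∀ ℚ-ring
  root : (a - c) * (a - d) ≡ 0ℚ
  root = trans (ring a b c d) (trans (cong₂ (λ s p → (a * (s - (c + d))) + (c * d - p)) sum≡ product≡) (ring′ (c + d) (c * d) a))
  split : Dec (a ≡ c) → (a ≡ c × b ≡ d) ⊎ (a ≡ d × b ≡ c)
  split (yes a≡c) = inj₁ (a≡c , trans (ring″ a b) (trans (cong₂ _-_ sum≡ a≡c) (trans (cong (_- c) (ℚ.+-comm c d)) (ring‴ d c))))
  split (no a≢c)  = inj₂ (a≡d , trans (ring″ a b) (trans (cong₂ _-_ sum≡ a≡d) (ring‴ c d)))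
    where
    a≡d : a ≡ d
    a≡d = x-y≡0⇒x≡y (*-zero-factor {a - c} (a≢c ∘ x-y≡0⇒x≡y) root)

module Equality {n} (2≤n : 2 ℕ.≤ n) (H : Graph n) (conn : Connected H) (acyclic : Acyclic H)
                {ℓ x y} (π : Path H ℓ x y) (x≢y : x ≢ y) (¬adj : ¬ Adj H x y) where
  open Distance H conn
  open TreeLaplacian H conn acyclic
  open PathProfile H conn acyclic π
  open PathLaplacian H conn acyclic π
  open Unicyclic H conn acyclic π x≢y ¬adj
  open Slack 2≤n H conn acyclic π x≢y ¬adj
  open Bound 2≤n H conn acyclic π x≢y ¬adj
  open Path π using (injective) renaming (vertex to v)
  open OffPath v injective

  module Ends {a b} (atStart : Fin a → Fin n) (atEnd : Fin b → Fin n) (e≡ : ∀ i → e i ≡ hits atStart i + hits atEnd i)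
              (pos-atStart : ∀ s → pos (atStart s) ≡ 0) (pos-atEnd : ∀ s → pos (atEnd s) ≡ ℓ) where

    ∑e : ∀ (F : ℕ → ℚ) → ∑ (λ i → e i * F (pos i)) ≡ ι a * F 0 + ι b * F ℓ
    ∑e F = begin
      ∑ (λ i → e i * F (pos i))     ≡⟨ ∑-cong (λ i → trans (cong (_* F (pos i)) (e≡ i)) (ℚ.*-distribʳ-+ (F (pos i)) (hits atStart i) (hits atEnd i))) ⟩
      ∑ (λ i → hits atStart i * F (pos i) + hits atEnd i * F (pos i))
        ≡⟨ trans (∑-+ _ _) (cong₂ _+_ (∑-hits atStart (λ i → F (pos i))) (∑-hits atEnd (λ i → F (pos i)))) ⟩
      ∑ (λ s → F (pos (atStart s))) + ∑ (λ s → F (pos (atEnd s)))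
        ≡⟨ cong₂ _+_ (trans (∑-cong (λ s → cong F (pos-atStart s))) (∑-const a (F 0))) (trans (∑-cong (λ s → cong F (pos-atEnd s))) (∑-const b (F ℓ))) ⟩
      ι a * F 0 + ι b * F ℓ         ∎

    r≡a+b : r ≡ ι a + ι b
    r≡a+b = trans (∑-cong (λ i → sym (ℚ.*-identityʳ (e i)))) (trans (∑e (λ _ → 1ℚ)) (cong₂ _+_ (ℚ.*-identityʳ (ι a)) (ℚ.*-identityʳ (ι b))))

    Q≡bl : Q ≡ ι b * l
    Q≡bl = trans (∑e ι) (trans (cong (_+ ι b * l) (ℚ.*-zeroʳ (ι a))) (ℚ.+-identityˡ (ι b * l)))

    P≡0 : P ≡ 0ℚ
    P≡0 = trans (∑e (λ q → ι q * (l - ι q))) (ring (ι a) (ι b) l)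
      where
      ring : ∀ a b l → a * (0ℚ * (l - 0ℚ)) + b * (l * (l - l)) ≡ 0ℚ
      ring = solve-∀ ℚ-ring

    -- Since `l` is nonzero, a vanishing deficit says that the two counts have the same product as
    -- floor and ceiling.
    deficit≡ : deficit ≡ (l * l) * (f * g - ι a * ι b)
    deficit≡ = trans (cong₂ (λ s z → s + f * g * (l * l) - z) P≡0 (cong₂ (λ q k → q * (k * l - q)) Q≡bl r≡a+b)) (ring f g l (ι a) (ι b))
      where
      ring : ∀ f g l a b → 0ℚ + f * g * (l * l) - (b * l) * ((a + b) * l - b * l) ≡ (l * l) * (f * g - a * b)
      ring = solve-∀ ℚ-ring

  pendent-distance : ∀ {z u} → PendentAt H z u → ∀ {k} → u ≢ k → D u k ≡ suc (D z k)
  pendent-distance {z} pend {k} u≢k with closer u≢k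
  ... | w , adj , eq = trans eq (cong (λ w → suc (D w k)) (Equivalence.to (pend w) adj))

  pendent-distance-ℚ : ∀ {z u} → PendentAt H z u → ∀ {k} → u ≢ k → Dℚ u k ≡ 1ℚ + Dℚ z k
  pendent-distance-ℚ {z} pend {k} u≢k = trans (cong ι (pendent-distance pend u≢k)) (ι-suc (D z k))

  p-h : ∀ {i s t} → Dℚ i x ≡ s → Dℚ i y ≡ t → p i ≡ ½ * ((s - t) + l) × h i ≡ ½ * ((s + t) - l)
  p-h {i} eq eq′ = trans (p≡ i) (cong₂ (λ s t → ½ * ((s - t) + l)) eq eq′)
                 , trans (h≡ i) (cong₂ (λ s t → ½ * ((s + t) - l)) eq eq′)

  Dxy : Dℚ x y ≡ l
  Dxy = trans (D-end-ℚ x) (trans (cong₂ (λ a b → (l - ι a) + ι b) pos-start height-start) (ring l))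
    where
    ring : ∀ l → (l - 0ℚ) + 0ℚ ≡ l
    ring = solve-∀ ℚ-ring

  slack-≢ : ∀ {i j} → i ≢ j → slack i j ≡ (t i j + h i + h j) - Dℚ i j
  slack-≢ {i} {j} i≢j = trans (cong (λ a → (1ℚ - a) * (t i j + h i + h j) - Dℚ i j) (δ-≢ i≢j)) (ring (t i j + h i + h j) (Dℚ i j))
    where
    ring : ∀ x y → (1ℚ - 0ℚ) * x - y ≡ x - y
    ring = solve-∀ ℚ-ring

  slack-≡ : ∀ i → slack i i ≡ 0ℚ
  slack-≡ i = trans (cong₂ (λ a b → (1ℚ - a) * (t i i + h i + h i) - b) (δ-refl i) (cong ι (D-refl i))) (ring (t i i + h i + h i))
    where
    ring : ∀ x → (1ℚ - 1ℚ) * x - 0ℚ ≡ 0ℚ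
    ring = solve-∀ ℚ-ring

  -- `D-v` is exact from a path vertex, so only off-path vertices can waste distance.
  slack-path : ∀ s j → slack (v s) j ≡ 0ℚ
  slack-path s j = split (v s ≟ j)
    where
    split : Dec (v s ≡ j) → slack (v s) j ≡ 0ℚ
    split (yes refl) = slack-≡ (v s)
    split (no  vs≢j) = trans (slack-≢ vs≢j) (trans (cong₂ (λ a b → (t (v s) j + a + h j) - b) (cong ι (height-v s))
        (trans (cong ι (D-v s j)) (trans (ι-+ ℕ.∣ toℕ s - pos j ∣ (height j)) (cong (λ q → ι ℕ.∣ q - pos j ∣ + h j) (sym (pos-v s))))))
      (ring (t (v s) j) (h j)))
      where
      ring : ∀ t h → (t + 0ℚ + h) - (t + h) ≡ 0ℚ
      ring = solve-∀ ℚ-ring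

  -- Every walk leaving `u` goes through `z`, at a cost of one step, which the height accounts for;
  -- `via` places `z` on the path at the position of `u`.
  slack-pendent : ∀ {u z} → PendentAt H z u → h u ≡ 1ℚ → (∀ k → Dℚ z k ≡ t u k + h k) → ∀ k → slack u k ≡ 0ℚ
  slack-pendent {u} {z} pend h≡1 via k = split (u ≟ k)
    where
    ring : ∀ t h → (t + 1ℚ + h) - (1ℚ + (t + h)) ≡ 0ℚ
    ring = solve-∀ ℚ-ring
    split : Dec (u ≡ k) → slack u k ≡ 0ℚ
    split (yes refl) = slack-≡ u
    split (no  u≢k)  = trans (slack-≢ u≢k) (trans (cong₂ (λ a b → (t u k + a + h k) - b) h≡1
      (trans (pendent-distance-ℚ pend u≢k) (cong (1ℚ +_) (via k)))) (ring (t u k) (h k)))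

  module FromPendents {a b} (pendents : PathWithPendents H π a b) where
    open PathWithPendents pendents

    φ : Fin (suc ℓ) ⊎ (Fin a ⊎ Fin b) → Fin n
    φ = Sum.[ v , Sum.[ atStart , atEnd ] ]

    φ-inj : ∀ {s t} → φ s ≡ φ t → s ≡ t
    φ-inj = vertices .proj₁

    φ-surj : ∀ i → ∃ λ s → φ s ≡ i
    φ-surj i = vertices .proj₂ i .proj₁ , vertices .proj₂ i .proj₂ refl

    Off : Fin n → Set
    Off i = ∀ s → i ≢ v s

    start-off : ∀ s → Off (atStart s)
    start-off s s′ eq with φ-inj {inj₂ (inj₁ s)} {inj₁ s′} eq
    ... | ()

    end-off : ∀ s → Off (atEnd s)
    end-off s s′ eq with φ-inj {inj₂ (inj₂ s)} {inj₁ s′} eq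
    ... | ()

    start≢end : ∀ s s′ → atStart s ≢ atEnd s′
    start≢end s s′ eq with φ-inj {inj₂ (inj₁ s)} {inj₂ (inj₂ s′)} eq
    ... | ()

    off⇒≢x : ∀ {i} → Off i → i ≢ x
    off⇒≢x off eq = off zero (trans eq (sym (Path.start π)))

    off⇒≢y : ∀ {i} → Off i → i ≢ y
    off⇒≢y off eq = off (fromℕ ℓ) (trans eq (sym (Path.end π)))

    off⇒e≡1 : ∀ {i} → Off i → e i ≡ 1ℚ
    off⇒e≡1 off = e-off (λ (s , eq) → off s (sym eq))

    e≡ : ∀ i → e i ≡ hits atStart i + hits atEnd i
    e≡ i = split (φ-surj i)
      where
      split : (∃ λ s → φ s ≡ i) → e i ≡ hits atStart i + hits atEnd i
      split (inj₁ s , refl) = trans (e-on (s , refl)) (sym (cong₂ _+_ (hits-outside atStart (λ s′ → start-off s′ s)) (hits-outside atEnd (λ s′ → end-off s′ s))))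
      split (inj₂ (inj₁ s) , refl) = trans (off⇒e≡1 (start-off s)) (sym (cong₂ _+_
        (hits-image atStart (λ {s} {t} eq → inj₁-injective (inj₂-injective (φ-inj {inj₂ (inj₁ s)} {inj₂ (inj₁ t)} eq))) s)
        (hits-outside atEnd (λ s′ eq → start≢end s s′ (sym eq)))))
      split (inj₂ (inj₂ s) , refl) = trans (off⇒e≡1 (end-off s)) (sym (cong₂ _+_
        (hits-outside atStart (λ s′ eq → start≢end s′ s eq))
        (hits-image atEnd (λ {s} {t} eq → inj₂-injective (inj₂-injective (φ-inj {inj₂ (inj₂ s)} {inj₂ (inj₂ t)} eq))) s)))

    -- The distances to the two ends, 1 and 1 + l, determine foot and height.
    p-h-start : ∀ s → p (atStart s) ≡ 0ℚ × h (atStart s) ≡ 1ℚ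
    p-h-start s = trans (ph .proj₁) (ring₁ l) , trans (ph .proj₂) (ring₂ l)
      where
      ring₁ : ∀ l → ½ * (((1ℚ + 0ℚ) - (1ℚ + l)) + l) ≡ 0ℚ
      ring₁ = solve-∀ ℚ-ring
      ring₂ : ∀ l → ½ * (((1ℚ + 0ℚ) + (1ℚ + l)) - l) ≡ 1ℚ
      ring₂ = solve-∀ ℚ-ring
      ph = p-h {atStart s} {1ℚ + 0ℚ} {1ℚ + l}
        (trans (pendent-distance-ℚ (pendStart s) (off⇒≢x (start-off s))) (cong (1ℚ +_) (cong ι (D-refl x))))
        (trans (pendent-distance-ℚ (pendStart s) (off⇒≢y (start-off s))) (cong (1ℚ +_) Dxy))

    p-h-end : ∀ s → p (atEnd s) ≡ l × h (atEnd s) ≡ 1ℚ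
    p-h-end s = trans (ph .proj₁) (ring₁ l) , trans (ph .proj₂) (ring₂ l)
      where
      ring₁ : ∀ l → ½ * (((1ℚ + l) - (1ℚ + 0ℚ)) + l) ≡ l
      ring₁ = solve-∀ ℚ-ring
      ring₂ : ∀ l → ½ * (((1ℚ + l) + (1ℚ + 0ℚ)) - l) ≡ 1ℚ
      ring₂ = solve-∀ ℚ-ring
      ph = p-h {atEnd s} {1ℚ + l} {1ℚ + 0ℚ}
        (trans (pendent-distance-ℚ (pendEnd s) (off⇒≢x (end-off s))) (cong (1ℚ +_) (trans (cong ι (D-sym y x)) Dxy)))
        (trans (pendent-distance-ℚ (pendEnd s) (off⇒≢y (end-off s))) (cong (1ℚ +_) (cong ι (D-refl y))))

    pos-atStart : ∀ s → pos (atStart s) ≡ 0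
    pos-atStart s = ι-injective {pos (atStart s)} {0} (p-h-start s .proj₁)

    pos-atEnd : ∀ s → pos (atEnd s) ≡ ℓ
    pos-atEnd s = ι-injective {pos (atEnd s)} {ℓ} (p-h-end s .proj₁)

    open Ends atStart atEnd e≡ pos-atStart pos-atEnd

    slack≡0 : ∀ i k → slack i k ≡ 0ℚ
    slack≡0 i k = split (φ-surj i)
      where
      split : (∃ λ s → φ s ≡ i) → slack i k ≡ 0ℚ
      split (inj₁ s , refl) = slack-path s k
      split (inj₂ (inj₁ s) , refl) = slack-pendent (pendStart s) (p-h-start s .proj₂)
        (λ k → trans (cong ι (D-sym x k)) (trans (D-start-ℚ k) (cong (λ q → ι ℕ.∣ q - pos k ∣ + h k) (sym (pos-atStart s))))) k
      split (inj₂ (inj₂ s) , refl) = slack-pendent (pendEnd s) (p-h-end s .proj₂)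
        (λ k → trans (cong ι (D-sym y k)) (trans (D-end-ℚ k) (cong (_+ h k)
          (trans (sym (ι-∸ (pos≤ℓ k))) (cong ι (trans (sym (ℕ.m≤n⇒∣n-m∣≡n∸m (pos≤ℓ k))) (cong (λ q → ℕ.∣ q - pos k ∣) (sym (pos-atEnd s)))))))))
        k

    tight : ι a * ι b ≡ f * g → Tight
    tight ab≡fg = slack≡0 , P≡0 , trans deficit≡ (trans (cong (λ z → (l * l) * (f * g - z)) ab≡fg)
      (trans (cong ((l * l) *_) (ℚ.+-inverseʳ (f * g))) (ℚ.*-zeroʳ (l * l))))

  balanced⇒tight : Balanced H π → Tight
  balanced⇒tight (inj₁ pendents) = FromPendents.tight pendents refl
  balanced⇒tight (inj₂ pendents) = FromPendents.tight pendents (ℚ.*-comm g f)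

  module FromTight (tight : Tight) where

    Off : Fin n → Set
    Off i = ¬ (∃ λ s → v s ≡ i)

    -- Off the path the weight `e` is one, so the vanishing of `P` gives pᵢ(l - pᵢ) = 0.
    end-pos : ∀ i → Off i → pos i ≢ 0 → pos i ≡ ℓ
    end-pos i off pos≢0 = ι-injective {pos i} {ℓ} (sym (x-y≡0⇒x≡y (*-zero-factor {p i} (ι≢0 pos≢0)
      (trans (sym (ℚ.*-identityˡ (p i * (l - p i)))) (trans (cong (_* (p i * (l - p i))) (sym (e-off off))) (∑-nonNeg≡0 0≤P-term (tight .proj₂ .proj₁) i))))))

    -- |pᵢ - pᵤ| + hᵢ + hᵤ = D(i,u) = 1 and hᵢ > 0.
    neighbour-foot : ∀ {i u} → Off i → Adj H i u → ∃ λ s → u ≡ v s × toℕ s ≡ pos i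
    neighbour-foot {i} {u} off adj = foot u , height≡0⇒on-path u hᵤ≡0 , trans (toℕ-foot u) (sym pᵢ≡pᵤ)
      where
      i≢u : i ≢ u
      i≢u = Adj⇒≢ H adj
      T≡ : ℕ.∣ pos i - pos u ∣ ℕ.+ height i ℕ.+ height u ≡ D i u
      T≡ = ι-injective {ℕ.∣ pos i - pos u ∣ ℕ.+ height i ℕ.+ height u} {D i u}
        (trans (ι-+ (ℕ.∣ pos i - pos u ∣ ℕ.+ height i) (height u)) (trans (cong (_+ h u) (ι-+ ℕ.∣ pos i - pos u ∣ (height i)))
          (x-y≡0⇒x≡y (trans (sym (slack-≢ i≢u)) (tight .proj₁ i u)))))
      D≤1 : D i u ℕ.≤ 1
      D≤1 = D-min (adj ∷ [])
      hᵢ≢0 : height i ≢ 0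
      hᵢ≢0 h≡0 = off (foot i , sym (height≡0⇒on-path i h≡0))
      rest : ∀ {t h k} → h ≢ 0 → t ℕ.+ h ℕ.+ k ℕ.≤ 1 → t ≡ 0 × k ≡ 0
      rest {t}     {zero}  {k}     h≢0 _  = ⊥-elim (h≢0 refl)
      rest {zero}  {suc h} {k}     _ (ℕ.s≤s le) = refl , ℕ.m+n≡0⇒n≡0 h (ℕ.n≤0⇒n≡0 le)
      rest {suc t} {suc h} {k}     _ (ℕ.s≤s le) = ⊥-elim (ℕ.m+1+n≢0 t (ℕ.m+n≡0⇒m≡0 (t ℕ.+ suc h) (ℕ.n≤0⇒n≡0 le)))
      both≡0 : ℕ.∣ pos i - pos u ∣ ≡ 0 × height u ≡ 0
      both≡0 = rest {ℕ.∣ pos i - pos u ∣} {height i} {height u} hᵢ≢0 (ℕ.≤-trans (ℕ.≤-reflexive T≡) D≤1)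
      hᵤ≡0 : height u ≡ 0
      hᵤ≡0 = both≡0 .proj₂
      pᵢ≡pᵤ : pos i ≡ pos u
      pᵢ≡pᵤ = ℕ.∣m-n∣≡0⇒m≡n (both≡0 .proj₁)

    -- By `neighbour-foot` the foot is the only possible neighbour, and connectedness supplies at
    -- least one, so the foot is indeed adjacent.
    pendent-at : ∀ {i} s → Off i → pos i ≡ toℕ s → PendentAt H (v s) i
    pendent-at {i} s off eq w = mk⇔ to (λ { refl → from })
      where
      to : ∀ {w} → Adj H i w → w ≡ v s
      to adj = let s′ , w≡ , s′≡ = neighbour-foot off adj in trans w≡ (cong v (Fin.toℕ-injective (trans s′≡ eq)))
      from : Adj H i (v s)
      from = let u , adj = neighbour H conn (λ i≡ → off (s , sym i≡)) in subst (Adj H i) (to adj) adj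

    -- Complementary by decision off the path; `end-pos` turns the inequality in `End` into position
    -- ℓ.
    Start End : Fin n → Set
    Start i = Off i × pos i ≡ 0
    End i = Off i × pos i ≢ 0

    starts = enumerate {n} {Start} (λ i → ¬? (on? i) ×-dec (pos i ℕ.≟ 0))
    ends = enumerate {n} {End} (λ i → ¬? (on? i) ×-dec ¬? (pos i ℕ.≟ 0))

    a b : ℕ
    a = starts .proj₁
    b = ends .proj₁

    atStart : Fin a → Fin n
    atStart = starts .proj₂ .proj₁

    atEnd : Fin b → Fin n
    atEnd = ends .proj₂ .proj₁

    atStart-inj : ∀ {s t} → atStart s ≡ atStart t → s ≡ t
    atStart-inj = starts .proj₂ .proj₂ .proj₁

    atEnd-inj : ∀ {s t} → atEnd s ≡ atEnd t → s ≡ t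
    atEnd-inj = ends .proj₂ .proj₂ .proj₁

    is-start : ∀ s → Start (atStart s)
    is-start = starts .proj₂ .proj₂ .proj₂ .proj₁

    is-end : ∀ s → End (atEnd s)
    is-end = ends .proj₂ .proj₂ .proj₂ .proj₁

    all-starts : ∀ i → Start i → ∃ λ s → atStart s ≡ i
    all-starts = starts .proj₂ .proj₂ .proj₂ .proj₂

    all-ends : ∀ i → End i → ∃ λ s → atEnd s ≡ i
    all-ends = ends .proj₂ .proj₂ .proj₂ .proj₂

    φ : Fin (suc ℓ) ⊎ (Fin a ⊎ Fin b) → Fin n
    φ = Sum.[ v , Sum.[ atStart , atEnd ] ]

    start≢end : ∀ s s′ → atStart s ≢ atEnd s′
    start≢end s s′ eq = is-end s′ .proj₂ (trans (cong pos (sym eq)) (is-start s .proj₂))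

    φ-inj : ∀ {s t} → φ s ≡ φ t → s ≡ t
    φ-inj {inj₁ s}        {inj₁ t}        eq = cong inj₁ (injective eq)
    φ-inj {inj₁ s}        {inj₂ (inj₁ t)} eq = ⊥-elim (is-start t .proj₁ (s , eq))
    φ-inj {inj₁ s}        {inj₂ (inj₂ t)} eq = ⊥-elim (is-end t .proj₁ (s , eq))
    φ-inj {inj₂ (inj₁ s)} {inj₁ t}        eq = ⊥-elim (is-start s .proj₁ (t , sym eq))
    φ-inj {inj₂ (inj₂ s)} {inj₁ t}        eq = ⊥-elim (is-end s .proj₁ (t , sym eq))
    φ-inj {inj₂ (inj₁ s)} {inj₂ (inj₁ t)} eq = cong (inj₂ ∘ inj₁) (atStart-inj eq)
    φ-inj {inj₂ (inj₂ s)} {inj₂ (inj₂ t)} eq = cong (inj₂ ∘ inj₂) (atEnd-inj eq)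
    φ-inj {inj₂ (inj₁ s)} {inj₂ (inj₂ t)} eq = ⊥-elim (start≢end s t eq)
    φ-inj {inj₂ (inj₂ s)} {inj₂ (inj₁ t)} eq = ⊥-elim (start≢end t s (sym eq))

    φ-surj : ∀ i → ∃ λ s → φ s ≡ i
    φ-surj i = split (on? i) (pos i ℕ.≟ 0)
      where
      split : Dec (∃ λ s → v s ≡ i) → Dec (pos i ≡ 0) → ∃ λ s → φ s ≡ i
      split (yes (s , eq)) _           = inj₁ s , eq
      split (no off)       (yes pos≡0) = let s , eq = all-starts i (off , pos≡0) in inj₂ (inj₁ s) , eq
      split (no off)       (no pos≢0)  = let s , eq = all-ends i (off , pos≢0) in inj₂ (inj₂ s) , eq

    pendents : PathWithPendents H π a b
    pendents = record
      { atStart   = atStart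
      ; atEnd     = atEnd
      ; vertices  = φ-inj , λ i → φ-surj i .proj₁ , λ { refl → φ-surj i .proj₂ }
      ; pendStart = λ s → subst (λ z → PendentAt H z (atStart s)) (Path.start π) (pendent-at zero (is-start s .proj₁) (is-start s .proj₂))
      ; pendEnd   = λ s → subst (λ z → PendentAt H z (atEnd s)) (Path.end π)
          (pendent-at (fromℕ ℓ) (is-end s .proj₁) (trans (end-pos (atEnd s) (is-end s .proj₁) (is-end s .proj₂)) (sym (Fin.toℕ-fromℕ ℓ))))
      }

    open Ends atStart atEnd (FromPendents.e≡ pendents) (FromPendents.pos-atStart pendents) (FromPendents.pos-atEnd pendents)

    balanced : Balanced H π
    -- Both pairs of counts sum to `r`, and the vanishing deficit equates their products.
    balanced = split (sum-product {ι a} {ι b} {f} {g} (trans (sym r≡a+b) (sym f+g≡r))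
        (sym (x-y≡0⇒x≡y (*-zero-factor l²≢0 (trans (sym deficit≡) (tight .proj₂ .proj₂))))))
      where
      l²≢0 : l * l ≢ 0ℚ
      l²≢0 eq = l≢0 (square≡0⇒≡0 eq)
      F = ⌊ n ℕ.∸ suc ℓ /2⌋
      C = ⌈ n ℕ.∸ suc ℓ /2⌉
      split : (ι a ≡ f × ι b ≡ g) ⊎ (ι a ≡ g × ι b ≡ f) → Balanced H π
      split (inj₁ (a≡f , b≡g)) = inj₁ (subst₂ (PathWithPendents H π) (ι-injective {a} {F} a≡f) (ι-injective {b} {C} b≡g) pendents)
      split (inj₂ (a≡g , b≡f)) = inj₂ (subst₂ (PathWithPendents H π) (ι-injective {a} {C} a≡g) (ι-injective {b} {F} b≡f) pendents)

theorem4p1 : (n : ℕ) → 4 ℕ.≤ n →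
    (T : Graph n) → IsTree T →
    (v₁ v_c : Fin n) (v₁≢v_c : v₁ ≢ v_c) → ¬ Adj T v₁ v_c →
    (ℓ : ℕ) (π : Path T ℓ v₁ v_c) →
    (κT κG : ℚ) →
    IsKemenyConstant T κT →
    IsKemenyConstant (addEdge T v₁ v_c v₁≢v_c) κG →
    (κG - κT ≥ bound n (suc ℓ)) ×
    ((κG - κT ≡ bound n (suc ℓ)) ⇔ Balanced T π)
theorem4p1 n 4≤n T (conn , acyclic) v₁ v_c v₁≢v_c ¬adj ℓ π κT κG kemT kemG =
    B.difference≥bound kemT kemG
  , mk⇔ (λ eq → E.FromTight.balanced (B.equality⇒tight kemT kemG eq))
        (λ bal → B.tight⇒equality kemT kemG (E.balanced⇒tight bal))
  where
  2≤n : 2 ℕ.≤ n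
  2≤n = ℕ.≤-trans (ℕ.s≤s (ℕ.s≤s ℕ.z≤n)) 4≤n
  module B = Bound 2≤n T conn acyclic π v₁≢v_c ¬adj
  module E = Equality 2≤n T conn acyclic π v₁≢v_c ¬adj
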